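{- There exists an absolute constant $K>0$ such that for every integer $d\geq 1$, every almost-equidistant set $V\subset\mathbb{R}^d$ is finite and satisfies $|V|\leq K d^{4/3}$. That is, an almost-equidistant set in $\mathbb{R}^d$ has cardinality $O(d^{4/3})$.
   Context: $\mathbb{R}^d$ is $d$-dimensional Euclidean space with the Euclidean norm $\|\cdot\|$. A subset $V\subseteq\mathbb{R}^d$ is called almost equidistant if among any three distinct points of $V$, some two are at Euclidean distance exactly $1$. -}

module Defs where

open import Algebra.Bundles using (RawRing)
import Algebra.Definitions.RawSemiring
open import Data.Fin.Base using (Fin)
open import Data.Integer.Base using (+_)
open import Data.Nat.Base as ℕ using (ℕ)
import Data.Nat.Properties as ℕ
open import Data.Product.Base using (_×_; _,_; proj₁; ∃-syntax)
open import Data.Rational.Base as ℚ using (ℚ; 0ℚ; 1ℚ; ½; ∣_∣)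
import Data.Rational.Properties as ℚ
open import Data.Rational.Solver using (module +-*-Solver)
open import Data.Sum.Base using (_⊎_)
open import Data.Vec.Functional using (Vector; map; zipWith)
import Data.Vec.Functional.Relation.Binary.Equality.Setoid as VecEq
open import Function.Bundles using (Bijection)
open import Level using (0ℓ)
open import Relation.Binary.Bundles using (Setoid)
open import Relation.Binary.Definitions using (_Respects_)
import Relation.Binary.Construct.On as On
open import Relation.Binary.PropositionalEquality as ≡ using (_≡_; refl; cong; cong₂; subst)
open import Relation.Nullary.Negation.Core using (¬_)
open import Relation.Unary using (Pred)

------------------------------------------------------------------------
-- The real numbers, as Cauchy sequences of rationals modulo null sequences

IsCauchy : (ℕ → ℚ) → Set
IsCauchy x = ∀ ε → 0ℚ ℚ.< ε →
  ∃[ N ] (∀ m n → N ℕ.≤ m → N ℕ.≤ n → ∣ x m ℚ.- x n ∣ ℚ.< ε)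

record ℝ : Set where
  constructor mkℝ
  field
    seq    : ℕ → ℚ
    cauchy : IsCauchy seq

open ℝ public

infix 4 _≈_ _≤_ _<_ _≉_

record _≈_ (x y : ℝ) : Set where
  constructor mk≈
  field
    close : ∀ ε → 0ℚ ℚ.< ε →
      ∃[ N ] (∀ n → N ℕ.≤ n → ∣ seq x n ℚ.- seq y n ∣ ℚ.< ε)

record _≤_ (x y : ℝ) : Set where
  constructor mk≤
  field
    below : ∀ ε → 0ℚ ℚ.< ε →
      ∃[ N ] (∀ n → N ℕ.≤ n → seq x n ℚ.< seq y n ℚ.+ ε)

record _<_ (x y : ℝ) : Set where
  constructor mk<
  field
    gap   : ℚ
    gap>0 : 0ℚ ℚ.< gap
    apart : ∃[ N ] (∀ n → N ℕ.≤ n → seq x n ℚ.+ gap ℚ.≤ seq y n)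

_≉_ : ℝ → ℝ → Set
x ≉ y = ¬ (x ≈ y)

private

  half>0 : ∀ {ε} → 0ℚ ℚ.< ε → 0ℚ ℚ.< ½ ℚ.* ε
  half>0 {ε} ε>0 = subst (ℚ._< ½ ℚ.* ε) (ℚ.*-zeroʳ ½) (ℚ.*-monoʳ-<-pos ½ ε>0)

  half+half : ∀ ε → ½ ℚ.* ε ℚ.+ ½ ℚ.* ε ≡ ε
  half+half ε = ≡.trans (≡.sym (ℚ.*-distribʳ-+ ε ½ ½)) (ℚ.*-identityˡ ε)

  ∣p-p∣≡0 : ∀ p → ∣ p ℚ.- p ∣ ≡ 0ℚ
  ∣p-p∣≡0 p = cong ∣_∣ (ℚ.+-inverseʳ p)

  ∣p-q∣≡∣q-p∣ : ∀ p q → ∣ p ℚ.- q ∣ ≡ ∣ q ℚ.- p ∣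
  ∣p-q∣≡∣q-p∣ p q = ≡.trans (≡.sym (ℚ.∣-p∣≡∣p∣ (p ℚ.- q)))
    (cong ∣_∣ (solve 2 (λ a b → :- (a :- b) := b :- a) refl p q))
    where open +-*-Solver

  triangle : ∀ p q r → ∣ p ℚ.- r ∣ ℚ.≤ ∣ p ℚ.- q ∣ ℚ.+ ∣ q ℚ.- r ∣
  triangle p q r = subst (λ t → ∣ t ∣ ℚ.≤ ∣ p ℚ.- q ∣ ℚ.+ ∣ q ℚ.- r ∣)
    (solve 3 (λ a b c → (a :- b) :+ (b :- c) := a :- c) refl p q r)
    (ℚ.∣p+q∣≤∣p∣+∣q∣ (p ℚ.- q) (q ℚ.- r))
    where open +-*-Solver

≈-refl : ∀ {x} → x ≈ x
≈-refl {x} = mk≈ λ ε ε>0 → 0 , λ n _ →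
  subst (ℚ._< ε) (≡.sym (∣p-p∣≡0 (seq x n))) ε>0

≈-sym : ∀ {x y} → x ≈ y → y ≈ x
≈-sym {x} {y} (mk≈ p) = mk≈ λ ε ε>0 → let N , h = p ε ε>0 in N , λ n N≤n →
  subst (ℚ._< ε) (∣p-q∣≡∣q-p∣ (seq x n) (seq y n)) (h n N≤n)

≈-trans : ∀ {x y z} → x ≈ y → y ≈ z → x ≈ z
≈-trans {x} {y} {z} (mk≈ p) (mk≈ q) = mk≈ λ ε ε>0 →
  let M , h = p (½ ℚ.* ε) (half>0 ε>0)
      N , k = q (½ ℚ.* ε) (half>0 ε>0)
  in M ℕ.⊔ N , λ n le →
    subst (∣ seq x n ℚ.- seq z n ∣ ℚ.<_) (half+half ε)
      (ℚ.≤-<-trans (triangle (seq x n) (seq y n) (seq z n))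
        (ℚ.+-mono-< (h n (ℕ.m⊔n≤o⇒m≤o M N le)) (k n (ℕ.m⊔n≤o⇒n≤o M N le))))

ℝ-setoid : Setoid 0ℓ 0ℓ
ℝ-setoid = record
  { Carrier       = ℝ
  ; _≈_           = _≈_
  ; isEquivalence = record { refl = ≈-refl ; sym = ≈-sym ; trans = ≈-trans }
  }

fromℚ : ℚ → ℝ
fromℚ p = mkℝ (λ _ → p) λ ε ε>0 → 0 , λ _ _ _ _ →
  subst (ℚ._< ε) (≡.sym (∣p-p∣≡0 p)) ε>0

fromℕ : ℕ → ℝ
fromℕ n = fromℚ (+ n ℚ./ 1)

0ℝ 1ℝ : ℝ
0ℝ = fromℚ 0ℚ
1ℝ = fromℚ 1ℚ

infixl 6 _+_ _-_
infixl 7 _*_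
infix  8 -_

_+_ : ℝ → ℝ → ℝ
mkℝ x cx + mkℝ y cy = mkℝ (λ n → x n ℚ.+ y n) λ ε ε>0 →
  let M , h = cx (½ ℚ.* ε) (half>0 ε>0)
      N , k = cy (½ ℚ.* ε) (half>0 ε>0)
  in M ℕ.⊔ N , λ m n le le′ →
    subst (∣ (x m ℚ.+ y m) ℚ.- (x n ℚ.+ y n) ∣ ℚ.<_) (half+half ε)
      (ℚ.≤-<-trans (bound (x m) (y m) (x n) (y n))
        (ℚ.+-mono-< (h m n (ℕ.m⊔n≤o⇒m≤o M N le) (ℕ.m⊔n≤o⇒m≤o M N le′))
                    (k m n (ℕ.m⊔n≤o⇒n≤o M N le) (ℕ.m⊔n≤o⇒n≤o M N le′))))
  where
  bound : ∀ a b c d → ∣ (a ℚ.+ b) ℚ.- (c ℚ.+ d) ∣ ℚ.≤ ∣ a ℚ.- c ∣ ℚ.+ ∣ b ℚ.- d ∣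
  bound a b c d = subst (λ t → ∣ t ∣ ℚ.≤ ∣ a ℚ.- c ∣ ℚ.+ ∣ b ℚ.- d ∣)
    (solve 4 (λ a b c d → (a :- c) :+ (b :- d) := (a :+ b) :- (c :+ d)) refl a b c d)
    (ℚ.∣p+q∣≤∣p∣+∣q∣ (a ℚ.- c) (b ℚ.- d))
    where open +-*-Solver

-_ : ℝ → ℝ
- mkℝ x cx = mkℝ (λ n → ℚ.- x n) λ ε ε>0 →
  let N , h = cx ε ε>0
  in N , λ m n N≤m N≤n → subst (ℚ._< ε) (flip (x n) (x m)) (h n m N≤n N≤m)
  where
  flip : ∀ a b → ∣ a ℚ.- b ∣ ≡ ∣ (ℚ.- b) ℚ.- (ℚ.- a) ∣
  flip a b = cong ∣_∣ (solve 2 (λ a b → a :- b := (:- b) :- (:- a)) refl a b)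
    where open +-*-Solver

_-_ : ℝ → ℝ → ℝ
x - y = x + - y

private

  eventuallyBounded : ∀ {x} → IsCauchy x →
    ∃[ B ] 0ℚ ℚ.< B × ∃[ N ] (∀ n → N ℕ.≤ n → ∣ x n ∣ ℚ.≤ B)
  eventuallyBounded {x} cx with cx 1ℚ (ℚ.positive⁻¹ 1ℚ)
  ... | N , h = 1ℚ ℚ.+ ∣ x N ∣
              , ℚ.+-mono-<-≤ (ℚ.positive⁻¹ 1ℚ) (ℚ.0≤∣p∣ (x N))
              , N
              , λ n N≤n → ℚ.≤-trans (split (x n) (x N))
                  (ℚ.+-monoˡ-≤ ∣ x N ∣ (ℚ.<⇒≤ (h n N N≤n ℕ.≤-refl)))
    where
    split : ∀ a b → ∣ a ∣ ℚ.≤ ∣ a ℚ.- b ∣ ℚ.+ ∣ b ∣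
    split a b = subst (λ t → ∣ t ∣ ℚ.≤ ∣ a ℚ.- b ∣ ℚ.+ ∣ b ∣)
      (solve 2 (λ a b → (a :- b) :+ b := a) refl a b)
      (ℚ.∣p+q∣≤∣p∣+∣q∣ (a ℚ.- b) b)
      where open +-*-Solver

  divide : ∀ {M ε} → 0ℚ ℚ.< M → 0ℚ ℚ.< ε → ∃[ δ ] 0ℚ ℚ.< δ × M ℚ.* δ ≡ ε
  divide {M} {ε} M>0 ε>0 = r ℚ.* ε , r*ε>0 ,
    ≡.trans (≡.sym (ℚ.*-assoc M r ε))
      (≡.trans (cong (ℚ._* ε) (ℚ.*-inverseʳ M)) (ℚ.*-identityˡ ε))
    where
    instance
      M-pos : ℚ.Positive M
      M-pos = ℚ.positive M>0
      M-nonZero : ℚ.NonZero M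
      M-nonZero = ℚ.pos⇒nonZero M
    r : ℚ
    r = ℚ.1/ M
    r*ε>0 : 0ℚ ℚ.< r ℚ.* ε
    r*ε>0 = subst (ℚ._< r ℚ.* ε) (ℚ.*-zeroʳ r)
      (ℚ.*-monoʳ-<-pos r {{ℚ.1/pos⇒pos M}} ε>0)

  small : ∀ {a b D δ} → 0ℚ ℚ.< D → ∣ a ∣ ℚ.≤ D → ∣ b ∣ ℚ.< δ →
          ∣ a ∣ ℚ.* ∣ b ∣ ℚ.< D ℚ.* δ
  small {a} {b} {D} D>0 a≤D b<δ = ℚ.≤-<-trans
    (ℚ.*-monoʳ-≤-nonNeg ∣ b ∣ {{ℚ.nonNegative (ℚ.0≤∣p∣ b)}} a≤D)
    (ℚ.*-monoʳ-<-pos D {{ℚ.positive D>0}} b<δ)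

  *-bound : ∀ a b c d →
    ∣ a ℚ.* b ℚ.- c ℚ.* d ∣ ℚ.≤ ∣ a ∣ ℚ.* ∣ b ℚ.- d ∣ ℚ.+ ∣ d ∣ ℚ.* ∣ a ℚ.- c ∣
  *-bound a b c d = ≡.subst₂ ℚ._≤_ (cong ∣_∣ (expand a b c d))
    (cong₂ ℚ._+_ (ℚ.∣p*q∣≡∣p∣*∣q∣ a (b ℚ.- d)) (ℚ.∣p*q∣≡∣p∣*∣q∣ d (a ℚ.- c)))
    (ℚ.∣p+q∣≤∣p∣+∣q∣ (a ℚ.* (b ℚ.- d)) (d ℚ.* (a ℚ.- c)))
    where
    open +-*-Solver
    expand : ∀ a b c d →
      a ℚ.* (b ℚ.- d) ℚ.+ d ℚ.* (a ℚ.- c) ≡ a ℚ.* b ℚ.- c ℚ.* d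
    expand = solve 4 (λ a b c d →
      a :* (b :- d) :+ d :* (a :- c) := a :* b :- c :* d) refl

  *-cauchy : ∀ {x y} → IsCauchy x → IsCauchy y → IsCauchy (λ n → x n ℚ.* y n)
  *-cauchy {x} {y} cx cy ε ε>0 =
    let B , B>0 , N₁ , hB = eventuallyBounded {x} cx
        C , C>0 , N₂ , hC = eventuallyBounded {y} cy
        δ , δ>0 , [B+C]δ≡ε = divide (ℚ.+-mono-< B>0 C>0) ε>0
        N₃ , hx = cx δ δ>0
        N₄ , hy = cy δ δ>0
        L = N₁ ℕ.⊔ N₂
        R = N₃ ℕ.⊔ N₄
    in L ℕ.⊔ R , λ m n N≤m N≤n →
      subst (∣ x m ℚ.* y m ℚ.- x n ℚ.* y n ∣ ℚ.<_)
        (≡.trans (≡.sym (ℚ.*-distribʳ-+ δ B C)) [B+C]δ≡ε)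
        (ℚ.≤-<-trans (*-bound (x m) (y m) (x n) (y n))
          (ℚ.+-mono-<
            (small {x m} {y m ℚ.- y n} B>0
              (hB m (ℕ.m⊔n≤o⇒m≤o N₁ N₂ (ℕ.m⊔n≤o⇒m≤o L R N≤m)))
              (hy m n (ℕ.m⊔n≤o⇒n≤o N₃ N₄ (ℕ.m⊔n≤o⇒n≤o L R N≤m)) (ℕ.m⊔n≤o⇒n≤o N₃ N₄ (ℕ.m⊔n≤o⇒n≤o L R N≤n))))
            (small {y n} {x m ℚ.- x n} C>0
              (hC n (ℕ.m⊔n≤o⇒n≤o N₁ N₂ (ℕ.m⊔n≤o⇒m≤o L R N≤n)))
              (hx m n (ℕ.m⊔n≤o⇒m≤o N₃ N₄ (ℕ.m⊔n≤o⇒n≤o L R N≤m)) (ℕ.m⊔n≤o⇒m≤o N₃ N₄ (ℕ.m⊔n≤o⇒n≤o L R N≤n))))))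

_*_ : ℝ → ℝ → ℝ
mkℝ x cx * mkℝ y cy = mkℝ (λ n → x n ℚ.* y n) (*-cauchy {x} {y} cx cy)

ℝ-rawRing : RawRing 0ℓ 0ℓ
ℝ-rawRing = record
  { Carrier = ℝ
  ; _≈_     = _≈_
  ; _+_     = _+_
  ; _*_     = _*_
  ; -_      = -_
  ; 0#      = 0ℝ
  ; 1#      = 1ℝ
  }

open Algebra.Definitions.RawSemiring (RawRing.rawSemiring ℝ-rawRing) public
  using (sum; _^_)

-- Uniquely determines r = d^{4/3}.
_IsFourThirdsPowerOf_ : ℝ → ℕ → Set
r IsFourThirdsPowerOf d = 0ℝ ≤ r × r ^ 3 ≈ fromℕ d ^ 4

------------------------------------------------------------------------
-- Euclidean space

Point : ℕ → Set
Point d = Vector ℝ d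

Point-setoid : ℕ → Setoid 0ℓ 0ℓ
Point-setoid = VecEq.≋-setoid ℝ-setoid

infix 4 _≋_ _≋̸_

_≋_ _≋̸_ : ∀ {d} → Point d → Point d → Set
_≋_ {d} = Setoid._≈_ (Point-setoid d)
x ≋̸ y = ¬ (x ≋ y)

-- The Euclidean norm is given by its graph: ‖ v ‖= r says that r is the
-- nonnegative square root of Σᵢ vᵢ².
‖_‖=_ : ∀ {d} → Point d → ℝ → Set
‖ v ‖= r = 0ℝ ≤ r × r ^ 2 ≈ sum (map (_^ 2) v)

UnitDistance : ∀ {d} → Point d → Point d → Set
UnitDistance x y = ‖ zipWith _-_ x y ‖= 1ℝ

record Subset (d : ℕ) : Set₁ where
  field
    member   : Pred (Point d) 0ℓ
    respects : member Respects _≋_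

  setoid : Setoid 0ℓ 0ℓ
  setoid = On.setoid {B = ∃[ x ] member x} (Point-setoid d) proj₁

infix 4 _∈_

_∈_ : ∀ {d} → Point d → Subset d → Set
x ∈ V = Subset.member V x

AlmostEquidistant : ∀ {d} → Subset d → Set
AlmostEquidistant V = ∀ x y z → x ∈ V → y ∈ V → z ∈ V →
  x ≋̸ y → y ≋̸ z → x ≋̸ z →
  UnitDistance x y ⊎ UnitDistance y z ⊎ UnitDistance x z

HasCardinality : ∀ {d} → Subset d → ℕ → Set
HasCardinality V n = Bijection (≡.setoid (Fin n)) (Subset.setoid V)

{-# OPTIONS --safe #-}

-- Let aᵢⱼ = 1 − ‖vᵢ − vⱼ‖² and join i ≠ j when aᵢⱼ ≠ 0. In an almost-equidistant
-- set this graph is triangle-free, so every neighbourhood is a unit simplex, and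
-- the form a is positive semidefinite on weights with sum 0. For N points,
-- projecting a to such weights gives a Gram matrix of rank at most d, whence
-- (N² − Σ aᵢⱼ)² ≤ d N² Σ aᵢⱼ²; for a simplex this says that it has at most
-- d + 2 points.
--
-- It remains to bound Σ aᵢⱼ². Let σ be the neighbourhood of a vertex of maximal
-- degree k, and let bᵥ be the sum of aᵥⱼ over j in σ. Discard the at most 8k
-- vertices joined to more than a quarter of σ. Bessel's inequality in the simplex
-- σ gives Σ bᵥ² ≤ 12 k² over the remaining vertices, so these are close to a
-- common sphere about the centroid of σ. Comparing the centroid of σ with the
-- centroid of each neighbourhood then bounds Σ aᵢⱼ² by O(N + k √N). With
-- k ≤ d + 2 this yields N² ≤ O(d N + d² √N), hence N = O(d^{4/3}).
module Submission where

open import Algebra.Bundles using (CommutativeRing; RawRing)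
import Algebra.Consequences.Setoid
import Algebra.Properties.Ring
import Algebra.Properties.Semiring.Mult.TCOptimised
import Algebra.Properties.Semiring.Sum
import Algebra.Solver.Ring
open import Algebra.Solver.Ring.AlmostCommutativeRing
  using (_-Raw-AlmostCommutative⟶_; fromCommutativeRing)
open import Axiom.ExcludedMiddle using (ExcludedMiddle)
open import Data.Fin.Base using (Fin; zero; suc)
import Data.Fin.Properties as Fin
open import Data.Integer.Base as ℤ using (ℤ)
import Data.Integer.Properties as ℤ
open import Data.Maybe.Base using (Maybe; just; nothing)
open import Data.Nat.Base as ℕ using (ℕ; zero; suc)
import Data.Nat.Properties as ℕ
open import Data.Product.Base using (_×_; _,_; proj₁; proj₂; ∃; ∃-syntax)
open import Data.Rational.Base as ℚ using (ℚ; 0ℚ; 1ℚ; ½; ∣_∣)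
import Data.Rational.Properties as ℚ
open import Data.Rational.Solver using (module +-*-Solver)
import Data.Rational.Unnormalised.Base as ℚᵘ
import Data.Rational.Unnormalised.Properties as ℚᵘ
open import Data.Sum.Base as Sum using (_⊎_; inj₁; inj₂)
open import Data.Vec.Functional using (map; zipWith)
open import Level using (0ℓ)
open import Relation.Binary.Bundles using (Poset; Setoid)
open import Relation.Binary.Core using (Rel)
open import Relation.Binary.Definitions using (Decidable)
open import Relation.Binary.PropositionalEquality as ≡ using (_≡_)
import Relation.Binary.Reasoning.PartialOrder
import Relation.Binary.Reasoning.Setoid
open import Relation.Binary.Structures using (IsTotalOrder)
open import Relation.Nullary using (¬_; yes; no; contradiction)
open import Relation.Nullary.Decidable using (toSum)

-- Bessel's inequality in a simplex controls the row sum b of a vertex only if the vertex is joined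
-- to a small part of that simplex. With m joined points out of k, Cauchy-Schwarz gives b² ≤ m q for
-- the sum q of squares, and k q ≤ k + (1 - b)² then bounds b only when m is well below k; hence the
-- discarded vertices. In the neighbourhood of v itself every point is joined to v, and the
-- inequality leaves the row sum of v unbounded. This is why σ serves as a common reference:
-- Cauchy-Schwarz for the centroids expresses that row sum through row sums over σ, which are under
-- control.
--
-- The argument is carried out in an ordered commutative ring, without division: averages appear
-- multiplied by sizes, and a size can be cancelled because it is at least 1. Square roots are
-- avoided as well: the mixed term is carried as a quantity x together with a bound on x². The ring
-- lemmas serve ℝ and also ℚ, where a bisection produces d^{4/3}.

record OrderedRing : Set₁ where
  infix 4 _≤_
  field
    commutativeRing : CommutativeRing 0ℓ 0ℓ
  open CommutativeRing commutativeRing public hiding (zero)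
  field
    _≤_          : Rel Carrier 0ℓ
    isTotalOrder : IsTotalOrder _≈_ _≤_
    +-monoʳ-≤    : ∀ x {y z} → y ≤ z → x + y ≤ x + z
    *-nonNeg     : ∀ {x y} → 0# ≤ x → 0# ≤ y → 0# ≤ x * y
    _≈?_         : Decidable _≈_

-- Ring identities with integer coefficients.

module IntegerSolver (R : CommutativeRing 0ℓ 0ℓ) where

  open import Data.Integer.Base using (+_; -[1+_])
  open CommutativeRing R
  open Algebra.Properties.Ring ring
    using (-0#≈0#; -‿distribˡ-*; -‿distribʳ-*; -‿involutive; -‿+-comm)
  open Algebra.Properties.Semiring.Mult.TCOptimised semiring public
    using (×-homo-+; ×1-homo-*; 1+×) renaming (_×_ to _·_)
  open Relation.Binary.Reasoning.Setoid setoid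

  -- With this version of multiples `# 1` computes to `1#`, so the two are interchangeable in what
  -- follows.
  #_ : ℕ → Carrier
  # n = n · 1#

  ⟦_⟧ℤ : ℤ → Carrier
  ⟦ + n ⟧ℤ      = # n
  ⟦ -[1+ n ] ⟧ℤ = - # suc n

  private

    ⟦-⟧ : ∀ i → ⟦ ℤ.- i ⟧ℤ ≈ - ⟦ i ⟧ℤ
    ⟦-⟧ (+ zero)   = sym -0#≈0#
    ⟦-⟧ (+ suc n)  = refl
    ⟦-⟧ (-[1+ n ]) = sym (-‿involutive _)

    cancel : ∀ x y → (1# + x) - (1# + y) ≈ x - y
    cancel x y = begin
      (1# + x) - (1# + y)       ≈⟨ +-cong (+-comm x 1#) (-‿+-comm 1# y) ⟨
      (x + 1#) + (- 1# - y)     ≈⟨ +-assoc x 1# _ ⟩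
      x + (1# + (- 1# - y))     ≈⟨ +-congˡ (+-assoc 1# (- 1#) (- y)) ⟨
      x + ((1# - 1#) - y)       ≈⟨ +-congˡ (+-congʳ (-‿inverseʳ 1#)) ⟩
      x + (0# - y)              ≈⟨ +-congˡ (+-identityˡ (- y)) ⟩
      x - y                     ∎

    ⟦⊖⟧ : ∀ m n → ⟦ m ℤ.⊖ n ⟧ℤ ≈ # m - # n
    ⟦⊖⟧ zero    zero    = sym (-‿inverseʳ 0#)
    ⟦⊖⟧ zero    (suc n) = sym (+-identityˡ _)
    ⟦⊖⟧ (suc m) zero    = sym (trans (+-congˡ -0#≈0#) (+-identityʳ _))
    ⟦⊖⟧ (suc m) (suc n) = begin
      ⟦ suc m ℤ.⊖ suc n ⟧ℤ        ≡⟨ ≡.cong ⟦_⟧ℤ (ℤ.[1+m]⊖[1+n]≡m⊖n m n) ⟩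
      ⟦ m ℤ.⊖ n ⟧ℤ                ≈⟨ ⟦⊖⟧ m n ⟩
      # m - # n                   ≈⟨ cancel (# m) (# n) ⟨
      (1# + # m) - (1# + # n)     ≈⟨ +-cong (1+× m 1#) (-‿cong (1+× n 1#)) ⟨
      # suc m - # suc n           ∎

    ⟦+⟧ : ∀ i j → ⟦ i ℤ.+ j ⟧ℤ ≈ ⟦ i ⟧ℤ + ⟦ j ⟧ℤ
    ⟦+⟧ (+ m)      (+ n)      = ×-homo-+ 1# m n
    ⟦+⟧ (+ m)      (-[1+ n ]) = ⟦⊖⟧ m (suc n)
    ⟦+⟧ (-[1+ m ]) (+ n)      = trans (⟦⊖⟧ n (suc m)) (+-comm _ _)
    ⟦+⟧ (-[1+ m ]) (-[1+ n ]) = begin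
      - # suc (suc (m ℕ.+ n))     ≡⟨ ≡.cong (λ t → - # suc t) (≡.sym (ℕ.+-suc m n)) ⟩
      - # (suc m ℕ.+ suc n)       ≈⟨ -‿cong (×-homo-+ 1# (suc m) (suc n)) ⟩
      - (# suc m + # suc n)       ≈⟨ -‿+-comm _ _ ⟨
      - # suc m - # suc n         ∎

    ⟦*⟧⁺ : ∀ i n → ⟦ i ℤ.* + n ⟧ℤ ≈ ⟦ i ⟧ℤ * # n
    ⟦*⟧⁺ (+ m) n = begin
      ⟦ + m ℤ.* + n ⟧ℤ  ≡⟨ ≡.cong ⟦_⟧ℤ (≡.sym (ℤ.pos-* m n)) ⟩
      # (m ℕ.* n)       ≈⟨ ×1-homo-* m n ⟩
      # m * # n         ∎
    ⟦*⟧⁺ (-[1+ m ]) n = begin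
      ⟦ -[1+ m ] ℤ.* + n ⟧ℤ         ≡⟨ ≡.cong ⟦_⟧ℤ (≡.sym (ℤ.neg-distribˡ-* (+ suc m) (+ n))) ⟩
      ⟦ ℤ.- (+ suc m ℤ.* + n) ⟧ℤ    ≈⟨ ⟦-⟧ (+ suc m ℤ.* + n) ⟩
      - ⟦ + suc m ℤ.* + n ⟧ℤ        ≈⟨ -‿cong (⟦*⟧⁺ (+ suc m) n) ⟩
      - (# suc m * # n)             ≈⟨ -‿distribˡ-* _ _ ⟩
      - # suc m * # n               ∎

    ⟦*⟧ : ∀ i j → ⟦ i ℤ.* j ⟧ℤ ≈ ⟦ i ⟧ℤ * ⟦ j ⟧ℤ
    ⟦*⟧ i (+ n)      = ⟦*⟧⁺ i n
    ⟦*⟧ i (-[1+ n ]) = begin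
      ⟦ i ℤ.* -[1+ n ] ⟧ℤ           ≡⟨ ≡.cong ⟦_⟧ℤ (≡.sym (ℤ.neg-distribʳ-* i (+ suc n))) ⟩
      ⟦ ℤ.- (i ℤ.* + suc n) ⟧ℤ      ≈⟨ ⟦-⟧ (i ℤ.* + suc n) ⟩
      - ⟦ i ℤ.* + suc n ⟧ℤ          ≈⟨ -‿cong (⟦*⟧⁺ i (suc n)) ⟩
      - (⟦ i ⟧ℤ * # suc n)          ≈⟨ -‿distribʳ-* _ _ ⟩
      ⟦ i ⟧ℤ * - # suc n            ∎

    ℤ-rawRing : RawRing 0ℓ 0ℓ
    ℤ-rawRing = record
      { Carrier = ℤ ; _≈_ = _≡_ ; _+_ = ℤ._+_ ; _*_ = ℤ._*_ ; -_ = ℤ.-_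
      ; 0# = + 0 ; 1# = + 1 }

    morphism : ℤ-rawRing -Raw-AlmostCommutative⟶ fromCommutativeRing R
    morphism = record
      { ⟦_⟧ = ⟦_⟧ℤ ; +-homo = ⟦+⟧ ; *-homo = ⟦*⟧ ; -‿homo = ⟦-⟧
      ; 0-homo = refl ; 1-homo = refl }

    _≟′_ : ∀ i j → Maybe (⟦ i ⟧ℤ ≈ ⟦ j ⟧ℤ)
    i ≟′ j with i ℤ.≟ j
    ... | yes ≡.refl = just refl
    ... | no _       = nothing

  open Algebra.Solver.Ring ℤ-rawRing (fromCommutativeRing R) morphism _≟′_ public
    using (solve; _:=_; con; _:+_; _:*_; _:-_; :-_; Polynomial)

  :# : ∀ {m} → ℕ → Polynomial m
  :# n = con (+ n)

-- Inequalities and finite sums in an ordered ring.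

module OrderedRingProperties (R : OrderedRing) where

  open OrderedRing R public
  open IntegerSolver commutativeRing public
  open Algebra.Properties.Semiring.Sum semiring public
    using (sum-cong-≋; ∑-distrib-+; ∑-comm; *-distribˡ-sum; *-distribʳ-sum) renaming (sum to ∑)
  open IsTotalOrder isTotalOrder public
    using (antisym; total; isPartialOrder)
    renaming (refl to ≤-refl; reflexive to ≤-reflexive; trans to ≤-trans)

  poset : Poset 0ℓ 0ℓ 0ℓ
  poset = record { isPartialOrder = isPartialOrder }

  module ≤-Reasoning = Relation.Binary.Reasoning.PartialOrder poset

  +-monoˡ-≤ : ∀ x {y z} → y ≤ z → y + x ≤ z + x
  +-monoˡ-≤ x {y} {z} y≤z = begin
    y + x  ≈⟨ +-comm y x ⟩
    x + y  ≤⟨ +-monoʳ-≤ x y≤z ⟩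
    x + z  ≈⟨ +-comm x z ⟩
    z + x  ∎
    where open ≤-Reasoning

  +-mono-≤ : ∀ {w x y z} → w ≤ x → y ≤ z → w + y ≤ x + z
  +-mono-≤ {x = x} {y} w≤x y≤z = ≤-trans (+-monoˡ-≤ y w≤x) (+-monoʳ-≤ x y≤z)

  x≤y⇒0≤y-x : ∀ {x y} → x ≤ y → 0# ≤ y - x
  x≤y⇒0≤y-x {x} {y} x≤y = begin
    0#     ≈⟨ -‿inverseʳ x ⟨
    x - x  ≤⟨ +-monoˡ-≤ (- x) x≤y ⟩
    y - x  ∎
    where open ≤-Reasoning

  0≤y-x⇒x≤y : ∀ {x y} → 0# ≤ y - x → x ≤ y
  0≤y-x⇒x≤y {x} {y} p = begin
    x            ≈⟨ +-identityʳ x ⟨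
    x + 0#       ≤⟨ +-monoʳ-≤ x p ⟩
    x + (y - x)  ≈⟨ solve 2 (λ x y → x :+ (y :- x) := y) refl x y ⟩
    y            ∎
    where open ≤-Reasoning

  -- The shape of most inequalities below: z is a certificate built from nonnegative pieces, and the
  -- ring solver checks that it equals the difference.
  ≤-by-difference : ∀ {x y z} → 0# ≤ z → y - x ≈ z → x ≤ y
  ≤-by-difference p e = 0≤y-x⇒x≤y (≤-trans p (≤-reflexive (sym e)))

  +-nonNeg : ∀ {x y} → 0# ≤ x → 0# ≤ y → 0# ≤ x + y
  +-nonNeg p q = ≤-trans (≤-reflexive (sym (+-identityʳ 0#))) (+-mono-≤ p q)

  sq-nonNeg : ∀ x → 0# ≤ x * x
  sq-nonNeg x with total 0# x
  ... | inj₁ 0≤x = *-nonNeg 0≤x 0≤x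
  ... | inj₂ x≤0 = ≤-trans (*-nonNeg (x≤y⇒0≤y-x x≤0) (x≤y⇒0≤y-x x≤0))
    (≤-reflexive (solve 1 (λ x → (:# 0 :- x) :* (:# 0 :- x) := x :* x) refl x))

  0≤1 : 0# ≤ 1#
  0≤1 = ≤-trans (sq-nonNeg 1#) (≤-reflexive (*-identityˡ 1#))

  #-nonNeg : ∀ n → 0# ≤ # n
  #-nonNeg zero    = ≤-refl
  #-nonNeg (suc n) = ≤-trans (+-nonNeg 0≤1 (#-nonNeg n)) (≤-reflexive (sym (1+× n 1#)))

  *-monoˡ-≤ : ∀ {c x y} → 0# ≤ c → x ≤ y → c * x ≤ c * y
  *-monoˡ-≤ {c} {x} {y} 0≤c x≤y = ≤-by-difference (*-nonNeg 0≤c (x≤y⇒0≤y-x x≤y))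
    (solve 3 (λ c x y → c :* y :- c :* x := c :* (y :- x)) refl c x y)

  *-mono-≤ : ∀ {w x y z} → 0# ≤ w → 0# ≤ y → w ≤ x → y ≤ z → w * y ≤ x * z
  *-mono-≤ {w} {x} {y} {z} 0≤w 0≤y w≤x y≤z = ≤-by-difference
    (+-nonNeg (*-nonNeg 0≤y (x≤y⇒0≤y-x w≤x)) (*-nonNeg (≤-trans 0≤w w≤x) (x≤y⇒0≤y-x y≤z)))
    (solve 4 (λ w x y z → x :* z :- w :* y := y :* (x :- w) :+ x :* (z :- y)) refl w x y z)

  -- Here 1 ≤ c replaces an inverse of c. Even if y ≤ x, the difference y - x = (c - 1)(x - y) + (c
  -- y - c x) is nonnegative.
  *-cancelˡ-≤ : ∀ {c x y} → 1# ≤ c → c * x ≤ c * y → x ≤ y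
  *-cancelˡ-≤ {c} {x} {y} 1≤c cx≤cy with total x y
  ... | inj₁ x≤y = x≤y
  ... | inj₂ y≤x = ≤-by-difference
    (+-nonNeg (*-nonNeg (x≤y⇒0≤y-x 1≤c) (x≤y⇒0≤y-x y≤x)) (x≤y⇒0≤y-x cx≤cy))
    (solve 3 (λ c x y → y :- x := (c :- :# 1) :* (x :- y) :+ (c :* y :- c :* x)) refl c x y)

  ∑-cong : ∀ {n} {f g : Fin n → Carrier} → (∀ i → f i ≈ g i) → ∑ f ≈ ∑ g
  ∑-cong = sum-cong-≋

  ∑-mono-≤ : ∀ {n} {f g : Fin n → Carrier} → (∀ i → f i ≤ g i) → ∑ f ≤ ∑ g
  ∑-mono-≤ {zero}  p = ≤-refl
  ∑-mono-≤ {suc n} p = +-mono-≤ (p zero) (∑-mono-≤ λ i → p (suc i))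

  ∑-zero : ∀ n → ∑ {n} (λ _ → 0#) ≈ 0#
  ∑-zero zero    = refl
  ∑-zero (suc n) = trans (+-identityˡ _) (∑-zero n)

  ∑-nonNeg : ∀ {n} {f : Fin n → Carrier} → (∀ i → 0# ≤ f i) → 0# ≤ ∑ f
  ∑-nonNeg {n} p = ≤-trans (≤-reflexive (sym (∑-zero n))) (∑-mono-≤ p)

  ∑-const : ∀ n x → ∑ {n} (λ _ → x) ≈ # n * x
  ∑-const zero    x = sym (zeroˡ x)
  ∑-const (suc n) x = begin
    x + ∑ {n} (λ _ → x)  ≈⟨ +-congˡ (∑-const n x) ⟩
    x + # n * x          ≈⟨ solve 2 (λ x m → x :+ m :* x := (:# 1 :+ m) :* x) refl x (# n) ⟩
    (1# + # n) * x       ≈⟨ *-congʳ (1+× n 1#) ⟨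
    # suc n * x          ∎
    where open Relation.Binary.Reasoning.Setoid setoid

  ∑-linear : ∀ {n} x y (f g : Fin n → Carrier) →
             ∑ (λ i → x * f i + y * g i) ≈ x * ∑ f + y * ∑ g
  ∑-linear x y f g = trans (∑-distrib-+ (λ i → x * f i) (λ i → y * g i))
    (sym (+-cong (*-distribˡ-sum x f) (*-distribˡ-sum y g)))

  ∑-∑-* : ∀ {m n} (f : Fin m → Carrier) (g : Fin n → Carrier) →
          ∑ (λ i → ∑ λ j → f i * g j) ≈ ∑ f * ∑ g
  ∑-∑-* f g = trans (∑-cong λ i → sym (*-distribˡ-sum (f i) g)) (sym (*-distribʳ-sum (∑ g) f))

  ∑∑-cong : ∀ {m n} {f g : Fin m → Fin n → Carrier} → (∀ i j → f i j ≈ g i j) →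
            ∑ (λ i → ∑ (f i)) ≈ ∑ (λ i → ∑ (g i))
  ∑∑-cong {m} {n} p = ∑-cong {m} λ i → ∑-cong {n} (p i)

  ∑∑-linear : ∀ {m n} x y (f g : Fin m → Fin n → Carrier) →
    ∑ (λ i → ∑ λ j → x * f i j + y * g i j) ≈
    x * ∑ (λ i → ∑ (f i)) + y * ∑ (λ i → ∑ (g i))
  ∑∑-linear {m} x y f g = trans (∑-cong {m} λ i → ∑-linear x y (f i) (g i))
    (∑-linear x y (λ i → ∑ (f i)) (λ i → ∑ (g i)))

  δ : ∀ {n} → Fin n → Fin n → Carrier
  δ zero    zero    = 1#
  δ zero    (suc j) = 0#
  δ (suc i) zero    = 0#
  δ (suc i) (suc j) = δ i j

  δ-sym : ∀ {n} (i j : Fin n) → δ i j ≡ δ j i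
  δ-sym zero    zero    = ≡.refl
  δ-sym zero    (suc j) = ≡.refl
  δ-sym (suc i) zero    = ≡.refl
  δ-sym (suc i) (suc j) = δ-sym i j

  δ-refl : ∀ {n} (i : Fin n) → δ i i ≡ 1#
  δ-refl zero    = ≡.refl
  δ-refl (suc i) = δ-refl i

  δ-≢ : ∀ {n} {i j : Fin n} → ¬ i ≡ j → δ i j ≡ 0#
  δ-≢ {i = zero}  {zero}  i≢j = contradiction ≡.refl i≢j
  δ-≢ {i = zero}  {suc j} i≢j = ≡.refl
  δ-≢ {i = suc i} {zero}  i≢j = ≡.refl
  δ-≢ {i = suc i} {suc j} i≢j = δ-≢ λ i≡j → i≢j (≡.cong suc i≡j)

  δ-01 : ∀ {n} (i j : Fin n) → δ i j ≡ 0# ⊎ δ i j ≡ 1#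
  δ-01 zero    zero    = inj₂ ≡.refl
  δ-01 zero    (suc j) = inj₁ ≡.refl
  δ-01 (suc i) zero    = inj₁ ≡.refl
  δ-01 (suc i) (suc j) = δ-01 i j

  ∑-δ : ∀ {n} (i : Fin n) (f : Fin n → Carrier) → ∑ (λ j → δ i j * f j) ≈ f i
  ∑-δ {suc n} zero f = begin
    1# * f zero + ∑ (λ j → 0# * f (suc j))  ≈⟨ +-cong (*-identityˡ _) (∑-cong λ j → zeroˡ (f (suc j))) ⟩
    f zero + ∑ {n} (λ _ → 0#)               ≈⟨ +-congˡ (∑-zero n) ⟩
    f zero + 0#                             ≈⟨ +-identityʳ _ ⟩
    f zero                                  ∎
    where open Relation.Binary.Reasoning.Setoid setoid
  ∑-δ (suc i) f = trans (+-cong (zeroˡ _) (∑-δ i λ j → f (suc j))) (+-identityˡ _)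

  ∑-δ-1 : ∀ {n} (i : Fin n) → ∑ (δ i) ≈ 1#
  ∑-δ-1 {n} i = trans (∑-cong {n} λ j → sym (*-identityʳ (δ i j))) (∑-δ i (λ _ → 1#))

  term≤∑ : ∀ {n} {f : Fin n → Carrier} → (∀ i → 0# ≤ f i) → ∀ i → f i ≤ ∑ f
  term≤∑ {n} {f} 0≤f i = ≤-trans (≤-reflexive (sym (∑-δ i f))) (∑-mono-≤ {n} bound)
    where
    bound : ∀ j → δ i j * f j ≤ f j
    bound j with δ i j | δ-01 i j
    ... | _ | inj₁ ≡.refl = ≤-trans (≤-reflexive (zeroˡ (f j))) (0≤f j)
    ... | _ | inj₂ ≡.refl = ≤-reflexive (*-identityˡ (f j))

  ∑-rotate : ∀ {l m n} (f : Fin l → Fin m → Fin n → Carrier) →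
    ∑ (λ i → ∑ λ j → ∑ λ k → f i j k) ≈ ∑ (λ k → ∑ λ i → ∑ λ j → f i j k)
  ∑-rotate {l} f = trans (∑-cong {l} λ i → ∑-comm (f i)) (∑-comm λ i k → ∑ λ j → f i j k)

  -- Lagrange: the difference of the two sides is half of
  -- Σᵢⱼ wᵢ wⱼ (xᵢ yⱼ − xⱼ yᵢ)².
  cauchy-schwarz : ∀ {n} (w x y : Fin n → Carrier) → (∀ i → 0# ≤ w i) →
    ∑ (λ i → w i * (x i * y i)) * ∑ (λ i → w i * (x i * y i)) ≤
    ∑ (λ i → w i * (x i * x i)) * ∑ (λ i → w i * (y i * y i))
  cauchy-schwarz {n} w x y 0≤w = *-cancelˡ-≤ {# 2}
    (≤-by-difference 0≤1 (solve 0 (:# 2 :- :# 1 := :# 1) refl))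
    (≤-by-difference lagrange-nonNeg (sym lagrange))
    where
    xx xy yy : Fin n → Carrier
    xx i = w i * (x i * x i)
    xy i = w i * (x i * y i)
    yy i = w i * (y i * y i)
    c : Fin n → Fin n → Carrier
    c i j = x i * y j - x j * y i
    lagrange-nonNeg : 0# ≤ ∑ (λ i → ∑ λ j → w i * w j * (c i j * c i j))
    lagrange-nonNeg = ∑-nonNeg λ i → ∑-nonNeg λ j →
      *-nonNeg (*-nonNeg (0≤w i) (0≤w j)) (sq-nonNeg (c i j))
    open Relation.Binary.Reasoning.Setoid setoid
    lagrange : ∑ (λ i → ∑ λ j → w i * w j * (c i j * c i j)) ≈
               # 2 * (∑ xx * ∑ yy) - # 2 * (∑ xy * ∑ xy)
    lagrange = begin
      ∑ (λ i → ∑ λ j → w i * w j * (c i j * c i j))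
        ≈⟨ ∑∑-cong (λ i j → solve 6 (λ w v x y z t →
             w :* v :* ((x :* t :- z :* y) :* (x :* t :- z :* y)) :=
             :# 1 :* (:# 1 :* (w :* (x :* x) :* (v :* (t :* t))) :+ :# 1 :* (w :* (y :* y) :* (v :* (z :* z))))
             :+ (:- :# 2) :* (w :* (x :* y) :* (v :* (z :* t))))
             refl (w i) (w j) (x i) (y i) (x j) (y j)) ⟩
      ∑ (λ i → ∑ λ j → # 1 * (# 1 * (xx i * yy j) + # 1 * (yy i * xx j)) + (- # 2) * (xy i * xy j))
        ≈⟨ trans (∑∑-linear (# 1) (- # 2) (λ i j → # 1 * (xx i * yy j) + # 1 * (yy i * xx j)) (λ i j → xy i * xy j))
             (+-congʳ (*-congˡ (∑∑-linear (# 1) (# 1) (λ i j → xx i * yy j) (λ i j → yy i * xx j)))) ⟩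
      # 1 * (# 1 * ∑ (λ i → ∑ (λ j → xx i * yy j)) + # 1 * ∑ (λ i → ∑ λ j → yy i * xx j))
        + (- # 2) * ∑ (λ i → ∑ λ j → xy i * xy j)
        ≈⟨ +-cong (*-congˡ (+-cong (*-congˡ (∑-∑-* xx yy)) (*-congˡ (∑-∑-* yy xx)))) (*-congˡ (∑-∑-* xy xy)) ⟩
      # 1 * (# 1 * (∑ xx * ∑ yy) + # 1 * (∑ yy * ∑ xx)) + (- # 2) * (∑ xy * ∑ xy)
        ≈⟨ solve 3 (λ a b c → :# 1 :* (:# 1 :* (a :* b) :+ :# 1 :* (b :* a)) :+ (:- :# 2) :* (c :* c) :=
             :# 2 :* (a :* b) :- :# 2 :* (c :* c)) refl (∑ xx) (∑ yy) (∑ xy) ⟩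
      # 2 * (∑ xx * ∑ yy) - # 2 * (∑ xy * ∑ xy)  ∎

  ∑-cauchy-schwarz : ∀ {n} (x y : Fin n → Carrier) →
    ∑ (λ i → x i * y i) * ∑ (λ i → x i * y i) ≤ ∑ (λ i → x i * x i) * ∑ (λ i → y i * y i)
  ∑-cauchy-schwarz {n} x y = begin
    ∑ (λ i → x i * y i) * ∑ (λ i → x i * y i)                        ≈⟨ *-cong (unit x y) (unit x y) ⟨
    ∑ (λ i → 1# * (x i * y i)) * ∑ (λ i → 1# * (x i * y i))          ≤⟨ cauchy-schwarz (λ _ → 1#) x y (λ _ → 0≤1) ⟩
    ∑ (λ i → 1# * (x i * x i)) * ∑ (λ i → 1# * (y i * y i))          ≈⟨ *-cong (unit x x) (unit y y) ⟩
    ∑ (λ i → x i * x i) * ∑ (λ i → y i * y i)                        ∎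
    where
    open ≤-Reasoning
    unit : ∀ x y → ∑ (λ i → 1# * (x i * y i)) ≈ ∑ (λ i → x i * y i)
    unit x y = ∑-cong {n} λ i → *-identityˡ (x i * y i)

  ∑-square-≤ : ∀ {n} (x : Fin n → Carrier) → ∑ x * ∑ x ≤ # n * ∑ (λ i → x i * x i)
  ∑-square-≤ {n} x = begin
    ∑ x * ∑ x                                         ≈⟨ *-cong eq eq ⟨
    ∑ (λ i → 1# * x i) * ∑ (λ i → 1# * x i)           ≤⟨ ∑-cauchy-schwarz (λ _ → 1#) x ⟩
    ∑ {n} (λ _ → 1# * 1#) * ∑ (λ i → x i * x i)       ≈⟨ *-congʳ (trans (∑-const n _) (solve 1 (λ n → n :* (:# 1 :* :# 1) := n) refl (# n))) ⟩
    # n * ∑ (λ i → x i * x i)                         ∎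
    where
    open ≤-Reasoning
    eq : ∑ (λ i → 1# * x i) ≈ ∑ x
    eq = ∑-cong {n} λ i → *-identityˡ (x i)

  -- Both sides are expressed by the d × d matrix M = Σᵢ wᵢ yᵢ yᵢᵀ: the left one
  -- is (tr M)², and the double sum on the right is tr M².
  trace-inequality : ∀ {n d} (w : Fin n → Carrier) (y : Fin n → Fin d → Carrier) →
    let g = λ i j → ∑ λ c → y i c * y j c in
    ∑ (λ i → w i * g i i) * ∑ (λ i → w i * g i i) ≤
    # d * ∑ (λ i → ∑ λ j → w i * w j * (g i j * g i j))
  trace-inequality {n} {d} w y = begin
    ∑ (λ i → w i * g i i) * ∑ (λ i → w i * g i i)        ≈⟨ *-cong trace trace ⟩
    ∑ (λ c → M c c) * ∑ (λ c → M c c)                    ≤⟨ ∑-square-≤ (λ c → M c c) ⟩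
    # d * ∑ (λ c → M c c * M c c)                        ≤⟨ *-monoˡ-≤ (#-nonNeg d) (∑-mono-≤ {d} λ c →
                                                              term≤∑ {d} (λ e → sq-nonNeg (M c e)) c) ⟩
    # d * ∑ (λ c → ∑ λ e → M c e * M c e)                ≈⟨ *-congˡ square ⟩
    # d * ∑ (λ i → ∑ λ j → w i * w j * (g i j * g i j))  ∎
    where
    open ≤-Reasoning
    module ≈ = Relation.Binary.Reasoning.Setoid setoid
    g : Fin n → Fin n → Carrier
    g i j = ∑ λ c → y i c * y j c
    M : Fin d → Fin d → Carrier
    M c e = ∑ λ i → w i * (y i c * y i e)
    trace : ∑ (λ i → w i * g i i) ≈ ∑ (λ c → M c c)
    trace = trans (∑-cong {n} λ i → *-distribˡ-sum (w i) (λ c → y i c * y i c))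
      (∑-comm λ i c → w i * (y i c * y i c))
    F : Fin d → Fin d → Fin n → Fin n → Carrier
    F c e i j = w i * (y i c * y i e) * (w j * (y j c * y j e))
    square : ∑ (λ c → ∑ λ e → M c e * M c e) ≈ ∑ (λ i → ∑ λ j → w i * w j * (g i j * g i j))
    square = ≈.begin
      ∑ (λ c → ∑ λ e → M c e * M c e)
        ≈.≈⟨ ∑∑-cong (λ c e → ∑-∑-* (λ i → w i * (y i c * y i e)) (λ j → w j * (y j c * y j e))) ⟨
      ∑ (λ c → ∑ λ e → ∑ λ i → ∑ λ j → F c e i j)
        ≈.≈⟨ ∑-rotate (λ c e i → ∑ (F c e i)) ⟩
      ∑ (λ i → ∑ λ c → ∑ λ e → ∑ λ j → F c e i j)
        ≈.≈⟨ ∑-cong {n} (λ i → ∑-rotate (λ c e → F c e i)) ⟩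
      ∑ (λ i → ∑ λ j → ∑ λ c → ∑ λ e → F c e i j)
        ≈.≈⟨ ∑∑-cong {n} {n} (λ i j → ∑∑-cong {d} {d} λ c e →
             solve 6 (λ w v a b s t → w :* (a :* b) :* (v :* (s :* t)) := w :* v :* (a :* s) :* (b :* t))
               refl (w i) (w j) (y i c) (y i e) (y j c) (y j e)) ⟩
      ∑ (λ i → ∑ λ j → ∑ λ c → ∑ λ e → w i * w j * (y i c * y j c) * (y i e * y j e))
        ≈.≈⟨ ∑∑-cong {n} {n} (λ i j → ∑-∑-* (λ c → w i * w j * (y i c * y j c)) (λ e → y i e * y j e)) ⟩
      ∑ (λ i → ∑ λ j → ∑ (λ c → w i * w j * (y i c * y j c)) * g i j)
        ≈.≈⟨ ∑∑-cong {n} {n} (λ i j → trans (*-congʳ (sym (*-distribˡ-sum (w i * w j) (λ c → y i c * y j c))))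
             (*-assoc (w i * w j) (g i j) (g i j))) ⟩
      ∑ (λ i → ∑ λ j → w i * w j * (g i j * g i j)) ≈.∎

-- The unit-distance form and its Gram representation.

module UnitDistanceForm (R : OrderedRing) {n d : ℕ} (p : Fin n → Fin d → OrderedRing.Carrier R) where

  open OrderedRingProperties R

  Weights : Set
  Weights = Fin n → Carrier

  -- Zero exactly at unit distance and 1 on the diagonal, so it is the identity matrix on a unit
  -- simplex. Entries are at most 1 but may be very negative.
  a : Fin n → Fin n → Carrier
  a i j = 1# - ∑ λ c → (p i c - p j c) * (p i c - p j c)

  row : Weights → Fin n → Carrier
  row y i = ∑ λ j → y j * a i j

  ⟪_,_⟫ : Weights → Weights → Carrier
  ⟪ x , y ⟫ = ∑ λ i → x i * row y i

  moment : Weights → Fin d → Carrier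
  moment x c = ∑ λ i → x i * p i c

  open Relation.Binary.Reasoning.Setoid setoid

  a-refl : ∀ i → a i i ≈ 1#
  a-refl i = begin
    1# - ∑ (λ c → (p i c - p i c) * (p i c - p i c))
      ≈⟨ +-congˡ (-‿cong (trans (∑-cong {d} λ c → solve 1 (λ x → (x :- x) :* (x :- x) := :# 0) refl (p i c)) (∑-zero d))) ⟩
    1# - 0#  ≈⟨ solve 0 (:# 1 :- :# 0 := :# 1) refl ⟩
    1#       ∎

  a-sym : ∀ i j → a i j ≈ a j i
  a-sym i j = +-congˡ (-‿cong (∑-cong {d} λ c →
    solve 2 (λ x y → (x :- y) :* (x :- y) := (y :- x) :* (y :- x)) refl (p i c) (p j c)))

  a≤1 : ∀ i j → a i j ≤ 1#
  a≤1 i j = ≤-by-difference (∑-nonNeg λ c → sq-nonNeg (p i c - p j c))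
    (solve 1 (λ s → :# 1 :- (:# 1 :- s) := s) refl _)

  form-∑∑ : ∀ x y → ⟪ x , y ⟫ ≈ ∑ λ i → ∑ λ j → x i * y j * a i j
  form-∑∑ x y = ∑-cong {n} λ i → trans (*-distribˡ-sum (x i) (λ j → y j * a i j))
    (∑-cong {n} λ j → sym (*-assoc (x i) (y j) (a i j)))

  form-sym : ∀ x y → ⟪ x , y ⟫ ≈ ⟪ y , x ⟫
  form-sym x y = begin
    ⟪ x , y ⟫                                ≈⟨ form-∑∑ x y ⟩
    ∑ (λ i → ∑ λ j → x i * y j * a i j)      ≈⟨ ∑-comm (λ i j → x i * y j * a i j) ⟩
    ∑ (λ j → ∑ λ i → x i * y j * a i j)      ≈⟨ ∑∑-cong (λ j i → *-cong (*-comm (x i) (y j)) (a-sym i j)) ⟩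
    ∑ (λ j → ∑ λ i → y j * x i * a j i)      ≈⟨ form-∑∑ y x ⟨
    ⟪ y , x ⟫                                ∎

  form-linearˡ : ∀ x y α β γ →
    ⟪ (λ i → x * α i + y * β i) , γ ⟫ ≈ x * ⟪ α , γ ⟫ + y * ⟪ β , γ ⟫
  form-linearˡ x y α β γ = trans
    (∑-cong {n} λ i → solve 5 (λ x y a b r → (x :* a :+ y :* b) :* r := x :* (a :* r) :+ y :* (b :* r)) refl
      x y (α i) (β i) (row γ i))
    (∑-linear x y (λ i → α i * row γ i) (λ i → β i * row γ i))

  form-linearʳ : ∀ x y α β γ →
    ⟪ γ , (λ i → x * α i + y * β i) ⟫ ≈ x * ⟪ γ , α ⟫ + y * ⟪ γ , β ⟫
  form-linearʳ x y α β γ = begin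
    ⟪ γ , (λ i → x * α i + y * β i) ⟫  ≈⟨ form-sym γ _ ⟩
    ⟪ (λ i → x * α i + y * β i) , γ ⟫  ≈⟨ form-linearˡ x y α β γ ⟩
    x * ⟪ α , γ ⟫ + y * ⟪ β , γ ⟫      ≈⟨ +-cong (*-congˡ (form-sym α γ)) (*-congˡ (form-sym β γ)) ⟩
    x * ⟪ γ , α ⟫ + y * ⟪ γ , β ⟫      ∎

  form-bilinear : ∀ x y z w α β γ ε →
    ⟪ (λ i → x * α i + y * β i) , (λ i → z * γ i + w * ε i) ⟫ ≈
    x * (z * ⟪ α , γ ⟫ + w * ⟪ α , ε ⟫) + y * (z * ⟪ β , γ ⟫ + w * ⟪ β , ε ⟫)
  form-bilinear x y z w α β γ ε = trans (form-linearˡ x y α β _)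
    (+-cong (*-congˡ (form-linearʳ z w γ ε α)) (*-congˡ (form-linearʳ z w γ ε β)))

  form-δˡ : ∀ v x → ⟪ δ v , x ⟫ ≈ row x v
  form-δˡ v x = ∑-δ v (row x)

  form-δʳ : ∀ v x → ⟪ x , δ v ⟫ ≈ row x v
  form-δʳ v x = trans (form-sym x (δ v)) (form-δˡ v x)

  row-δ : ∀ i j → row (δ i) j ≈ a j i
  row-δ i j = ∑-δ i (a j)

  -- In a i j = 1 - |pᵢ|² - |pⱼ|² + 2 pᵢ·pⱼ every summand but the last depends on at most one index,
  -- and weights of sum 0 annihilate it.
  form-moment : ∀ x y → ∑ x ≈ 0# → ∑ y ≈ 0# →
    ⟪ x , y ⟫ ≈ # 2 * ∑ (λ c → moment x c * moment y c)
  form-moment x y ∑x≈0 ∑y≈0 = begin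
    ⟪ x , y ⟫
      ≈⟨ form-∑∑ x y ⟩
    ∑ (λ i → ∑ λ j → x i * y j * a i j)
      ≈⟨ ∑∑-cong (λ i j → trans
           (solve 2 (λ z s → z :* (:# 1 :- s) := :# 1 :* z :+ (:- :# 1) :* (z :* s)) refl (x i * y j) (∑ (q i j)))
           (+-congˡ (*-congˡ (*-distribˡ-sum (x i * y j) (q i j))))) ⟩
    ∑ (λ i → ∑ λ j → # 1 * (x i * y j) + (- # 1) * ∑ (λ c → x i * y j * q i j c))
      ≈⟨ ∑∑-linear (# 1) (- # 1) (λ i j → x i * y j) (λ i j → ∑ λ c → x i * y j * q i j c) ⟩
    # 1 * ∑ (λ i → ∑ λ j → x i * y j) + (- # 1) * ∑ (λ i → ∑ λ j → ∑ λ c → x i * y j * q i j c)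
      ≈⟨ +-cong (*-congˡ (trans (∑-∑-* x y) (*-cong ∑x≈0 ∑y≈0))) (*-congˡ swap) ⟩
    # 1 * (0# * 0#) + (- # 1) * ∑ (λ c → ∑ λ i → ∑ λ j → x i * y j * q i j c)
      ≈⟨ +-congˡ (*-congˡ (∑-cong {d} coordinate)) ⟩
    # 1 * (0# * 0#) + (- # 1) * ∑ (λ c → - # 2 * (moment x c * moment y c))
      ≈⟨ +-congˡ (*-congˡ (*-distribˡ-sum (- # 2) (λ c → moment x c * moment y c))) ⟨
    # 1 * (0# * 0#) + (- # 1) * (- # 2 * ∑ (λ c → moment x c * moment y c))
      ≈⟨ solve 1 (λ s → :# 1 :* (:# 0 :* :# 0) :+ (:- :# 1) :* ((:- :# 2) :* s) := :# 2 :* s) refl _ ⟩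
    # 2 * ∑ (λ c → moment x c * moment y c)  ∎
    where
    q : Fin n → Fin n → Fin d → Carrier
    q i j c = (p i c - p j c) * (p i c - p j c)
    swap : ∑ (λ i → ∑ λ j → ∑ λ c → x i * y j * q i j c) ≈ ∑ (λ c → ∑ λ i → ∑ λ j → x i * y j * q i j c)
    swap = trans (∑-cong {n} λ i → ∑-comm (λ j c → x i * y j * q i j c))
      (∑-comm (λ i c → ∑ λ j → x i * y j * q i j c))
    coordinate : ∀ c → ∑ (λ i → ∑ λ j → x i * y j * q i j c) ≈ - # 2 * (moment x c * moment y c)
    coordinate c = begin
      ∑ (λ i → ∑ λ j → x i * y j * q i j c)
        ≈⟨ ∑∑-cong (λ i j → solve 4 (λ x y p r → x :* y :* ((p :- r) :* (p :- r)) :=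
             :# 1 :* (:# 1 :* (x :* (p :* p) :* y) :+ :# 1 :* (x :* (y :* (r :* r)))) :+ (:- :# 2) :* (x :* p :* (y :* r)))
             refl (x i) (y j) (p i c) (p j c)) ⟩
      ∑ (λ i → ∑ λ j → # 1 * (# 1 * (x₂ i * y j) + # 1 * (x i * y₂ j)) + (- # 2) * (x₁ i * y₁ j))
        ≈⟨ trans (∑∑-linear (# 1) (- # 2) (λ i j → # 1 * (x₂ i * y j) + # 1 * (x i * y₂ j)) (λ i j → x₁ i * y₁ j))
             (+-congʳ (*-congˡ (∑∑-linear (# 1) (# 1) (λ i j → x₂ i * y j) (λ i j → x i * y₂ j)))) ⟩
      # 1 * (# 1 * ∑ (λ i → ∑ λ j → x₂ i * y j) + # 1 * ∑ (λ i → ∑ λ j → x i * y₂ j))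
        + (- # 2) * ∑ (λ i → ∑ λ j → x₁ i * y₁ j)
        ≈⟨ +-cong (*-congˡ (+-cong (*-congˡ (trans (∑-∑-* x₂ y) (*-congˡ ∑y≈0)))
             (*-congˡ (trans (∑-∑-* x y₂) (*-congʳ ∑x≈0))))) (*-congˡ (∑-∑-* x₁ y₁)) ⟩
      # 1 * (# 1 * (∑ x₂ * 0#) + # 1 * (0# * ∑ y₂)) + (- # 2) * (∑ x₁ * ∑ y₁)
        ≈⟨ solve 3 (λ s t u → :# 1 :* (:# 1 :* (s :* :# 0) :+ :# 1 :* (:# 0 :* t)) :+ (:- :# 2) :* u := (:- :# 2) :* u)
             refl (∑ x₂) (∑ y₂) _ ⟩
      - # 2 * (moment x c * moment y c)  ∎
      where
      x₁ x₂ y₁ y₂ : Weights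
      x₁ i = x i * p i c
      x₂ i = x i * (p i c * p i c)
      y₁ j = y j * p j c
      y₂ j = y j * (p j c * p j c)

  form-nonNeg : ∀ x → ∑ x ≈ 0# → 0# ≤ ⟪ x , x ⟫
  form-nonNeg x ∑x≈0 = ≤-trans
    (*-nonNeg (#-nonNeg 2) (∑-nonNeg λ c → sq-nonNeg (moment x c)))
    (≤-reflexive (sym (form-moment x x ∑x≈0 ∑x≈0)))

  form-cauchy-schwarz : ∀ x y → ∑ x ≈ 0# → ∑ y ≈ 0# →
    ⟪ x , y ⟫ * ⟪ x , y ⟫ ≤ ⟪ x , x ⟫ * ⟪ y , y ⟫
  form-cauchy-schwarz x y ∑x≈0 ∑y≈0 = ≤R.begin
    ⟪ x , y ⟫ * ⟪ x , y ⟫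
      ≤R.≈⟨ *-cong (form-moment x y ∑x≈0 ∑y≈0) (form-moment x y ∑x≈0 ∑y≈0) ⟩
    # 2 * ∑ (λ c → moment x c * moment y c) * (# 2 * ∑ (λ c → moment x c * moment y c))
      ≤R.≈⟨ solve 1 (λ s → :# 2 :* s :* (:# 2 :* s) := :# 4 :* (s :* s)) refl _ ⟩
    # 4 * (∑ (λ c → moment x c * moment y c) * ∑ (λ c → moment x c * moment y c))
      ≤R.≤⟨ *-monoˡ-≤ (#-nonNeg 4) (∑-cauchy-schwarz (moment x) (moment y)) ⟩
    # 4 * (∑ (λ c → moment x c * moment x c) * ∑ (λ c → moment y c * moment y c))
      ≤R.≈⟨ solve 2 (λ s t → :# 4 :* (s :* t) := :# 2 :* s :* (:# 2 :* t)) refl _ _ ⟩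
    # 2 * ∑ (λ c → moment x c * moment x c) * (# 2 * ∑ (λ c → moment y c * moment y c))
      ≤R.≈⟨ *-cong (form-moment x x ∑x≈0 ∑x≈0) (form-moment y y ∑y≈0 ∑y≈0) ⟨
    ⟪ x , x ⟫ * ⟪ y , y ⟫ ≤R.∎
    where module ≤R = ≤-Reasoning

-- Unit simplices: Bessel's inequality and centroids.

module Simplices (R : OrderedRing) {n d : ℕ} (p : Fin n → Fin d → OrderedRing.Carrier R) where

  open OrderedRingProperties R
  open UnitDistanceForm R p

  rowSq : Weights → Fin n → Carrier
  rowSq y i = ∑ λ j → y j * (a i j * a i j)

  -- For a 0/1-valued σ: the selected points are at mutual distance 1.
  Simplex : Weights → Set
  Simplex σ = ∀ i j → σ i * σ j * a i j ≈ σ i * δ i j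

  module _ {σ : Weights} (simplex : Simplex σ) where

    open Relation.Binary.Reasoning.Setoid setoid

    -- The matrix `a` acts as the identity on weights supported on the simplex; the factor σ i
    -- restricts the claim to its points.
    simplex-row : ∀ f i → σ i * row (λ j → σ j * f j) i ≈ σ i * f i
    simplex-row f i = begin
      σ i * row (λ j → σ j * f j) i
        ≈⟨ *-distribˡ-sum (σ i) (λ j → σ j * f j * a i j) ⟩
      ∑ (λ j → σ i * (σ j * f j * a i j))
        ≈⟨ ∑-cong {n} (λ j → solve 4 (λ s t f a → s :* (t :* f :* a) := s :* t :* a :* f) refl (σ i) (σ j) (f j) (a i j)) ⟩
      ∑ (λ j → σ i * σ j * a i j * f j)
        ≈⟨ ∑-cong {n} (λ j → trans (*-congʳ (simplex i j)) (*-assoc (σ i) (δ i j) (f j))) ⟩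
      ∑ (λ j → σ i * (δ i j * f j))
        ≈⟨ *-distribˡ-sum (σ i) (λ j → δ i j * f j) ⟨
      σ i * ∑ (λ j → δ i j * f j)
        ≈⟨ *-congˡ (∑-δ i f) ⟩
      σ i * f i ∎

    simplex-form : ∀ f → ⟪ (λ i → σ i * f i) , (λ i → σ i * f i) ⟫ ≈ ∑ (λ i → σ i * (f i * f i))
    simplex-form f = ∑-cong {n} λ i → begin
      σ i * f i * row (λ j → σ j * f j) i    ≈⟨ solve 3 (λ s f r → s :* f :* r := f :* (s :* r)) refl (σ i) (f i) _ ⟩
      f i * (σ i * row (λ j → σ j * f j) i)  ≈⟨ *-congˡ (simplex-row f i) ⟩
      f i * (σ i * f i)                      ≈⟨ solve 2 (λ s f → f :* (s :* f) := s :* (f :* f)) refl (σ i) (f i) ⟩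
      σ i * (f i * f i)                      ∎

    simplex-form-1 : ⟪ σ , σ ⟫ ≈ ∑ σ
    simplex-form-1 = begin
      ∑ (λ i → σ i * row σ i)                         ≈⟨ ∑-cong {n} (λ i → *-congˡ (∑-cong {n} λ j → *-congʳ (sym (*-identityʳ (σ j))))) ⟩
      ∑ (λ i → σ i * row (λ j → σ j * 1#) i)          ≈⟨ ∑-cong {n} (λ i → trans (simplex-row (λ _ → 1#) i) (*-identityʳ (σ i))) ⟩
      ∑ σ                                             ∎

    -- The form is nonnegative at k δᵥ − σ (k a v + 1 − b): up to scaling, the
    -- difference of v and its projection to the affine hull of the simplex.
    simplex-bessel : 1# ≤ ∑ σ → ∀ v →
      ∑ σ * rowSq σ v ≤ ∑ σ + (1# - row σ v) * (1# - row σ v)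
    simplex-bessel 1≤k v = *-cancelˡ-≤ 1≤k (≤-by-difference (form-nonNeg x ∑x≈0) (sym (begin
      ⟪ x , x ⟫
        ≈⟨ form-bilinear k (- # 1) k (- # 1) (δ v) y (δ v) y ⟩
      k * (k * ⟪ δ v , δ v ⟫ + (- # 1) * ⟪ δ v , y ⟫) + (- # 1) * (k * ⟪ y , δ v ⟫ + (- # 1) * ⟪ y , y ⟫)
        ≈⟨ +-cong (*-congˡ (+-cong (*-congˡ δδ) (*-congˡ (trans (form-δˡ v y) row-y))))
             (*-congˡ (+-cong (*-congˡ (trans (form-δʳ v y) row-y)) (*-congˡ yy))) ⟩
      k * (k * # 1 + (- # 1) * (k * q + (# 1 - b) * b)) + (- # 1) * (k * (k * q + (# 1 - b) * b) +
        (- # 1) * (k * k * q + # 1 * (# 2 * k * (# 1 - b) * b + (# 1 - b) * (# 1 - b) * k)))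
        ≈⟨ solve 3 (λ k q b →
             k :* (k :* :# 1 :+ (:- :# 1) :* (k :* q :+ (:# 1 :- b) :* b)) :+ (:- :# 1) :* (k :* (k :* q :+ (:# 1 :- b) :* b) :+
               (:- :# 1) :* (k :* k :* q :+ :# 1 :* (:# 2 :* k :* (:# 1 :- b) :* b :+ (:# 1 :- b) :* (:# 1 :- b) :* k))) :=
             k :* (k :+ (:# 1 :- b) :* (:# 1 :- b)) :- k :* (k :* q)) refl k q b ⟩
      k * (k + (1# - b) * (1# - b)) - k * (k * q) ∎)))
      where
      k b q : Carrier
      k = ∑ σ
      b = row σ v
      q = rowSq σ v
      f y x : Weights
      f i = k * a v i + (# 1 - b)
      y i = σ i * f i
      x i = k * δ v i + (- # 1) * y i
      δδ : ⟪ δ v , δ v ⟫ ≈ # 1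
      δδ = trans (form-δˡ v (δ v)) (trans (row-δ v v) (a-refl v))
      ∑y : ∑ y ≈ k * b + (# 1 - b) * k
      ∑y = trans (∑-cong {n} λ i → solve 4 (λ s k a c → s :* (k :* a :+ c) := k :* (s :* a) :+ c :* s) refl (σ i) k (a v i) (# 1 - b))
        (∑-linear k (# 1 - b) (λ i → σ i * a v i) σ)
      ∑x≈0 : ∑ x ≈ 0#
      ∑x≈0 = begin
        ∑ x                                                  ≈⟨ ∑-linear k (- # 1) (δ v) y ⟩
        k * ∑ (δ v) + (- # 1) * ∑ y                          ≈⟨ +-cong (*-congˡ (∑-δ-1 v)) (*-congˡ ∑y) ⟩
        k * # 1 + (- # 1) * (k * b + (# 1 - b) * k)          ≈⟨ solve 2 (λ k b → k :* :# 1 :+ (:- :# 1) :* (k :* b :+ (:# 1 :- b) :* k) := :# 0) refl k b ⟩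
        0#                                                   ∎
      row-y : row y v ≈ k * q + (# 1 - b) * b
      row-y = trans (∑-cong {n} λ i → solve 4 (λ s k a c → s :* (k :* a :+ c) :* a := k :* (s :* (a :* a)) :+ c :* (s :* a)) refl (σ i) k (a v i) (# 1 - b))
        (∑-linear k (# 1 - b) (λ i → σ i * (a v i * a v i)) (λ i → σ i * a v i))
      yy : ⟪ y , y ⟫ ≈ k * k * q + # 1 * (# 2 * k * (# 1 - b) * b + (# 1 - b) * (# 1 - b) * k)
      yy = begin
        ⟪ y , y ⟫
          ≈⟨ simplex-form f ⟩
        ∑ (λ i → σ i * (f i * f i))
          ≈⟨ ∑-cong {n} (λ i → solve 4 (λ s k a c → s :* ((k :* a :+ c) :* (k :* a :+ c)) :=
               k :* k :* (s :* (a :* a)) :+ :# 1 :* (:# 2 :* k :* c :* (s :* a) :+ c :* c :* s)) refl (σ i) k (a v i) (# 1 - b)) ⟩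
        ∑ (λ i → k * k * (σ i * (a v i * a v i)) + # 1 * (# 2 * k * (# 1 - b) * (σ i * a v i) + (# 1 - b) * (# 1 - b) * σ i))
          ≈⟨ ∑-linear (k * k) (# 1) (λ i → σ i * (a v i * a v i)) (λ i → # 2 * k * (# 1 - b) * (σ i * a v i) + (# 1 - b) * (# 1 - b) * σ i) ⟩
        k * k * q + # 1 * ∑ (λ i → # 2 * k * (# 1 - b) * (σ i * a v i) + (# 1 - b) * (# 1 - b) * σ i)
          ≈⟨ +-congˡ (*-congˡ (∑-linear (# 2 * k * (# 1 - b)) ((# 1 - b) * (# 1 - b)) (λ i → σ i * a v i) σ)) ⟩
        k * k * q + # 1 * (# 2 * k * (# 1 - b) * b + (# 1 - b) * (# 1 - b) * k) ∎

  -- Cauchy–Schwarz for the vectors from the centroid of σ to v and to the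
  -- centroid of τ, scaled by k and k l.
  module _ {σ τ : Weights} (σ-simplex : Simplex σ) (τ-simplex : Simplex τ)
           (1≤k : 1# ≤ ∑ σ) (1≤l : 1# ≤ ∑ τ) where

    private
      k l β : Carrier
      k = ∑ σ
      l = ∑ τ
      β = ∑ λ i → τ i * row σ i
      y : Weights
      y i = k * τ i + (- l) * σ i
      ∑y≈0 : ∑ y ≈ 0#
      ∑y≈0 = trans (∑-linear k (- l) τ σ) (solve 2 (λ k l → k :* l :+ (:- l) :* k := :# 0) refl k l)
      yy : ⟪ y , y ⟫ ≈ k * (l * (k + l - # 2 * β))
      yy = begin
        ⟪ y , y ⟫
          ≈⟨ form-bilinear k (- l) k (- l) τ σ τ σ ⟩
        k * (k * ⟪ τ , τ ⟫ + (- l) * β) + (- l) * (k * ⟪ σ , τ ⟫ + (- l) * ⟪ σ , σ ⟫)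
          ≈⟨ +-cong (*-congˡ (+-congʳ (*-congˡ (simplex-form-1 τ-simplex))))
               (*-congˡ (+-cong (*-congˡ (form-sym σ τ)) (*-congˡ (simplex-form-1 σ-simplex)))) ⟩
        k * (k * l + (- l) * β) + (- l) * (k * β + (- l) * k)
          ≈⟨ solve 3 (λ k l β → k :* (k :* l :+ (:- l) :* β) :+ (:- l) :* (k :* β :+ (:- l) :* k) :=
               k :* (l :* (k :+ l :- :# 2 :* β))) refl k l β ⟩
        k * (l * (k + l - # 2 * β)) ∎
        where open Relation.Binary.Reasoning.Setoid setoid

    -- The form at k τ - l σ is k l times this quantity, which is thus 2 k l times the squared
    -- distance between the two centroids.
    centroid-distance-nonNeg : 0# ≤ k + l - # 2 * β
    centroid-distance-nonNeg = *-cancelˡ-≤ 1≤l (*-cancelˡ-≤ 1≤k (begin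
      k * (l * 0#)                 ≈⟨ solve 2 (λ k l → k :* (l :* :# 0) := :# 0) refl k l ⟩
      0#                           ≤⟨ form-nonNeg y ∑y≈0 ⟩
      ⟪ y , y ⟫                    ≈⟨ yy ⟩
      k * (l * (k + l - # 2 * β))  ∎))
      where open ≤-Reasoning

    -- The form between k δᵥ - σ and k τ - l σ equals k e, and its value at k δᵥ - σ is k (k + 1 - 2
    -- `row σ v`). A bound on e determines `row τ v` up to that error from data about σ.
    centroid-cauchy-schwarz : ∀ v → let e = k * row τ v - l * row σ v - β + l in
      e * e ≤ l * ((k + # 1 - # 2 * row σ v) * (k + l - # 2 * β))
    centroid-cauchy-schwarz v = *-cancelˡ-≤ 1≤k (*-cancelˡ-≤ 1≤k (begin
      k * (k * (e * e))
        ≈⟨ solve 2 (λ k e → k :* (k :* (e :* e)) := k :* e :* (k :* e)) refl k e ⟩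
      k * e * (k * e)
        ≈⟨ *-cong xy xy ⟨
      ⟪ x , y ⟫ * ⟪ x , y ⟫
        ≤⟨ form-cauchy-schwarz x y ∑x≈0 ∑y≈0 ⟩
      ⟪ x , x ⟫ * ⟪ y , y ⟫
        ≈⟨ *-cong xx yy ⟩
      k * (k + # 1 - # 2 * b) * (k * (l * (k + l - # 2 * β)))
        ≈⟨ solve 4 (λ k f l g → k :* f :* (k :* (l :* g)) := k :* (k :* (l :* (f :* g)))) refl k (k + # 1 - # 2 * b) l (k + l - # 2 * β) ⟩
      k * (k * (l * ((k + # 1 - # 2 * b) * (k + l - # 2 * β)))) ∎))
      where
      b b′ e : Carrier
      b = row σ v
      b′ = row τ v
      e = k * b′ - l * b - β + l
      x : Weights
      x i = k * δ v i + (- # 1) * σ i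
      ∑x≈0 : ∑ x ≈ 0#
      ∑x≈0 = trans (∑-linear k (- # 1) (δ v) σ) (trans (+-congʳ (*-congˡ (∑-δ-1 v)))
        (solve 1 (λ k → k :* :# 1 :+ (:- :# 1) :* k := :# 0) refl k))
      xx : ⟪ x , x ⟫ ≈ k * (k + # 1 - # 2 * b)
      xx = begin
        ⟪ x , x ⟫
          ≈⟨ form-bilinear k (- # 1) k (- # 1) (δ v) σ (δ v) σ ⟩
        k * (k * ⟪ δ v , δ v ⟫ + (- # 1) * ⟪ δ v , σ ⟫) + (- # 1) * (k * ⟪ σ , δ v ⟫ + (- # 1) * ⟪ σ , σ ⟫)
          ≈⟨ +-cong (*-congˡ (+-cong (*-congˡ (trans (form-δˡ v (δ v)) (trans (row-δ v v) (a-refl v)))) (*-congˡ (form-δˡ v σ))))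
               (*-congˡ (+-cong (*-congˡ (form-δʳ v σ)) (*-congˡ (simplex-form-1 σ-simplex)))) ⟩
        k * (k * # 1 + (- # 1) * b) + (- # 1) * (k * b + (- # 1) * k)
          ≈⟨ solve 2 (λ k b → k :* (k :* :# 1 :+ (:- :# 1) :* b) :+ (:- :# 1) :* (k :* b :+ (:- :# 1) :* k) :=
               k :* (k :+ :# 1 :- :# 2 :* b)) refl k b ⟩
        k * (k + # 1 - # 2 * b) ∎
        where open Relation.Binary.Reasoning.Setoid setoid
      xy : ⟪ x , y ⟫ ≈ k * e
      xy = begin
        ⟪ x , y ⟫
          ≈⟨ form-bilinear k (- # 1) k (- l) (δ v) σ τ σ ⟩
        k * (k * ⟪ δ v , τ ⟫ + (- l) * ⟪ δ v , σ ⟫) + (- # 1) * (k * ⟪ σ , τ ⟫ + (- l) * ⟪ σ , σ ⟫)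
          ≈⟨ +-cong (*-congˡ (+-cong (*-congˡ (form-δˡ v τ)) (*-congˡ (form-δˡ v σ))))
               (*-congˡ (+-cong (*-congˡ (form-sym σ τ)) (*-congˡ (simplex-form-1 σ-simplex)))) ⟩
        k * (k * b′ + (- l) * b) + (- # 1) * (k * β + (- l) * k)
          ≈⟨ solve 5 (λ k l b b′ β → k :* (k :* b′ :+ (:- l) :* b) :+ (:- :# 1) :* (k :* β :+ (:- l) :* k) :=
               k :* (k :* b′ :- l :* b :- β :+ l)) refl k l b b′ β ⟩
        k * e ∎
        where open Relation.Binary.Reasoning.Setoid setoid
      open ≤-Reasoning

-- The rank bound for weighted point sets.

module RankBound (R : OrderedRing) {n d : ℕ} (p : Fin n → Fin d → OrderedRing.Carrier R) where

  open OrderedRingProperties R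
  open UnitDistanceForm R p
  open Simplices R p

  module _ (θ : Weights) (0≤θ : ∀ i → 0# ≤ θ i) where

    private
      N s T : Carrier
      N = ∑ θ
      s = ⟪ θ , θ ⟫
      T = ∑ λ i → θ i * rowSq θ i
      r : Weights
      r = row θ
      -- The moment of `x i` is N pᵢ - Σⱼ θⱼ pⱼ, that is N times the vector from the weighted
      -- centroid to pᵢ.
      x : Fin n → Weights
      x i j = N * δ i j + (- # 1) * θ j
      h g : Fin n → Fin n → Carrier
      h i j = ⟪ x i , x j ⟫
      g i j = ∑ λ c → moment (x i) c * moment (x j) c
      module ≈ = Relation.Binary.Reasoning.Setoid setoid

      ∑x≈0 : ∀ i → ∑ (x i) ≈ 0#
      ∑x≈0 i = trans (∑-linear N (- # 1) (δ i) θ) (trans (+-congʳ (*-congˡ (∑-δ-1 i)))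
        (solve 1 (λ k → k :* :# 1 :+ (:- :# 1) :* k := :# 0) refl N))

      h≈ : ∀ i j → h i j ≈ N * (N * a i j - r i) - (N * r j - s)
      h≈ i j = trans (form-bilinear N (- # 1) N (- # 1) (δ i) θ (δ j) θ) (trans
        (+-cong (*-congˡ (+-cong (*-congˡ (trans (form-δˡ i (δ j)) (row-δ j i))) (*-congˡ (form-δˡ i θ))))
          (*-congˡ (+-congʳ (*-congˡ (form-δʳ j θ)))))
        (solve 5 (λ N a r t s → N :* (N :* a :+ (:- :# 1) :* r) :+ (:- :# 1) :* (N :* t :+ (:- :# 1) :* s) :=
          N :* (N :* a :- r) :- (N :* t :- s)) refl N (a i j) (r i) (r j) s))

      h≈2g : ∀ i j → h i j ≈ # 2 * g i j
      h≈2g i j = form-moment (x i) (x j) (∑x≈0 i) (∑x≈0 j)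

      -- The weights Σⱼ θⱼ xⱼ = N θ - N θ vanish identically.
      h-centred : ∀ i → ∑ (λ j → θ j * h i j) ≈ 0#
      h-centred i = ≈.begin
        ∑ (λ j → θ j * h i j)
          ≈.≈⟨ ∑-cong {n} (λ j → trans (*-congˡ (h≈ i j)) (solve 6 (λ t N a r u s →
               t :* (N :* (N :* a :- r) :- (N :* u :- s)) :=
               N :* N :* (t :* a) :+ :# 1 :* ((s :- N :* r) :* t :+ (:- N) :* (t :* u))) refl (θ j) N (a i j) (r i) (r j) s)) ⟩
        ∑ (λ j → N * N * (θ j * a i j) + # 1 * ((s - N * r i) * θ j + (- N) * (θ j * r j)))
          ≈.≈⟨ trans (∑-linear (N * N) (# 1) (λ j → θ j * a i j) (λ j → (s - N * r i) * θ j + (- N) * (θ j * r j)))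
               (+-congˡ (*-congˡ (∑-linear (s - N * r i) (- N) θ (λ j → θ j * r j)))) ⟩
        N * N * r i + # 1 * ((s - N * r i) * N + (- N) * s)
          ≈.≈⟨ solve 3 (λ N r s → N :* N :* r :+ :# 1 :* ((s :- N :* r) :* N :+ (:- N) :* s) := :# 0) refl N (r i) s ⟩
        0# ≈.∎

      H² G² : Carrier
      H² = ∑ λ i → ∑ λ j → θ i * θ j * (h i j * h i j)
      G² = ∑ λ i → ∑ λ j → θ i * θ j * (g i j * g i j)

      H²≈4G² : H² ≈ # 4 * G²
      H²≈4G² = trans (∑∑-cong {n} {n} λ i j → trans (*-congˡ (*-cong (h≈2g i j) (h≈2g i j)))
          (solve 2 (λ t g → t :* (:# 2 :* g :* (:# 2 :* g)) := :# 4 :* (t :* (g :* g))) refl (θ i * θ j) (g i j)))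
        (trans (∑-cong {n} λ i → sym (*-distribˡ-sum (# 4) (λ j → θ i * θ j * (g i j * g i j))))
          (sym (*-distribˡ-sum (# 4) (λ i → ∑ λ j → θ i * θ j * (g i j * g i j)))))

      trace-h : ∑ (λ i → θ i * h i i) ≈ N * (N * N - s)
      trace-h = ≈.begin
        ∑ (λ i → θ i * h i i)
          ≈.≈⟨ ∑-cong {n} (λ i → trans (*-congˡ (trans (h≈ i i) (+-congʳ (*-congˡ (+-congʳ (*-congˡ (a-refl i)))))))
               (solve 4 (λ t N r s → t :* (N :* (N :* :# 1 :- r) :- (N :* r :- s)) :=
                 (N :* N :+ s) :* t :+ (:- (:# 2 :* N)) :* (t :* r)) refl (θ i) N (r i) s)) ⟩
        ∑ (λ i → (N * N + s) * θ i + (- (# 2 * N)) * (θ i * r i))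
          ≈.≈⟨ ∑-linear (N * N + s) (- (# 2 * N)) θ (λ i → θ i * r i) ⟩
        (N * N + s) * N + (- (# 2 * N)) * s
          ≈.≈⟨ solve 2 (λ N s → (N :* N :+ s) :* N :+ (:- (:# 2 :* N)) :* s := N :* (N :* N :- s)) refl N s ⟩
        N * (N * N - s) ≈.∎

      trace-h-2g : ∑ (λ i → θ i * h i i) ≈ # 2 * ∑ (λ i → θ i * g i i)
      trace-h-2g = trans (∑-cong {n} λ i → trans (*-congˡ (h≈2g i i))
          (solve 2 (λ t g → t :* (:# 2 :* g) := :# 2 :* (t :* g)) refl (θ i) (g i i)))
        (sym (*-distribˡ-sum (# 2) (λ i → θ i * g i i)))

      D : Fin n → Fin n → Carrier
      D i j = N * r i - s + N * r j

      T≈∑∑ : T ≈ ∑ (λ i → ∑ λ j → θ i * θ j * (a i j * a i j))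
      T≈∑∑ = ∑-cong {n} λ i → trans (*-distribˡ-sum (θ i) (λ j → θ j * (a i j * a i j)))
        (∑-cong {n} λ j → sym (*-assoc (θ i) (θ j) (a i j * a i j)))

      -- `D` is the part of N² a removed by centring, a function of i plus a function of j. Each
      -- kind is orthogonal to `h` because the weighted row and column sums of `h` vanish.
      h-orthogonal : ∑ (λ i → ∑ λ j → θ i * θ j * (h i j * D i j)) ≈ 0#
      h-orthogonal = ≈.begin
        ∑ (λ i → ∑ λ j → θ i * θ j * (h i j * D i j))
          ≈.≈⟨ ∑∑-cong {n} {n} (λ i j → solve 6 (λ t u h N r z → t :* u :* (h :* (r :+ N :* z)) :=
               :# 1 :* (t :* r :* (u :* h)) :+ N :* (u :* z :* (t :* h))) refl (θ i) (θ j) (h i j) N (N * r i - s) (r j)) ⟩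
        ∑ (λ i → ∑ λ j → # 1 * (θ i * (N * r i - s) * (θ j * h i j)) + N * (θ j * r j * (θ i * h i j)))
          ≈.≈⟨ ∑∑-linear (# 1) N (λ i j → θ i * (N * r i - s) * (θ j * h i j)) (λ i j → θ j * r j * (θ i * h i j)) ⟩
        # 1 * ∑ (λ i → ∑ λ j → θ i * (N * r i - s) * (θ j * h i j)) + N * ∑ (λ i → ∑ λ j → θ j * r j * (θ i * h i j))
          ≈.≈⟨ +-cong (*-congˡ left) (*-congˡ right) ⟩
        # 1 * 0# + N * 0#
          ≈.≈⟨ solve 1 (λ N → :# 1 :* :# 0 :+ N :* :# 0 := :# 0) refl N ⟩
        0# ≈.∎
        where
        left : ∑ (λ i → ∑ λ j → θ i * (N * r i - s) * (θ j * h i j)) ≈ 0#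
        left = trans (∑-cong {n} λ i → trans (sym (*-distribˡ-sum (θ i * (N * r i - s)) (λ j → θ j * h i j)))
          (trans (*-congˡ (h-centred i)) (zeroʳ _))) (∑-zero n)
        right : ∑ (λ i → ∑ λ j → θ j * r j * (θ i * h i j)) ≈ 0#
        right = trans (∑-comm (λ i j → θ j * r j * (θ i * h i j)))
          (trans (∑-cong {n} λ j → trans (sym (*-distribˡ-sum (θ j * r j) (λ i → θ i * h i j)))
            (trans (*-congˡ (trans (∑-cong {n} λ i → *-congˡ (form-sym (x i) (x j))) (h-centred j))) (zeroʳ _)))
            (∑-zero n))

      -- The centred matrix h is the orthogonal projection of N² a.
      H²≤N⁴T : H² ≤ N * N * (N * N * T)
      H²≤N⁴T = ≤-by-difference
        (∑-nonNeg {n} λ i → ∑-nonNeg {n} λ j → *-nonNeg (*-nonNeg (0≤θ i) (0≤θ j)) (sq-nonNeg (D i j)))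
        (≈.begin
        N * N * (N * N * T) - H²
          ≈.≈⟨ trans (+-congʳ (trans (*-congˡ (*-congˡ T≈∑∑)) (sym (*-assoc (N * N) (N * N) _))))
               (solve 3 (λ a b c → a :* b :- c := a :* b :+ (:- :# 1) :* c) refl (N * N * (N * N)) _ H²) ⟩
        N * N * (N * N) * ∑ (λ i → ∑ λ j → θ i * θ j * (a i j * a i j)) + (- # 1) * H²
          ≈.≈⟨ ∑∑-linear (N * N * (N * N)) (- # 1) (λ i j → θ i * θ j * (a i j * a i j)) (λ i j → θ i * θ j * (h i j * h i j)) ⟨
        ∑ (λ i → ∑ λ j → N * N * (N * N) * (θ i * θ j * (a i j * a i j)) + (- # 1) * (θ i * θ j * (h i j * h i j)))
          ≈.≈⟨ ∑∑-cong {n} {n} pointwise ⟩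
        ∑ (λ i → ∑ λ j → # 1 * (θ i * θ j * (D i j * D i j)) + # 2 * (θ i * θ j * (h i j * D i j)))
          ≈.≈⟨ ∑∑-linear (# 1) (# 2) (λ i j → θ i * θ j * (D i j * D i j)) (λ i j → θ i * θ j * (h i j * D i j)) ⟩
        # 1 * ∑ (λ i → ∑ λ j → θ i * θ j * (D i j * D i j)) + # 2 * ∑ (λ i → ∑ λ j → θ i * θ j * (h i j * D i j))
          ≈.≈⟨ +-congˡ (*-congˡ h-orthogonal) ⟩
        # 1 * ∑ (λ i → ∑ λ j → θ i * θ j * (D i j * D i j)) + # 2 * 0#
          ≈.≈⟨ solve 1 (λ z → :# 1 :* z :+ :# 2 :* :# 0 := z) refl _ ⟩
        ∑ (λ i → ∑ λ j → θ i * θ j * (D i j * D i j)) ≈.∎)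
        where
        pointwise : ∀ i j → N * N * (N * N) * (θ i * θ j * (a i j * a i j)) + (- # 1) * (θ i * θ j * (h i j * h i j)) ≈
          # 1 * (θ i * θ j * (D i j * D i j)) + # 2 * (θ i * θ j * (h i j * D i j))
        pointwise i j = ≈.begin
          N * N * (N * N) * (θ i * θ j * (a i j * a i j)) + (- # 1) * (θ i * θ j * (h i j * h i j))
            ≈.≈⟨ +-congʳ (solve 3 (λ N t a → N :* N :* (N :* N) :* (t :* (a :* a)) := t :* (N :* N :* a :* (N :* N :* a))) refl N (θ i * θ j) (a i j)) ⟩
          θ i * θ j * (N * N * a i j * (N * N * a i j)) + (- # 1) * (θ i * θ j * (h i j * h i j))
            ≈.≈⟨ +-congʳ (*-congˡ (*-cong N²a N²a)) ⟩
          θ i * θ j * ((h i j + D i j) * (h i j + D i j)) + (- # 1) * (θ i * θ j * (h i j * h i j))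
            ≈.≈⟨ solve 3 (λ t h D → t :* ((h :+ D) :* (h :+ D)) :+ (:- :# 1) :* (t :* (h :* h)) :=
                 :# 1 :* (t :* (D :* D)) :+ :# 2 :* (t :* (h :* D))) refl (θ i * θ j) (h i j) (D i j) ⟩
          # 1 * (θ i * θ j * (D i j * D i j)) + # 2 * (θ i * θ j * (h i j * D i j)) ≈.∎
          where
          N²a : N * N * a i j ≈ h i j + D i j
          N²a = sym (trans (+-congʳ (h≈ i j)) (solve 5 (λ N a r z s →
            N :* (N :* a :- r) :- (N :* z :- s) :+ (N :* r :- s :+ N :* z) := N :* N :* a) refl N (a i j) (r i) (r j) s))

    -- The trace inequality is applied to h = 2 g, a Gram matrix of vectors in dimension d. Its
    -- weighted trace is N (N² - s) and its weighted square norm at most N⁴ T; a factor N² then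
    -- cancels.
    rank-bound : 1# ≤ ∑ θ →
      let e = ∑ θ * ∑ θ - ⟪ θ , θ ⟫ in
      e * e ≤ # d * (∑ θ * ∑ θ * ∑ (λ i → θ i * rowSq θ i))
    rank-bound 1≤N = *-cancelˡ-≤ 1≤N (*-cancelˡ-≤ 1≤N (begin
      N * (N * ((N * N - s) * (N * N - s)))
        ≈⟨ solve 2 (λ N e → N :* (N :* (e :* e)) := N :* e :* (N :* e)) refl N (N * N - s) ⟩
      N * (N * N - s) * (N * (N * N - s))
        ≈⟨ *-cong (trans (sym trace-h-2g) trace-h) (trans (sym trace-h-2g) trace-h) ⟨
      # 2 * t * (# 2 * t)
        ≈⟨ solve 1 (λ t → :# 2 :* t :* (:# 2 :* t) := :# 4 :* (t :* t)) refl t ⟩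
      # 4 * (t * t)
        ≤⟨ *-monoˡ-≤ (#-nonNeg 4) (trace-inequality θ (λ i → moment (x i))) ⟩
      # 4 * (# d * G²)
        ≈⟨ solve 3 (λ f d g → f :* (d :* g) := d :* (f :* g)) refl (# 4) (# d) G² ⟩
      # d * (# 4 * G²)
        ≈⟨ *-congˡ H²≈4G² ⟨
      # d * H²
        ≤⟨ *-monoˡ-≤ (#-nonNeg d) H²≤N⁴T ⟩
      # d * (N * N * (N * N * T))
        ≈⟨ solve 3 (λ d N T → d :* (N :* N :* (N :* N :* T)) := N :* (N :* (d :* (N :* N :* T)))) refl (# d) N T ⟩
      N * (N * (# d * (N * N * T))) ∎))
      where
      open ≤-Reasoning
      t : Carrier
      t = ∑ λ i → θ i * g i i

-- Zero-one weights.

module BinaryWeights (R : OrderedRing) where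

  open OrderedRingProperties R

  Binary : Carrier → Set
  Binary x = x ≈ 0# ⊎ x ≈ 1#

  binary-* : ∀ {x y} → Binary x → Binary y → Binary (x * y)
  binary-* {x} {y} (inj₁ x≈0) _          = inj₁ (trans (*-congʳ x≈0) (zeroˡ y))
  binary-* {x} {y} (inj₂ x≈1) (inj₁ y≈0) = inj₁ (trans (*-congˡ y≈0) (zeroʳ x))
  binary-* {x} {y} (inj₂ x≈1) (inj₂ y≈1) = inj₂ (trans (*-cong x≈1 y≈1) (*-identityˡ 1#))

  binary-idem : ∀ {x} → Binary x → x * x ≈ x
  binary-idem {x} (inj₁ x≈0) = trans (*-congˡ x≈0) (trans (zeroʳ x) (sym x≈0))
  binary-idem {x} (inj₂ x≈1) = trans (*-congˡ x≈1) (*-identityʳ x)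

  binary-nonNeg : ∀ {x} → Binary x → 0# ≤ x
  binary-nonNeg (inj₁ x≈0) = ≤-reflexive (sym x≈0)
  binary-nonNeg (inj₂ x≈1) = ≤-trans 0≤1 (≤-reflexive (sym x≈1))

  binary-≤1 : ∀ {x} → Binary x → x ≤ 1#
  binary-≤1 (inj₁ x≈0) = ≤-trans (≤-reflexive x≈0) 0≤1
  binary-≤1 (inj₂ x≈1) = ≤-reflexive x≈1

  -- This dichotomy supplies the hypothesis 1 ≤ c of `*-cancelˡ-≤` whenever c is the size of a
  -- selected set.
  ∑-binary : ∀ {n} {f : Fin n → Carrier} → (∀ i → Binary (f i)) → (∀ i → f i ≈ 0#) ⊎ 1# ≤ ∑ f
  ∑-binary {zero}      b = inj₁ λ ()
  ∑-binary {suc n} {f} b with b zero | ∑-binary {n} (λ i → b (suc i))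
  ... | inj₁ f0≈0 | inj₁ fs≈0 = inj₁ λ { zero → f0≈0 ; (suc i) → fs≈0 i }
  ... | inj₁ f0≈0 | inj₂ 1≤∑  = inj₂ (≤-trans 1≤∑ (≤-trans (≤-reflexive (sym (+-identityˡ _)))
    (+-monoˡ-≤ _ (≤-reflexive (sym f0≈0)))))
  ... | inj₂ f0≈1 | _         = inj₂ (≤-trans (≤-reflexive (trans (sym f0≈1) (sym (+-identityʳ _))))
    (+-monoʳ-≤ (f zero) (∑-nonNeg {n} λ i → binary-nonNeg (b (suc i)))))

  argmax : ∀ {n} (f : Fin (suc n) → Carrier) → ∃[ i ] (∀ j → f j ≤ f i)
  argmax {zero}  f = zero , λ { zero → ≤-refl }
  argmax {suc n} f with argmax (λ i → f (suc i))
  ... | i , fs≤fi with total (f zero) (f (suc i))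
  ...   | inj₁ f0≤fi = suc i , λ { zero → f0≤fi ; (suc j) → fs≤fi j }
  ...   | inj₂ fi≤f0 = zero , λ { zero → ≤-refl ; (suc j) → ≤-trans (fs≤fi j) fi≤f0 }

-- The graph of non-unit distances.

module NonUnitGraph (R : OrderedRing) {n d : ℕ} (p : Fin n → Fin d → OrderedRing.Carrier R) where

  open OrderedRingProperties R
  open BinaryWeights R
  open UnitDistanceForm R p
  open Simplices R p
  open RankBound R p

  χ : Fin n → Fin n → Carrier
  χ i j with i Fin.≟ j | a i j ≈? 0#
  ... | yes _ | _     = 0#
  ... | no _  | yes _ = 0#
  ... | no _  | no _  = 1#

  -- Propositional equality is used so that matching on `refl` replaces the entry by a numeral.
  χ-cases : ∀ i j → χ i j ≡ 0# ⊎ (χ i j ≡ 1# × ¬ i ≡ j × ¬ a i j ≈ 0#)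
  χ-cases i j with i Fin.≟ j | a i j ≈? 0#
  ... | yes _   | _       = inj₁ ≡.refl
  ... | no _    | yes _   = inj₁ ≡.refl
  ... | no i≢j  | no a≉0  = inj₂ (≡.refl , i≢j , a≉0)

  χ-binary : ∀ i j → Binary (χ i j)
  χ-binary i j with χ i j | χ-cases i j
  ... | _ | inj₁ ≡.refl       = inj₁ refl
  ... | _ | inj₂ (≡.refl , _) = inj₂ refl

  χ-nonNeg : ∀ i j → 0# ≤ χ i j
  χ-nonNeg i j = binary-nonNeg (χ-binary i j)

  χ-refl : ∀ i → χ i i ≡ 0#
  χ-refl i with χ-cases i i
  ... | inj₁ χ≡0             = χ≡0
  ... | inj₂ (_ , i≢i , _)   = contradiction ≡.refl i≢i

  χ-sym : ∀ i j → χ i j ≡ χ j i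
  χ-sym i j with i Fin.≟ j | j Fin.≟ i | a i j ≈? 0# | a j i ≈? 0#
  ... | yes _   | yes _   | _       | _       = ≡.refl
  ... | yes i≡j | no j≢i  | _       | _       = contradiction (≡.sym i≡j) j≢i
  ... | no i≢j  | yes j≡i | _       | _       = contradiction (≡.sym j≡i) i≢j
  ... | no _    | no _    | yes _   | yes _   = ≡.refl
  ... | no _    | no _    | yes p≈0 | no q≉0  = contradiction (trans (a-sym j i) p≈0) q≉0
  ... | no _    | no _    | no p≉0  | yes q≈0 = contradiction (trans (a-sym i j) q≈0) p≉0
  ... | no _    | no _    | no _    | no _    = ≡.refl

  a-off-graph : ∀ i j → a i j ≈ δ i j + χ i j * a i j
  a-off-graph i j with i Fin.≟ j | a i j ≈? 0#
  ... | yes ≡.refl | _       = trans (a-refl i) (trans (sym (reflexive (δ-refl i))) (sym (trans (+-congˡ (zeroˡ _)) (+-identityʳ _))))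
  ... | no i≢j     | yes a≈0 = trans a≈0 (sym (trans (+-cong (reflexive (δ-≢ i≢j)) (zeroˡ _)) (+-identityˡ _)))
  ... | no i≢j     | no _    = sym (trans (+-cong (reflexive (δ-≢ i≢j)) (*-identityˡ _)) (+-identityˡ _))

  a²-off-graph : ∀ i j → a i j * a i j ≈ δ i j + χ i j * (a i j * a i j)
  a²-off-graph i j with i Fin.≟ j | a i j ≈? 0#
  ... | yes ≡.refl | _       = trans (trans (*-cong (a-refl i) (a-refl i)) (*-identityˡ 1#))
    (trans (sym (reflexive (δ-refl i))) (sym (trans (+-congˡ (zeroˡ _)) (+-identityʳ _))))
  ... | no i≢j     | yes a≈0 = trans (trans (*-congˡ a≈0) (zeroʳ _)) (sym (trans (+-cong (reflexive (δ-≢ i≢j)) (zeroˡ _)) (+-identityˡ _)))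
  ... | no i≢j     | no _    = sym (trans (+-cong (reflexive (δ-≢ i≢j)) (*-identityˡ _)) (+-identityˡ _))

  -- The indicator of a i j ≉ 0. Inserted into a row sum it changes nothing, but lets Cauchy-Schwarz
  -- count only the terms that matter.
  support : Fin n → Fin n → Carrier
  support i j = δ i j + χ i j

  support-binary : ∀ i j → Binary (support i j)
  support-binary i j with toSum (i Fin.≟ j)
  ... | inj₁ ≡.refl = inj₂ (trans (+-cong (reflexive (δ-refl i)) (reflexive (χ-refl i))) (+-identityʳ 1#))
  ... | inj₂ i≢j with χ-binary i j
  ...   | inj₁ χ≈0 = inj₁ (trans (+-cong (reflexive (δ-≢ i≢j)) χ≈0) (+-identityʳ 0#))
  ...   | inj₂ χ≈1 = inj₂ (trans (+-cong (reflexive (δ-≢ i≢j)) χ≈1) (+-identityˡ 1#))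

  support-a : ∀ i j → support i j * a i j ≈ a i j
  support-a i j with toSum (i Fin.≟ j)
  ... | inj₁ ≡.refl = trans (*-congʳ (trans (+-cong (reflexive (δ-refl i)) (reflexive (χ-refl i))) (+-identityʳ 1#))) (*-identityˡ _)
  ... | inj₂ i≢j     = trans (*-congʳ (trans (+-congʳ (reflexive (δ-≢ i≢j))) (+-identityˡ _)))
    (sym (trans (a-off-graph i j) (trans (+-congʳ (reflexive (δ-≢ i≢j))) (+-identityˡ _))))

  simplex-restrict : {σ θ : Weights} → (∀ i → Binary (θ i)) → Simplex σ → Simplex (λ i → σ i * θ i)
  simplex-restrict {σ} {θ} θ-binary simplex i j = begin
    σ i * θ i * (σ j * θ j) * a i j   ≈⟨ solve 5 (λ s t u v a → s :* t :* (u :* v) :* a := t :* v :* (s :* u :* a)) refl (σ i) (θ i) (σ j) (θ j) (a i j) ⟩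
    θ i * θ j * (σ i * σ j * a i j)   ≈⟨ *-congˡ (simplex i j) ⟩
    θ i * θ j * (σ i * δ i j)         ≈⟨ collapse ⟩
    σ i * θ i * δ i j                 ∎
    where
    open Relation.Binary.Reasoning.Setoid setoid
    collapse : θ i * θ j * (σ i * δ i j) ≈ σ i * θ i * δ i j
    collapse with toSum (i Fin.≟ j)
    ... | inj₁ ≡.refl = trans (*-congʳ (binary-idem (θ-binary i)))
      (solve 3 (λ s t e → t :* (s :* e) := s :* t :* e) refl (σ i) (θ i) (δ i i))
    ... | inj₂ i≢j     = trans (*-congˡ (trans (*-congˡ (reflexive (δ-≢ i≢j))) (zeroʳ _)))
      (trans (zeroʳ _) (sym (trans (*-congˡ (reflexive (δ-≢ i≢j))) (zeroʳ _))))

  -- On a simplex of size k both the form and the sum of squares equal k, so the rank bound becomes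
  -- (k - 1)² ≤ d k, that is k² + 1 ≤ (d + 2) k.
  simplex-size : {σ : Weights} → (∀ i → Binary (σ i)) → Simplex σ → 1# ≤ ∑ σ → ∑ σ ≤ # d + # 2
  simplex-size {σ} σ-binary simplex 1≤k = *-cancelˡ-≤ 1≤k (≤-by-difference
    (+-nonNeg 0≤1 (x≤y⇒0≤y-x bound))
    (solve 2 (λ k d → k :* (d :+ :# 2) :- k :* k := :# 1 :+ (d :* k :- (k :- :# 1) :* (k :- :# 1))) refl k (# d)))
    where
    k : Carrier
    k = ∑ σ
    T≈k : ∑ (λ i → σ i * rowSq σ i) ≈ k
    T≈k = ∑-cong {n} λ i → begin
      σ i * rowSq σ i                          ≈⟨ *-distribˡ-sum (σ i) (λ j → σ j * (a i j * a i j)) ⟩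
      ∑ (λ j → σ i * (σ j * (a i j * a i j)))  ≈⟨ ∑-cong {n} (λ j → trans
                                                    (solve 3 (λ s t a → s :* (t :* (a :* a)) := s :* t :* a :* a) refl (σ i) (σ j) (a i j))
                                                    (trans (*-congʳ (simplex i j)) (*-assoc (σ i) (δ i j) (a i j)))) ⟩
      ∑ (λ j → σ i * (δ i j * a i j))          ≈⟨ *-distribˡ-sum (σ i) (λ j → δ i j * a i j) ⟨
      σ i * ∑ (λ j → δ i j * a i j)            ≈⟨ *-congˡ (trans (∑-δ i (a i)) (a-refl i)) ⟩
      σ i * 1#                                 ≈⟨ *-identityʳ (σ i) ⟩
      σ i                                      ∎
      where open Relation.Binary.Reasoning.Setoid setoid
    bound : (k - # 1) * (k - # 1) ≤ # d * k
    bound = *-cancelˡ-≤ 1≤k (*-cancelˡ-≤ 1≤k (begin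
      k * (k * ((k - # 1) * (k - # 1)))           ≈⟨ solve 1 (λ k → k :* (k :* ((k :- :# 1) :* (k :- :# 1))) := (k :* k :- k) :* (k :* k :- k)) refl k ⟩
      (k * k - k) * (k * k - k)                   ≈⟨ *-cong (+-congˡ (-‿cong s)) (+-congˡ (-‿cong s)) ⟨
      (k * k - ⟪ σ , σ ⟫) * (k * k - ⟪ σ , σ ⟫)   ≤⟨ rank-bound σ (λ i → binary-nonNeg (σ-binary i)) 1≤k ⟩
      # d * (k * k * ∑ (λ i → σ i * rowSq σ i))   ≈⟨ *-congˡ (*-congˡ T≈k) ⟩
      # d * (k * k * k)                           ≈⟨ solve 2 (λ k d → d :* (k :* k :* k) := k :* (k :* (d :* k))) refl k (# d) ⟩
      k * (k * (# d * k))                         ∎))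
      where
      open ≤-Reasoning
      s : ⟪ σ , σ ⟫ ≈ k
      s = simplex-form-1 simplex

  -- For two distinct neighbours i, j of v the entries a v i and a v j are nonzero, so the triple v,
  -- i, j leaves only a i j ≈ 0.
  neighbourhood-simplex : (∀ i j l → ¬ i ≡ j → ¬ j ≡ l → ¬ i ≡ l → a i j ≈ 0# ⊎ a j l ≈ 0# ⊎ a i l ≈ 0#) →
    ∀ v → Simplex (χ v)
  neighbourhood-simplex sparse v i j with toSum (i Fin.≟ j)
  ... | inj₁ ≡.refl = trans (*-cong (binary-idem (χ-binary v i)) (a-refl i)) (*-congˡ (sym (reflexive (δ-refl i))))
  ... | inj₂ i≢j     = trans off-diagonal (sym (trans (*-congˡ (reflexive (δ-≢ i≢j))) (zeroʳ _)))
    where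
    off-diagonal : χ v i * χ v j * a i j ≈ 0#
    off-diagonal with χ v i | χ-cases v i | χ v j | χ-cases v j
    ... | _ | inj₁ ≡.refl | x | _           = trans (*-congʳ (zeroˡ x)) (zeroˡ _)
    ... | x | inj₂ _      | _ | inj₁ ≡.refl = trans (*-congʳ (zeroʳ x)) (zeroˡ _)
    ... | x | inj₂ (_ , v≢i , vi≉0) | y | inj₂ (_ , v≢j , vj≉0) with sparse v i j v≢i i≢j v≢j
    ...   | inj₁ vi≈0        = contradiction vi≈0 vi≉0
    ...   | inj₂ (inj₁ ij≈0) = trans (*-congˡ ij≈0) (zeroʳ _)
    ...   | inj₂ (inj₂ vj≈0) = contradiction vj≈0 vj≉0

-- Polynomial inequalities behind the estimates, with their constants.

module Polynomials (R : OrderedRing) where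

  open OrderedRingProperties R

  -- From (1 - b)² ≤ 2 + 2 b² one gets k b² ≤ m k q ≤ m (k + 2 + 2 b²). As 4 m ≤ k, the term 2 m b²
  -- is absorbed by half of the left side, leaving k b² ≤ 2 m k + 4 m ≤ 6 m k.
  row-square-bound : ∀ {k m q b} → 0# ≤ m → 1# ≤ k → # 4 * m ≤ k →
    b * b ≤ m * q → k * q ≤ k + (1# - b) * (1# - b) → b * b ≤ # 6 * m
  row-square-bound {k} {m} {q} {b} 0≤m 1≤k 4m≤k b²≤mq kq≤ = *-cancelˡ-≤ 1≤k (≤-by-difference
    (+-nonNeg (+-nonNeg (+-nonNeg
      (*-nonNeg (*-nonNeg (#-nonNeg 4) 0≤m) (x≤y⇒0≤y-x 1≤k))
      (*-nonNeg (x≤y⇒0≤y-x 4m≤k) (sq-nonNeg b)))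
      (*-nonNeg (*-nonNeg (#-nonNeg 2) 0≤m) (+-nonNeg (x≤y⇒0≤y-x kq≤) (sq-nonNeg (1# + b)))))
      (*-nonNeg (*-nonNeg (#-nonNeg 2) (≤-trans 0≤1 1≤k)) (x≤y⇒0≤y-x b²≤mq)))
    (solve 4 (λ k m q b → k :* (:# 6 :* m) :- k :* (b :* b) :=
      :# 4 :* m :* (k :- :# 1) :+ (k :- :# 4 :* m) :* (b :* b)
      :+ :# 2 :* m :* (k :+ (:# 1 :- b) :* (:# 1 :- b) :- k :* q :+ (:# 1 :+ b) :* (:# 1 :+ b))
      :+ :# 2 :* k :* (m :* q :- b :* b)) refl k m q b))

  four-squares : ∀ x y z w → (x + y + z - w) * (x + y + z - w) ≤
    # 4 * (x * x + y * y + z * z + w * w)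
  four-squares x y z w = ≤-by-difference
    (+-nonNeg (+-nonNeg (+-nonNeg (+-nonNeg (+-nonNeg
      (sq-nonNeg (x - y)) (sq-nonNeg (x - z))) (sq-nonNeg (x + w)))
      (sq-nonNeg (y - z))) (sq-nonNeg (y + w))) (sq-nonNeg (z + w)))
    (solve 4 (λ x y z w → :# 4 :* (x :* x :+ y :* y :+ z :* z :+ w :* w) :- (x :+ y :+ z :- w) :* (x :+ y :+ z :- w) :=
      (x :- y) :* (x :- y) :+ (x :- z) :* (x :- z) :+ (x :+ w) :* (x :+ w) :+ (y :- z) :* (y :- z)
      :+ (y :+ w) :* (y :+ w) :+ (z :+ w) :* (z :+ w)) refl x y z w)

  -- In the application k and l are the sizes of σ and of the retained neighbourhood τ of v, b and
  -- b′ the row sums of v over them, β and η the sums over τ of the σ-row sums and of their squares,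
  -- and q the sum of squares to be bounded. Bessel in τ reduces q to b′², and e reduces b′ to b, β
  -- and l. The term in β keeps its sign, to be summed over v later.
  neighbourhood-bound : ∀ {k l b b′ β η q} → 1# ≤ k → 1# ≤ l → l ≤ k →
    b * b ≤ # 2 * k → β * β ≤ l * η →
    l * q ≤ l + (1# - b′) * (1# - b′) →
    0# ≤ k + l - # 2 * β →
    (let e = k * b′ - l * b - β + l in e * e ≤ l * ((k + # 1 - # 2 * b) * (k + l - # 2 * β))) →
    k * k * q ≤ # 91 * (k * k) - # 80 * (k * β) + # 8 * (k * (b * b)) + # 8 * η
  neighbourhood-bound {k} {l} {b} {b′} {β} {η} {q} 1≤k 1≤l l≤k b²≤2k β²≤lη lq≤ 0≤f e²≤ =
    ≤-trans (*-cancelˡ-≤ 1≤l scaled) final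
    where
    open ≤-Reasoning
    f e y : Carrier
    f = k + l - # 2 * β
    e = k * b′ - l * b - β + l
    y = # 4 * (# 5 * k * f + l * (b * b) + η + l)
    0≤k : 0# ≤ k
    0≤k = ≤-trans 0≤1 1≤k
    0≤l : 0# ≤ l
    0≤l = ≤-trans 0≤1 1≤l
    -- Since -2 b ≤ b² + 1 ≤ 2 k + 1, the factor k + 1 - 2 b is at most 3 k + 2 ≤ 5 k.
    e²≤5klf : e * e ≤ l * (# 5 * k * f)
    e²≤5klf = ≤-trans e²≤ (*-monoˡ-≤ 0≤l (≤-by-difference
      (*-nonNeg (+-nonNeg (+-nonNeg (x≤y⇒0≤y-x b²≤2k) (*-nonNeg (#-nonNeg 2) (x≤y⇒0≤y-x 1≤k))) (sq-nonNeg (b + 1#))) 0≤f)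
      (solve 3 (λ k b f → :# 5 :* k :* f :- (k :+ :# 1 :- :# 2 :* b) :* f :=
        (:# 2 :* k :- b :* b :+ :# 2 :* (k :- :# 1) :+ (b :+ :# 1) :* (b :+ :# 1)) :* f) refl k b f)))
    -- Solving for the row sum gives k b′ = e + l b + β - l. Each of the four squares carries a
    -- factor l, which is why β² ≤ l η is used in this form.
    kb′²≤ly : k * k * (b′ * b′) ≤ l * y
    kb′²≤ly = begin
      k * k * (b′ * b′)
        ≈⟨ solve 5 (λ k l b b′ β → k :* k :* (b′ :* b′) :=
             ((k :* b′ :- l :* b :- β :+ l) :+ l :* b :+ β :- l) :* ((k :* b′ :- l :* b :- β :+ l) :+ l :* b :+ β :- l)) refl k l b b′ β ⟩
      (e + l * b + β - l) * (e + l * b + β - l)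
        ≤⟨ four-squares e (l * b) β l ⟩
      # 4 * (e * e + l * b * (l * b) + β * β + l * l)
        ≤⟨ *-monoˡ-≤ (#-nonNeg 4) (+-monoˡ-≤ (l * l) (+-mono-≤ (+-monoˡ-≤ (l * b * (l * b)) e²≤5klf) β²≤lη)) ⟩
      # 4 * (l * (# 5 * k * f) + l * b * (l * b) + l * η + l * l)
        ≈⟨ solve 5 (λ k l b f η → :# 4 :* (l :* (:# 5 :* k :* f) :+ l :* b :* (l :* b) :+ l :* η :+ l :* l) :=
             l :* (:# 4 :* (:# 5 :* k :* f :+ l :* (b :* b) :+ η :+ l))) refl k l b f η ⟩
      l * y ∎
    -- Here l q ≤ l + 2 + 2 b′² ≤ 3 l + 2 b′², by (1 - b′)² ≤ 2 + 2 b′² and 1 ≤ l.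
    scaled : l * (k * k * q) ≤ l * (# 3 * (k * k) + # 2 * y)
    scaled = ≤-by-difference
      (+-nonNeg (*-nonNeg (sq-nonNeg k) (+-nonNeg (+-nonNeg (x≤y⇒0≤y-x lq≤) (sq-nonNeg (1# + b′))) (*-nonNeg (#-nonNeg 2) (x≤y⇒0≤y-x 1≤l))))
        (*-nonNeg (#-nonNeg 2) (x≤y⇒0≤y-x kb′²≤ly)))
      (solve 5 (λ k l b′ q y → l :* (:# 3 :* (k :* k) :+ :# 2 :* y) :- l :* (k :* k :* q) :=
        k :* k :* (l :+ (:# 1 :- b′) :* (:# 1 :- b′) :- l :* q :+ (:# 1 :+ b′) :* (:# 1 :+ b′) :+ :# 2 :* (l :- :# 1))
        :+ :# 2 :* (l :* y :- k :* k :* (b′ :* b′))) refl k l b′ q y)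
    -- The constant is 91 = 3 + 80 + 8: besides 3 k² there are 40 k (k + l) ≤ 80 k² from f and 8 l ≤
    -- 8 k².
    final : # 3 * (k * k) + # 2 * y ≤ # 91 * (k * k) - # 80 * (k * β) + # 8 * (k * (b * b)) + # 8 * η
    final = ≤-by-difference
      (+-nonNeg (+-nonNeg (*-nonNeg (*-nonNeg (#-nonNeg 40) 0≤k) (x≤y⇒0≤y-x l≤k))
        (*-nonNeg (#-nonNeg 8) (*-nonNeg (x≤y⇒0≤y-x l≤k) (sq-nonNeg b))))
        (*-nonNeg (#-nonNeg 8) (+-nonNeg (*-nonNeg 0≤k (x≤y⇒0≤y-x 1≤k)) (x≤y⇒0≤y-x l≤k))))
      (solve 5 (λ k l b β η →
        :# 91 :* (k :* k) :- :# 80 :* (k :* β) :+ :# 8 :* (k :* (b :* b)) :+ :# 8 :* η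
        :- (:# 3 :* (k :* k) :+ :# 2 :* (:# 4 :* (:# 5 :* k :* (k :+ l :- :# 2 :* β) :+ l :* (b :* b) :+ η :+ l))) :=
        :# 40 :* k :* (k :- l) :+ :# 8 :* ((k :- l) :* (b :* b)) :+ :# 8 :* (k :* (k :- :# 1) :+ (k :- l))) refl k l b β η)

  -- In the application N ≤ n is the size of the retained set, t is k Σ a², and
  -- x² ≤ 12 N k⁴ bounds the mixed term.
  cubic-bound : ∀ {n N d k x t} → 1# ≤ k → 1# ≤ d → k ≤ # 3 * d →
    # 20 * k ≤ n → N ≤ n → n ≤ N + # 8 * k →
    t ≤ # 92 * (k * N) + # 80 * x + # 192 * (k * k) →
    x * x ≤ # 12 * (N * (k * k * (k * k))) →
    k * ((N - 1# - k) * (N - 1# - k)) ≤ d * t →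
    n * (n * n) ≤ # 728 * (# 728 * # 728) * (d * d * (d * d))
  cubic-bound {n} {N} {d} {k} {x} {t} 1≤k 1≤d k≤3d 20k≤n N≤n n≤N+8k t≤ x²≤ ku²≤dt = conclude (total x (k * n))
    where
    open ≤-Reasoning
    u c : Carrier
    u = N - 1# - k
    c = # 728
    0≤k : 0# ≤ k
    0≤k = ≤-trans 0≤1 1≤k
    0≤d : 0# ≤ d
    0≤d = ≤-trans 0≤1 1≤d
    0≤c : 0# ≤ c
    0≤c = #-nonNeg 728
    108≤c : # 108 ≤ c
    108≤c = ≤-by-difference (#-nonNeg 620) (solve 0 (:# 728 :- :# 108 := :# 620) refl)
    1≤c : 1# ≤ c
    1≤c = ≤-by-difference (#-nonNeg 727) (solve 0 (:# 728 :- :# 1 := :# 727) refl)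
    1≤n : 1# ≤ n
    1≤n = ≤-by-difference (+-nonNeg (+-nonNeg (x≤y⇒0≤y-x 20k≤n) (*-nonNeg (#-nonNeg 20) (x≤y⇒0≤y-x 1≤k))) (#-nonNeg 19))
      (solve 2 (λ n k → n :- :# 1 := n :- :# 20 :* k :+ :# 20 :* (k :- :# 1) :+ :# 19) refl n k)
    0≤n : 0# ≤ n
    0≤n = ≤-trans 0≤1 1≤n
    -- The threshold 20 comes from here: passing from n to u loses at most 9 k + 1, and twice that
    -- is at most 20 k ≤ n.
    n≤2u : n ≤ # 2 * u
    n≤2u = ≤-by-difference (+-nonNeg (+-nonNeg (*-nonNeg (#-nonNeg 2) (x≤y⇒0≤y-x n≤N+8k)) (x≤y⇒0≤y-x 20k≤n)) (*-nonNeg (#-nonNeg 2) (x≤y⇒0≤y-x 1≤k)))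
      (solve 3 (λ n N k → :# 2 :* (N :- :# 1 :- k) :- n :=
        :# 2 :* (N :+ :# 8 :* k :- n) :+ (n :- :# 20 :* k) :+ :# 2 :* (k :- :# 1)) refl n N k)
    -- The term 192 k² is at most 10 k n, whence 102 = 92 + 10.
    kn²≤ : k * (n * n) ≤ # 4 * d * (# 102 * (k * n) + # 80 * x)
    kn²≤ = begin
      k * (n * n)
        ≤⟨ *-monoˡ-≤ 0≤k (*-mono-≤ 0≤n 0≤n n≤2u n≤2u) ⟩
      k * (# 2 * u * (# 2 * u))
        ≈⟨ solve 2 (λ k u → k :* (:# 2 :* u :* (:# 2 :* u)) := :# 4 :* (k :* (u :* u))) refl k u ⟩
      # 4 * (k * (u * u))
        ≤⟨ *-monoˡ-≤ (#-nonNeg 4) (≤-trans ku²≤dt (*-monoˡ-≤ 0≤d t≤)) ⟩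
      # 4 * (d * (# 92 * (k * N) + # 80 * x + # 192 * (k * k)))
        ≤⟨ ≤-by-difference
             (*-nonNeg (*-nonNeg (#-nonNeg 4) 0≤d) (*-nonNeg 0≤k (+-nonNeg (+-nonNeg (*-nonNeg (#-nonNeg 92) (x≤y⇒0≤y-x N≤n))
               (*-nonNeg (#-nonNeg 10) (x≤y⇒0≤y-x 20k≤n))) (*-nonNeg (#-nonNeg 8) 0≤k))))
             (solve 5 (λ n N d k x → :# 4 :* d :* (:# 102 :* (k :* n) :+ :# 80 :* x) :-
               :# 4 :* (d :* (:# 92 :* (k :* N) :+ :# 80 :* x :+ :# 192 :* (k :* k))) :=
               :# 4 :* d :* (k :* (:# 92 :* (n :- N) :+ :# 10 :* (n :- :# 20 :* k) :+ :# 8 :* k))) refl n N d k x) ⟩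
      # 4 * d * (# 102 * (k * n) + # 80 * x) ∎
    conclude : x ≤ k * n ⊎ k * n ≤ x → n * (n * n) ≤ c * (c * c) * (d * d * (d * d))
    conclude (inj₁ x≤kn) = begin
      n * (n * n)
        ≤⟨ *-mono-≤ 0≤n (*-nonNeg 0≤n 0≤n) n≤cd (*-mono-≤ 0≤n 0≤n n≤cd n≤cd) ⟩
      c * d * (c * d * (c * d))
        ≤⟨ ≤-by-difference (*-nonNeg (*-nonNeg 0≤c (*-nonNeg 0≤c 0≤c)) (*-nonNeg (*-nonNeg 0≤d (*-nonNeg 0≤d 0≤d)) (x≤y⇒0≤y-x 1≤d)))
             (solve 2 (λ c d → c :* (c :* c) :* (d :* d :* (d :* d)) :- c :* d :* (c :* d :* (c :* d)) :=
               c :* (c :* c) :* (d :* (d :* d) :* (d :- :# 1))) refl c d) ⟩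
      c * (c * c) * (d * d * (d * d)) ∎
      where
      n≤cd : n ≤ c * d
      n≤cd = *-cancelˡ-≤ 1≤n (*-cancelˡ-≤ 1≤k (≤-trans kn²≤ (≤-by-difference
        (*-nonNeg (*-nonNeg (#-nonNeg 320) 0≤d) (x≤y⇒0≤y-x x≤kn))
        (solve 4 (λ n d k x → k :* (n :* (:# 728 :* d)) :- :# 4 :* d :* (:# 102 :* (k :* n) :+ :# 80 :* x) :=
          :# 320 :* d :* (k :* n :- x)) refl n d k x))))
    -- The inequality k n² ≤ 728 d x is squared to remove the root. Of the k⁴ in the bound on x²,
    -- two factors cancel and two become 3 d, so 108 = 12 · 9.
    conclude (inj₂ kn≤x) = *-cancelˡ-≤ 1≤n (*-cancelˡ-≤ 1≤k (*-cancelˡ-≤ 1≤k (begin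
      k * (k * (n * (n * (n * n))))
        ≈⟨ solve 2 (λ k n → k :* (k :* (n :* (n :* (n :* n)))) := k :* (n :* n) :* (k :* (n :* n))) refl k n ⟩
      k * (n * n) * (k * (n * n))
        ≤⟨ *-mono-≤ 0≤kn² 0≤kn² kn²≤cdx kn²≤cdx ⟩
      c * d * x * (c * d * x)
        ≈⟨ solve 3 (λ c d x → c :* d :* x :* (c :* d :* x) := c :* c :* (d :* d) :* (x :* x)) refl c d x ⟩
      c * c * (d * d) * (x * x)
        ≤⟨ *-monoˡ-≤ 0≤c²d² x²≤ ⟩
      c * c * (d * d) * (# 12 * (N * (k * k * (k * k))))
        ≤⟨ *-monoˡ-≤ 0≤c²d² (*-monoˡ-≤ (#-nonNeg 12) (*-mono-≤ 0≤N (*-nonNeg 0≤k² 0≤k²) N≤n (*-monoˡ-≤ 0≤k² (*-mono-≤ 0≤k 0≤k k≤3d k≤3d)))) ⟩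
      c * c * (d * d) * (# 12 * (n * (k * k * (# 3 * d * (# 3 * d)))))
        ≈⟨ solve 4 (λ c d k n → c :* c :* (d :* d) :* (:# 12 :* (n :* (k :* k :* (:# 3 :* d :* (:# 3 :* d))))) :=
             :# 108 :* (k :* (k :* (n :* (c :* c :* (d :* d :* (d :* d))))))) refl c d k n ⟩
      # 108 * (k * (k * (n * (c * c * (d * d * (d * d))))))
        ≤⟨ *-mono-≤ (#-nonNeg 108) 0≤rest 108≤c ≤-refl ⟩
      c * (k * (k * (n * (c * c * (d * d * (d * d))))))
        ≈⟨ solve 4 (λ c d k n → c :* (k :* (k :* (n :* (c :* c :* (d :* d :* (d :* d)))))) :=
             k :* (k :* (n :* (c :* (c :* c) :* (d :* d :* (d :* d)))))) refl c d k n ⟩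
      k * (k * (n * (c * (c * c) * (d * d * (d * d))))) ∎)))
      where
      0≤k² : 0# ≤ k * k
      0≤k² = *-nonNeg 0≤k 0≤k
      0≤kn² : 0# ≤ k * (n * n)
      0≤kn² = *-nonNeg 0≤k (*-nonNeg 0≤n 0≤n)
      0≤c²d² : 0# ≤ c * c * (d * d)
      0≤c²d² = *-nonNeg (*-nonNeg 0≤c 0≤c) (*-nonNeg 0≤d 0≤d)
      0≤rest : 0# ≤ k * (k * (n * (c * c * (d * d * (d * d)))))
      0≤rest = *-nonNeg 0≤k (*-nonNeg 0≤k (*-nonNeg 0≤n (*-nonNeg (*-nonNeg 0≤c 0≤c) (*-nonNeg (*-nonNeg 0≤d 0≤d) (*-nonNeg 0≤d 0≤d)))))
      0≤N : 0# ≤ N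
      0≤N = ≤-by-difference (+-nonNeg (+-nonNeg (x≤y⇒0≤y-x n≤N+8k) (x≤y⇒0≤y-x 20k≤n)) (*-nonNeg (#-nonNeg 12) 0≤k))
        (solve 3 (λ n N k → N :- :# 0 := N :+ :# 8 :* k :- n :+ (n :- :# 20 :* k) :+ :# 12 :* k) refl n N k)
      kn²≤cdx : k * (n * n) ≤ c * d * x
      kn²≤cdx = ≤-trans kn²≤ (≤-by-difference
        (*-nonNeg (*-nonNeg (#-nonNeg 408) 0≤d) (x≤y⇒0≤y-x kn≤x))
        (solve 4 (λ n d k x → :# 728 :* d :* x :- :# 4 :* d :* (:# 102 :* (k :* n) :+ :# 80 :* x) :=
          :# 408 :* d :* (x :- k :* n)) refl n d k x))

-- The sum of squares, estimated around a neighbourhood of maximal size.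

module LargeSimplex (R : OrderedRing) {n d : ℕ} (p : Fin n → Fin d → OrderedRing.Carrier R) where

  open OrderedRingProperties R
  open BinaryWeights R
  open Polynomials R
  open UnitDistanceForm R p
  open Simplices R p
  open RankBound R p
  open NonUnitGraph R p

  module _ (neighbourhoods : ∀ v → Simplex (χ v)) {σ : Weights}
           (σ-binary : ∀ i → Binary (σ i)) (σ-simplex : Simplex σ)
           (1≤k : 1# ≤ ∑ σ) (degree≤k : ∀ v → ∑ (χ v) ≤ ∑ σ) where

    private
      k : Carrier
      k = ∑ σ
      b m θ η : Weights
      b = row σ
      -- The number of points of σ equal or joined to v, hence of the terms of `b v` that can be
      -- nonzero.
      m v = ∑ λ j → σ j * support v j
      -- θ selects the retained vertices, and τ v those of them adjacent to v.
      θ v with total (# 4 * m v) k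
      ... | inj₁ _ = 1#
      ... | inj₂ _ = 0#
      τ : Fin n → Weights
      τ v i = χ v i * θ i
      β : Weights
      β v = ∑ λ i → τ v i * b i
      η v = ∑ λ i → τ v i * (b i * b i)
      q : Weights
      q v = rowSq (τ v) v
      N S : Carrier
      N = ∑ θ
      S = ∑ λ v → θ v * (b v * b v)
      module ≈ = Relation.Binary.Reasoning.Setoid setoid

      0≤k : 0# ≤ k
      0≤k = ≤-trans 0≤1 1≤k

      -- Only totality of the order is available, so a tie may fall on either side; both cases
      -- therefore record weak inequalities.
      θ-cases : ∀ v → (θ v ≡ 1# × # 4 * m v ≤ k) ⊎ (θ v ≡ 0# × k ≤ # 4 * m v)
      θ-cases v with total (# 4 * m v) k
      ... | inj₁ le = inj₁ (≡.refl , le)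
      ... | inj₂ le = inj₂ (≡.refl , le)

      θ-binary : ∀ v → Binary (θ v)
      θ-binary v with θ v | θ-cases v
      ... | _ | inj₁ (≡.refl , _) = inj₂ refl
      ... | _ | inj₂ (≡.refl , _) = inj₁ refl

      θ-nonNeg : ∀ v → 0# ≤ θ v
      θ-nonNeg v = binary-nonNeg (θ-binary v)

      m-nonNeg : ∀ v → 0# ≤ m v
      m-nonNeg v = ∑-nonNeg {n} λ j → *-nonNeg (binary-nonNeg (σ-binary j)) (binary-nonNeg (support-binary v j))

      -- Counted from the side of σ: each of its k points is met by itself and by at most k
      -- neighbours.
      ∑m≤2k² : ∑ m ≤ # 2 * (k * k)
      ∑m≤2k² = begin
        ∑ m                                                  ≈⟨ ∑-comm (λ v j → σ j * support v j) ⟩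
        ∑ (λ j → ∑ λ v → σ j * support v j)                  ≈⟨ ∑-cong {n} (λ j → trans (sym (*-distribˡ-sum (σ j) (λ v → support v j)))
                                                                  (*-congˡ (trans (∑-cong {n} λ v → +-cong (reflexive (δ-sym v j)) (reflexive (χ-sym v j)))
                                                                    (trans (∑-distrib-+ (δ j) (χ j)) (+-congʳ (∑-δ-1 j)))))) ⟩
        ∑ (λ j → σ j * (1# + ∑ (χ j)))                       ≤⟨ ∑-mono-≤ {n} (λ j → *-monoˡ-≤ (binary-nonNeg (σ-binary j)) (+-monoʳ-≤ 1# (degree≤k j))) ⟩
        ∑ (λ j → σ j * (1# + k))                             ≈⟨ *-distribʳ-sum (1# + k) σ ⟨
        k * (1# + k)                                         ≤⟨ ≤-by-difference (*-nonNeg 0≤k (x≤y⇒0≤y-x 1≤k))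
                                                                  (solve 1 (λ k → :# 2 :* (k :* k) :- k :* (:# 1 :+ k) := k :* (k :- :# 1)) refl k) ⟩
        # 2 * (k * k)                                        ∎
        where open ≤-Reasoning

      -- A discarded vertex contributes at least k/4 to Σ m ≤ 2 k².
      n≤N+8k : # n ≤ N + # 8 * k
      n≤N+8k = *-cancelˡ-≤ 1≤k (≤-by-difference
        (+-nonNeg (x≤y⇒0≤y-x summed) (*-nonNeg (#-nonNeg 4) (x≤y⇒0≤y-x ∑m≤2k²)))
        (solve 4 (λ n N k M → k :* (N :+ :# 8 :* k) :- k :* n :=
          (k :* N :+ :# 4 :* M :- n :* k) :+ :# 4 :* (:# 2 :* (k :* k) :- M)) refl (# n) N k (∑ m)))
        where
        bad : ∀ v → k ≤ k * θ v + # 4 * m v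
        bad v with θ v | θ-cases v
        ... | _ | inj₁ (≡.refl , _) = ≤-by-difference (*-nonNeg (#-nonNeg 4) (m-nonNeg v))
          (solve 2 (λ k m → k :* :# 1 :+ m :- k := m) refl k _)
        ... | _ | inj₂ (≡.refl , k≤4m) = ≤-by-difference (x≤y⇒0≤y-x k≤4m)
          (solve 2 (λ k m → k :* :# 0 :+ m :- k := m :- k) refl k _)
        summed : # n * k ≤ k * N + # 4 * ∑ m
        summed = begin
          # n * k                            ≈⟨ ∑-const n k ⟨
          ∑ {n} (λ _ → k)                    ≤⟨ ∑-mono-≤ {n} bad ⟩
          ∑ (λ v → k * θ v + # 4 * m v)      ≈⟨ ∑-linear k (# 4) θ m ⟩
          k * N + # 4 * ∑ m                  ∎
          where open ≤-Reasoning

      -- Restricting to the support makes Cauchy-Schwarz cost a factor `m v` instead of k.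
      b²≤mq : ∀ v → b v * b v ≤ m v * rowSq σ v
      b²≤mq v = begin
        b v * b v
          ≈⟨ *-cong b≈ b≈ ⟨
        ∑ (λ j → σ j * (support v j * a v j)) * ∑ (λ j → σ j * (support v j * a v j))
          ≤⟨ cauchy-schwarz σ (support v) (a v) (λ j → binary-nonNeg (σ-binary j)) ⟩
        ∑ (λ j → σ j * (support v j * support v j)) * ∑ (λ j → σ j * (a v j * a v j))
          ≈⟨ *-congʳ (∑-cong {n} λ j → *-congˡ (binary-idem (support-binary v j))) ⟩
        m v * rowSq σ v ∎
        where
        open ≤-Reasoning
        b≈ : ∑ (λ j → σ j * (support v j * a v j)) ≈ b v
        b≈ = ∑-cong {n} λ j → *-congˡ (support-a v j)

      b²≤6m : ∀ v → # 4 * m v ≤ k → b v * b v ≤ # 6 * m v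
      b²≤6m v 4m≤k = row-square-bound (m-nonNeg v) 1≤k 4m≤k (b²≤mq v) (simplex-bessel σ-simplex 1≤k v)

      b²≤2k : ∀ v → # 4 * m v ≤ k → b v * b v ≤ # 2 * k
      b²≤2k v 4m≤k = *-cancelˡ-≤ {# 2} (≤-by-difference 0≤1 (solve 0 (:# 2 :- :# 1 := :# 1) refl)) (≤-by-difference
        (+-nonNeg (+-nonNeg (*-nonNeg (#-nonNeg 2) (x≤y⇒0≤y-x (b²≤6m v 4m≤k))) (*-nonNeg (#-nonNeg 3) (x≤y⇒0≤y-x 4m≤k))) 0≤k)
        (solve 3 (λ k m b → :# 2 :* (:# 2 :* k) :- :# 2 :* b := :# 2 :* (:# 6 :* m :- b) :+ :# 3 :* (k :- :# 4 :* m) :+ k)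
          refl k (m v) (b v * b v)))

      S≤12k² : S ≤ # 12 * (k * k)
      S≤12k² = begin
        S                           ≤⟨ ∑-mono-≤ {n} bound ⟩
        ∑ (λ v → # 6 * m v)         ≈⟨ *-distribˡ-sum (# 6) m ⟨
        # 6 * ∑ m                   ≤⟨ *-monoˡ-≤ (#-nonNeg 6) ∑m≤2k² ⟩
        # 6 * (# 2 * (k * k))       ≈⟨ solve 1 (λ k → :# 6 :* (:# 2 :* k) := :# 12 :* k) refl (k * k) ⟩
        # 12 * (k * k)              ∎
        where
        open ≤-Reasoning
        bound : ∀ v → θ v * (b v * b v) ≤ # 6 * m v
        bound v with θ v | θ-cases v
        ... | _ | inj₁ (≡.refl , 4m≤k) = ≤-trans (≤-reflexive (*-identityˡ _)) (b²≤6m v 4m≤k)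
        ... | _ | inj₂ (≡.refl , _)    = ≤-trans (≤-reflexive (zeroˡ _)) (*-nonNeg (#-nonNeg 6) (m-nonNeg v))

      τ-binary : ∀ v i → Binary (τ v i)
      τ-binary v i = binary-* (χ-binary v i) (θ-binary i)

      τ-simplex : ∀ v → Simplex (τ v)
      τ-simplex v = simplex-restrict θ-binary (neighbourhoods v)

      τ≤k : ∀ v → ∑ (τ v) ≤ k
      τ≤k v = ≤-trans (∑-mono-≤ {n} λ i → ≤-trans (*-monoˡ-≤ (χ-nonNeg v i) (binary-≤1 (θ-binary i)))
        (≤-reflexive (*-identityʳ (χ v i)))) (degree≤k v)

      local-bound : ∀ v → # 4 * m v ≤ k →
        k * k * q v ≤ # 91 * (k * k) - # 80 * (k * β v) + # 8 * (k * (b v * b v)) + # 8 * η v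
      local-bound v 4m≤k with ∑-binary {n} (τ-binary v)
      ... | inj₂ 1≤l = neighbourhood-bound {b′ = row (τ v) v} 1≤k 1≤l (τ≤k v) (b²≤2k v 4m≤k) β²≤lη
              (simplex-bessel (τ-simplex v) 1≤l v)
              (centroid-distance-nonNeg σ-simplex (τ-simplex v) 1≤k 1≤l)
              (centroid-cauchy-schwarz σ-simplex (τ-simplex v) 1≤k 1≤l v)
        where
        open ≤-Reasoning
        l : Carrier
        l = ∑ (τ v)
        β²≤lη : β v * β v ≤ l * η v
        β²≤lη = begin
          β v * β v
            ≈⟨ *-cong β≈ β≈ ⟨
          ∑ (λ i → τ v i * (1# * b i)) * ∑ (λ i → τ v i * (1# * b i))
            ≤⟨ cauchy-schwarz (τ v) (λ _ → 1#) b (λ i → binary-nonNeg (τ-binary v i)) ⟩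
          ∑ (λ i → τ v i * (1# * 1#)) * η v
            ≈⟨ *-congʳ (∑-cong {n} λ i → trans (*-congˡ (*-identityˡ 1#)) (*-identityʳ (τ v i))) ⟩
          l * η v ∎
          where
          β≈ : ∑ (λ i → τ v i * (1# * b i)) ≈ β v
          β≈ = ∑-cong {n} λ i → *-congˡ (*-identityˡ (b i))
      -- Without retained neighbours there is no size l ≥ 1 to cancel, but then q, β and η vanish
      -- and the right side is a sum of nonnegative terms.
      ... | inj₁ τ≈0 = ≤-by-difference
              (+-nonNeg (*-nonNeg (#-nonNeg 91) (*-nonNeg 0≤k 0≤k)) (*-nonNeg (#-nonNeg 8) (*-nonNeg 0≤k (sq-nonNeg (b v)))))
              (trans (+-cong (+-cong (+-congʳ (+-congˡ (-‿cong (*-congˡ (*-congˡ (vanish b)))))) (*-congˡ (vanish λ i → b i * b i)))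
                  (-‿cong (*-congˡ (vanish λ i → a v i * a v i))))
                (solve 2 (λ k b → :# 91 :* (k :* k) :- :# 80 :* (k :* :# 0) :+ :# 8 :* (k :* b) :+ :# 8 :* :# 0 :- k :* k :* :# 0 :=
                  :# 91 :* (k :* k) :+ :# 8 :* (k :* b)) refl k (b v * b v)))
        where
        vanish : ∀ (f : Weights) → ∑ (λ i → τ v i * f i) ≈ 0#
        vanish f = trans (∑-cong {n} λ i → trans (*-congʳ (τ≈0 i)) (zeroˡ (f i))) (∑-zero n)

      -- The number of retained neighbours of u, which is the multiplicity of u when neighbourhoods
      -- are summed.
      D : Weights
      D u = ∑ λ v → θ v * χ v u

      D-nonNeg : ∀ u → 0# ≤ D u
      D-nonNeg u = ∑-nonNeg {n} λ v → *-nonNeg (θ-nonNeg v) (χ-nonNeg v u)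

      D≤k : ∀ u → D u ≤ k
      D≤k u = ≤-trans (∑-mono-≤ {n} λ v → ≤-trans (*-mono-≤ (θ-nonNeg v) (χ-nonNeg v u) (binary-≤1 (θ-binary v)) (≤-reflexive (reflexive (χ-sym v u))))
        (≤-reflexive (*-identityˡ (χ u v)))) (degree≤k u)

      double-count : ∀ (f : Weights) → ∑ (λ v → θ v * ∑ λ u → τ v u * f u) ≈ ∑ (λ u → θ u * (D u * f u))
      double-count f = ≈.begin
        ∑ (λ v → θ v * ∑ λ u → τ v u * f u)
          ≈.≈⟨ ∑-cong {n} (λ v → *-distribˡ-sum (θ v) (λ u → τ v u * f u)) ⟩
        ∑ (λ v → ∑ λ u → θ v * (τ v u * f u))
          ≈.≈⟨ ∑-comm (λ v u → θ v * (τ v u * f u)) ⟩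
        ∑ (λ u → ∑ λ v → θ v * (τ v u * f u))
          ≈.≈⟨ ∑∑-cong {n} {n} (λ u v → solve 4 (λ s x t f → s :* (x :* t :* f) := s :* x :* (t :* f)) refl (θ v) (χ v u) (θ u) (f u)) ⟩
        ∑ (λ u → ∑ λ v → θ v * χ v u * (θ u * f u))
          ≈.≈⟨ ∑-cong {n} (λ u → *-distribʳ-sum (θ u * f u) (λ v → θ v * χ v u)) ⟨
        ∑ (λ u → D u * (θ u * f u))
          ≈.≈⟨ ∑-cong {n} (λ u → solve 3 (λ D t f → D :* (t :* f) := t :* (D :* f)) refl (D u) (θ u) (f u)) ⟩
        ∑ (λ u → θ u * (D u * f u)) ≈.∎

      ∑θη≤kS : ∑ (λ v → θ v * η v) ≤ k * S
      ∑θη≤kS = begin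
        ∑ (λ v → θ v * η v)                    ≈⟨ double-count (λ u → b u * b u) ⟩
        ∑ (λ u → θ u * (D u * (b u * b u)))    ≤⟨ ∑-mono-≤ {n} (λ u → *-monoˡ-≤ (θ-nonNeg u) (*-mono-≤ (D-nonNeg u) (sq-nonNeg (b u)) (D≤k u) ≤-refl)) ⟩
        ∑ (λ u → θ u * (k * (b u * b u)))      ≈⟨ ∑-cong {n} (λ u → solve 3 (λ t k b → t :* (k :* b) := k :* (t :* b)) refl (θ u) k (b u * b u)) ⟩
        ∑ (λ u → k * (θ u * (b u * b u)))      ≈⟨ *-distribˡ-sum k (λ u → θ u * (b u * b u)) ⟨
        k * S                                  ∎
        where open ≤-Reasoning

      ∑θβ : Carrier
      ∑θβ = ∑ λ v → θ v * β v

      -- After regrouping, `b u` occurs `D u` ≤ k times, and Cauchy-Schwarz pairs these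
      -- multiplicities, of total square at most N k², with S ≤ 12 k².
      [∑θβ]²≤ : ∑θβ * ∑θβ ≤ # 12 * (N * (k * k * (k * k)))
      [∑θβ]²≤ = begin
        ∑θβ * ∑θβ
          ≈⟨ *-cong (double-count b) (double-count b) ⟩
        ∑ (λ u → θ u * (D u * b u)) * ∑ (λ u → θ u * (D u * b u))
          ≤⟨ cauchy-schwarz θ D b θ-nonNeg ⟩
        ∑ (λ u → θ u * (D u * D u)) * S
          ≤⟨ *-mono-≤ (∑-nonNeg {n} λ u → *-nonNeg (θ-nonNeg u) (sq-nonNeg (D u)))
               (∑-nonNeg {n} λ u → *-nonNeg (θ-nonNeg u) (sq-nonNeg (b u)))
               (≤-trans (∑-mono-≤ {n} λ u → *-monoˡ-≤ (θ-nonNeg u) (*-mono-≤ (D-nonNeg u) (D-nonNeg u) (D≤k u) (D≤k u)))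
                 (≤-reflexive (sym (*-distribʳ-sum (k * k) θ))))
               S≤12k² ⟩
        N * (k * k) * (# 12 * (k * k))
          ≈⟨ solve 2 (λ N K → N :* K :* (:# 12 :* K) := :# 12 :* (N :* (K :* K))) refl N (k * k) ⟩
        # 12 * (N * (k * k * (k * k))) ∎
        where open ≤-Reasoning

      T : Carrier
      T = ∑ λ v → θ v * rowSq θ v

      rowSq-split : ∀ v → rowSq θ v ≈ θ v + q v
      rowSq-split v = trans (∑-cong {n} λ j → trans (*-congˡ (a²-off-graph v j))
          (solve 4 (λ t e x a → t :* (e :+ x :* a) := e :* t :+ x :* t :* a) refl (θ j) (δ v j) (χ v j) (a v j * a v j)))
        (trans (∑-distrib-+ (λ j → δ v j * θ j) (λ j → τ v j * (a v j * a v j))) (+-congʳ (∑-δ v θ)))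

      k²T≤ : k * k * T ≤ # 92 * (k * k * N) - # 80 * (k * ∑θβ) + # 8 * (k * S) + # 8 * (k * S)
      k²T≤ = begin
        k * k * T
          ≈⟨ *-distribˡ-sum (k * k) (λ v → θ v * rowSq θ v) ⟩
        ∑ (λ v → k * k * (θ v * rowSq θ v))
          ≤⟨ ∑-mono-≤ {n} bound ⟩
        ∑ (λ v → # 1 * (# 92 * (k * k) * θ v + (- (# 80 * k)) * (θ v * β v)) + # 1 * (# 8 * k * (θ v * (b v * b v)) + # 8 * (θ v * η v)))
          ≈⟨ ∑-linear (# 1) (# 1) (λ v → # 92 * (k * k) * θ v + (- (# 80 * k)) * (θ v * β v)) (λ v → # 8 * k * (θ v * (b v * b v)) + # 8 * (θ v * η v)) ⟩
        # 1 * ∑ (λ v → # 92 * (k * k) * θ v + (- (# 80 * k)) * (θ v * β v)) + # 1 * ∑ (λ v → # 8 * k * (θ v * (b v * b v)) + # 8 * (θ v * η v))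
          ≈⟨ +-cong (*-congˡ (∑-linear (# 92 * (k * k)) (- (# 80 * k)) θ (λ v → θ v * β v)))
               (*-congˡ (∑-linear (# 8 * k) (# 8) (λ v → θ v * (b v * b v)) (λ v → θ v * η v))) ⟩
        # 1 * (# 92 * (k * k) * N + (- (# 80 * k)) * ∑θβ) + # 1 * (# 8 * k * S + # 8 * ∑ (λ v → θ v * η v))
          ≤⟨ ≤-by-difference (*-nonNeg (#-nonNeg 8) (x≤y⇒0≤y-x ∑θη≤kS))
               (solve 5 (λ k N X S E → :# 92 :* (k :* k :* N) :- :# 80 :* (k :* X) :+ :# 8 :* (k :* S) :+ :# 8 :* (k :* S)
                 :- (:# 1 :* (:# 92 :* (k :* k) :* N :+ (:- (:# 80 :* k)) :* X) :+ :# 1 :* (:# 8 :* k :* S :+ :# 8 :* E)) :=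
                 :# 8 :* (k :* S :- E)) refl k N ∑θβ S (∑ (λ v → θ v * η v))) ⟩
        # 92 * (k * k * N) - # 80 * (k * ∑θβ) + # 8 * (k * S) + # 8 * (k * S) ∎
        where
        open ≤-Reasoning
        bound : ∀ v → k * k * (θ v * rowSq θ v) ≤
          # 1 * (# 92 * (k * k) * θ v + (- (# 80 * k)) * (θ v * β v)) + # 1 * (# 8 * k * (θ v * (b v * b v)) + # 8 * (θ v * η v))
        bound v = begin
          k * k * (θ v * rowSq θ v)
            ≈⟨ *-congˡ (*-congˡ (rowSq-split v)) ⟩
          k * k * (θ v * (θ v + q v))
            ≈⟨ solve 3 (λ k t q → k :* k :* (t :* (t :+ q)) := t :* (k :* k :* (t :+ q))) refl k (θ v) (q v) ⟩
          θ v * (k * k * (θ v + q v))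
            ≤⟨ good ⟩
          θ v * (# 92 * (k * k) - # 80 * (k * β v) + # 8 * (k * (b v * b v)) + # 8 * η v)
            ≈⟨ solve 5 (λ t k β b e → t :* (:# 92 :* (k :* k) :- :# 80 :* (k :* β) :+ :# 8 :* (k :* b) :+ :# 8 :* e) :=
                 :# 1 :* (:# 92 :* (k :* k) :* t :+ (:- (:# 80 :* k)) :* (t :* β)) :+ :# 1 :* (:# 8 :* k :* (t :* b) :+ :# 8 :* (t :* e)))
                 refl (θ v) k (β v) (b v * b v) (η v) ⟩
          # 1 * (# 92 * (k * k) * θ v + (- (# 80 * k)) * (θ v * β v)) + # 1 * (# 8 * k * (θ v * (b v * b v)) + # 8 * (θ v * η v)) ∎
          where
          good : θ v * (k * k * (θ v + q v)) ≤ θ v * (# 92 * (k * k) - # 80 * (k * β v) + # 8 * (k * (b v * b v)) + # 8 * η v)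
          good with θ-cases v
          ... | inj₁ (θ≡1 , 4m≤k) = *-monoˡ-≤ (θ-nonNeg v) (≤-by-difference
                  (+-nonNeg (x≤y⇒0≤y-x (local-bound v 4m≤k)) (*-nonNeg (sq-nonNeg k) (x≤y⇒0≤y-x (binary-≤1 (θ-binary v)))))
                  (solve 6 (λ t k β b e q → :# 92 :* (k :* k) :- :# 80 :* (k :* β) :+ :# 8 :* (k :* b) :+ :# 8 :* e :- k :* k :* (t :+ q) :=
                    :# 91 :* (k :* k) :- :# 80 :* (k :* β) :+ :# 8 :* (k :* b) :+ :# 8 :* e :- k :* k :* q :+ k :* k :* (:# 1 :- t))
                    refl (θ v) k (β v) (b v * b v) (η v) (q v)))
          ... | inj₂ (θ≡0 , _)    = ≤-reflexive (trans (*-congʳ (reflexive θ≡0)) (trans (zeroˡ _)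
                  (sym (trans (*-congʳ (reflexive θ≡0)) (zeroˡ _)))))

      kT≤ : k * T ≤ # 92 * (k * N) + # 80 * (- ∑θβ) + # 192 * (k * k)
      kT≤ = *-cancelˡ-≤ 1≤k (≤-by-difference
        (+-nonNeg (x≤y⇒0≤y-x k²T≤) (*-nonNeg (#-nonNeg 16) (*-nonNeg 0≤k (x≤y⇒0≤y-x S≤12k²))))
        (solve 5 (λ k N X S T → k :* (:# 92 :* (k :* N) :+ :# 80 :* (:- X) :+ :# 192 :* (k :* k)) :- k :* (k :* T) :=
          :# 92 :* (k :* k :* N) :- :# 80 :* (k :* X) :+ :# 8 :* (k :* S) :+ :# 8 :* (k :* S) :- k :* k :* T
          :+ :# 16 :* (k :* (:# 12 :* (k :* k) :- S))) refl k N ∑θβ S T))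

      N≤n : N ≤ # n
      N≤n = ≤-trans (∑-mono-≤ {n} λ v → binary-≤1 (θ-binary v))
        (≤-reflexive (trans (∑-const n 1#) (*-identityʳ (# n))))

      -- Off the diagonal `a` lives on the graph and is at most 1, so a row sum is at most 1 plus
      -- the degree.
      θθ≤ : ⟪ θ , θ ⟫ ≤ N * (1# + k)
      θθ≤ = ≤-trans (∑-mono-≤ {n} λ v → *-monoˡ-≤ (θ-nonNeg v) (row≤ v)) (≤-reflexive (sym (*-distribʳ-sum (1# + k) θ)))
        where
        row≤ : ∀ v → row θ v ≤ 1# + k
        row≤ v = begin
          row θ v
            ≈⟨ ∑-cong {n} (λ j → trans (*-congˡ (a-off-graph v j))
                 (solve 4 (λ t e x a → t :* (e :+ x :* a) := e :* t :+ x :* t :* a) refl (θ j) (δ v j) (χ v j) (a v j))) ⟩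
          ∑ (λ j → δ v j * θ j + τ v j * a v j)
            ≈⟨ trans (∑-distrib-+ (λ j → δ v j * θ j) (λ j → τ v j * a v j)) (+-congʳ (∑-δ v θ)) ⟩
          θ v + ∑ (λ j → τ v j * a v j)
            ≤⟨ +-mono-≤ (binary-≤1 (θ-binary v)) (≤-trans (∑-mono-≤ {n} λ j →
                 ≤-trans (*-monoˡ-≤ (binary-nonNeg (τ-binary v j)) (a≤1 v j)) (≤-reflexive (*-identityʳ (τ v j)))) (τ≤k v)) ⟩
          1# + k ∎
          where open ≤-Reasoning

      k[N-1-k]²≤dkT : # 20 * k ≤ # n → k * ((N - 1# - k) * (N - 1# - k)) ≤ # d * (k * T)
      k[N-1-k]²≤dkT 20k≤n = ≤-trans (*-monoˡ-≤ 0≤k [N-1-k]²≤dT)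
        (≤-reflexive (solve 3 (λ k d T → k :* (d :* T) := d :* (k :* T)) refl k (# d) T))
        where
        1≤N : 1# ≤ N
        1≤N = ≤-by-difference
          (+-nonNeg (+-nonNeg (+-nonNeg (x≤y⇒0≤y-x n≤N+8k) (x≤y⇒0≤y-x 20k≤n)) (*-nonNeg (#-nonNeg 12) (x≤y⇒0≤y-x 1≤k))) (#-nonNeg 11))
          (solve 3 (λ n N k → N :- :# 1 := N :+ :# 8 :* k :- n :+ (n :- :# 20 :* k) :+ :# 12 :* (k :- :# 1) :+ :# 11) refl (# n) N k)
        0≤N : 0# ≤ N
        0≤N = ≤-trans 0≤1 1≤N
        0≤N-1-k : 0# ≤ N - 1# - k
        0≤N-1-k = ≤-trans
          (+-nonNeg (+-nonNeg (+-nonNeg (x≤y⇒0≤y-x n≤N+8k) (x≤y⇒0≤y-x 20k≤n)) (*-nonNeg (#-nonNeg 11) (x≤y⇒0≤y-x 1≤k))) (#-nonNeg 10))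
          (≤-reflexive (solve 3 (λ n N k → N :+ :# 8 :* k :- n :+ (n :- :# 20 :* k) :+ :# 11 :* (k :- :# 1) :+ :# 10 := N :- :# 1 :- k) refl (# n) N k))
        below : N * (N - 1# - k) ≤ N * N - ⟪ θ , θ ⟫
        below = ≤-by-difference (x≤y⇒0≤y-x θθ≤)
          (solve 3 (λ N k s → N :* N :- s :- N :* (N :- :# 1 :- k) := N :* (:# 1 :+ k) :- s) refl N k ⟪ θ , θ ⟫)
        0≤N[N-1-k] : 0# ≤ N * (N - 1# - k)
        0≤N[N-1-k] = *-nonNeg 0≤N 0≤N-1-k
        [N-1-k]²≤dT : (N - 1# - k) * (N - 1# - k) ≤ # d * T
        [N-1-k]²≤dT = *-cancelˡ-≤ 1≤N (*-cancelˡ-≤ 1≤N (begin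
          N * (N * ((N - 1# - k) * (N - 1# - k)))              ≈⟨ solve 2 (λ N u → N :* (N :* (u :* u)) := N :* u :* (N :* u)) refl N (N - 1# - k) ⟩
          N * (N - 1# - k) * (N * (N - 1# - k))                ≤⟨ *-mono-≤ 0≤N[N-1-k] 0≤N[N-1-k] below below ⟩
          (N * N - ⟪ θ , θ ⟫) * (N * N - ⟪ θ , θ ⟫)            ≤⟨ rank-bound θ θ-nonNeg 1≤N ⟩
          # d * (N * N * T)                                    ≈⟨ solve 3 (λ d N T → d :* (N :* N :* T) := N :* (N :* (d :* T))) refl (# d) N T ⟩
          N * (N * (# d * T))                                  ∎))
          where open ≤-Reasoning

    large-simplex-bound : 1# ≤ # d → k ≤ # 3 * # d → # 20 * k ≤ # n →
      # n * (# n * # n) ≤ # 728 * (# 728 * # 728) * (# d * # d * (# d * # d))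
    large-simplex-bound 1≤d k≤3d 20k≤n = cubic-bound 1≤k 1≤d k≤3d 20k≤n N≤n n≤N+8k kT≤
      -- The mixed term enters with a minus sign, so x is -Σ θ β, which has the same square.
      (≤-trans (≤-reflexive (solve 1 (λ x → (:- x) :* (:- x) := x :* x) refl ∑θβ)) [∑θβ]²≤)
      (k[N-1-k]²≤dkT 20k≤n)

-- The cubic bound for finite point families.

module AlmostEquidistantBound (R : OrderedRing) where

  open OrderedRingProperties R
  open BinaryWeights R

  almost-equidistant-bound : ∀ n {d} → 1# ≤ # d → (p : Fin n → Fin d → Carrier) →
    let open UnitDistanceForm R p in
    (∀ i j l → ¬ i ≡ j → ¬ j ≡ l → ¬ i ≡ l → a i j ≈ 0# ⊎ a j l ≈ 0# ⊎ a i l ≈ 0#) →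
    # n * (# n * # n) ≤ # 728 * (# 728 * # 728) * (# d * # d * (# d * # d))
  almost-equidistant-bound zero {d} 1≤d p _ = ≤-trans (≤-reflexive (zeroˡ _))
    (*-nonNeg (*-nonNeg (#-nonNeg 728) (*-nonNeg (#-nonNeg 728) (#-nonNeg 728)))
      (*-nonNeg (sq-nonNeg (# d)) (sq-nonNeg (# d))))
  almost-equidistant-bound n@(suc n′) {d} 1≤d p sparse = conclude (argmax degree)
    where
    open UnitDistanceForm R p
    open Simplices R p
    open NonUnitGraph R p
    open LargeSimplex R p
    degree : Fin n → Carrier
    degree v = ∑ (χ v)
    neighbourhoods : ∀ v → Simplex (χ v)
    neighbourhoods = neighbourhood-simplex sparse
    0≤d : 0# ≤ # d
    0≤d = #-nonNeg d
    -- The degenerate cases give a bound linear in d, stronger than needed since d³ ≤ d⁴. The 60 is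
    -- 20 · 3.
    linear : # n ≤ # 60 * # d → # n * (# n * # n) ≤ # 728 * (# 728 * # 728) * (# d * # d * (# d * # d))
    linear n≤60d = ≤-trans (*-mono-≤ (#-nonNeg n) (sq-nonNeg (# n)) n≤cd (*-mono-≤ (#-nonNeg n) (#-nonNeg n) n≤cd n≤cd))
      (≤-by-difference (*-nonNeg (*-nonNeg 0≤c (*-nonNeg 0≤c 0≤c)) (*-nonNeg (*-nonNeg 0≤d (*-nonNeg 0≤d 0≤d)) (x≤y⇒0≤y-x 1≤d)))
         (solve 2 (λ c d → c :* (c :* c) :* (d :* d :* (d :* d)) :- c :* d :* (c :* d :* (c :* d)) :=
           c :* (c :* c) :* (d :* (d :* d) :* (d :- :# 1))) refl (# 728) (# d)))
      where
      0≤c : 0# ≤ # 728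
      0≤c = #-nonNeg 728
      n≤cd : # n ≤ # 728 * # d
      n≤cd = ≤-trans n≤60d (≤-by-difference (*-nonNeg (#-nonNeg 668) 0≤d)
        (solve 1 (λ d → :# 728 :* d :- :# 60 :* d := :# 668 :* d) refl (# d)))
    size≤3d : # d + # 2 ≤ # 3 * # d
    size≤3d = ≤-by-difference (*-nonNeg (#-nonNeg 2) (x≤y⇒0≤y-x 1≤d))
      (solve 1 (λ d → :# 3 :* d :- (d :+ :# 2) := :# 2 :* (d :- :# 1)) refl (# d))
    conclude : ∃[ v ] (∀ u → degree u ≤ degree v) → _
    conclude (v , max) with ∑-binary {n} (χ-binary v)
    -- If the maximal degree is 0, the whole family is a unit simplex.
    ... | inj₁ χ≈0 = linear (≤-trans n≤3d (≤-by-difference (*-nonNeg (#-nonNeg 57) 0≤d)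
            (solve 1 (λ d → :# 60 :* d :- :# 3 :* d := :# 57 :* d) refl (# d))))
      where
      isolated : ∀ i j → χ i j ≈ 0#
      isolated i j = antisym
        (≤-trans (term≤∑ {n} (χ-nonNeg i) j) (≤-trans (max i) (≤-reflexive (trans (∑-cong {n} χ≈0) (∑-zero n)))))
        (χ-nonNeg i j)
      one-simplex : Simplex (λ _ → 1#)
      one-simplex i j = trans (trans (*-congʳ (*-identityˡ 1#)) (*-identityˡ (a i j)))
        (trans (a-off-graph i j) (trans (+-congˡ (trans (*-congʳ (isolated i j)) (zeroˡ _)))
          (trans (+-identityʳ (δ i j)) (sym (*-identityˡ (δ i j))))))
      n≈∑1 : # n ≈ ∑ {n} (λ _ → 1#)
      n≈∑1 = sym (trans (∑-const n 1#) (*-identityʳ (# n)))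
      1≤n : 1# ≤ # n
      1≤n = ≤-trans (≤-reflexive (sym (+-identityʳ 1#))) (≤-trans (+-monoʳ-≤ 1# (#-nonNeg n′)) (≤-reflexive (sym (1+× n′ 1#))))
      n≤3d : # n ≤ # 3 * # d
      n≤3d = ≤-trans (≤-reflexive n≈∑1) (≤-trans
        (simplex-size (λ _ → inj₂ refl) one-simplex (≤-trans 1≤n (≤-reflexive n≈∑1))) size≤3d)
    -- When one neighbourhood is at least a twentieth of the family, its size as a simplex already
    -- bounds n.
    ... | inj₂ 1≤k with total (# 20 * degree v) (# n)
    ...   | inj₁ 20k≤n = large-simplex-bound neighbourhoods (χ-binary v) (neighbourhoods v) 1≤k max 1≤d k≤3d 20k≤n
      where
      k≤3d : degree v ≤ # 3 * # d
      k≤3d = ≤-trans (simplex-size (χ-binary v) (neighbourhoods v) 1≤k) size≤3d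
    ...   | inj₂ n≤20k = linear (≤-trans n≤20k (≤-trans (*-monoˡ-≤ (#-nonNeg 20) k≤3d)
            (≤-reflexive (solve 1 (λ d → :# 20 :* (:# 3 :* d) := :# 60 :* d) refl (# d)))))
      where
      k≤3d : degree v ≤ # 3 * # d
      k≤3d = ≤-trans (simplex-size (χ-binary v) (neighbourhoods v) 1≤k) size≤3d

-- From the cubic bound to natural numbers and to cube roots.

module NaturalBounds (R : OrderedRing) where

  open OrderedRingProperties R

  1≤#suc : ∀ n → 1# ≤ # suc n
  1≤#suc n = begin
    1#          ≈⟨ +-identityʳ 1# ⟨
    1# + 0#     ≤⟨ +-monoʳ-≤ 1# (#-nonNeg n) ⟩
    1# + # n    ≈⟨ 1+× n 1# ⟨
    # suc n     ∎
    where open ≤-Reasoning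

  -- The cofactor x² + x y + y² of y - x in y³ - x³ is at least 1 and can be cancelled.
  cube-cancel-≤ : ∀ {x y} → 1# ≤ x → 0# ≤ y → x * (x * x) ≤ y * (y * y) → x ≤ y
  cube-cancel-≤ {x} {y} 1≤x 0≤y x³≤y³ = *-cancelˡ-≤ {x * x + x * y + y * y}
    (≤-by-difference (+-nonNeg (+-nonNeg (+-nonNeg (*-nonNeg (≤-trans 0≤1 1≤x) (x≤y⇒0≤y-x 1≤x)) (x≤y⇒0≤y-x 1≤x)) (*-nonNeg (≤-trans 0≤1 1≤x) 0≤y)) (sq-nonNeg y))
      (solve 2 (λ x y → x :* x :+ x :* y :+ y :* y :- :# 1 := x :* (x :- :# 1) :+ (x :- :# 1) :+ x :* y :+ y :* y) refl x y))
    (≤-by-difference (x≤y⇒0≤y-x x³≤y³)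
      (solve 2 (λ x y → (x :* x :+ x :* y :+ y :* y) :* y :- (x :* x :+ x :* y :+ y :* y) :* x :=
        y :* (y :* y) :- x :* (x :* x)) refl x y))

  module _ (1≰0 : ¬ 1# ≤ 0#) where

    #-cancel-≤ : ∀ m n → # m ≤ # n → m ℕ.≤ n
    #-cancel-≤ zero    n       _  = ℕ.z≤n
    #-cancel-≤ (suc m) zero    le = contradiction (≤-trans (1≤#suc m) le) 1≰0
    #-cancel-≤ (suc m) (suc n) le = ℕ.s≤s (#-cancel-≤ m n (≤-by-difference (x≤y⇒0≤y-x le)
      (trans (solve 2 (λ m n → n :- m := (:# 1 :+ n) :- (:# 1 :+ m)) refl (# m) (# n))
        (sym (+-cong (1+× n 1#) (-‿cong (1+× m 1#)))))))

    -- Deliberately crude, through n ≤ n³: it serves only to show that families of distinct points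
    -- have bounded size.
    cube-bound-ℕ : ∀ n k d → # n * (# n * # n) ≤ # k * (# k * # k) * (# d * # d * (# d * # d)) →
      n ℕ.≤ k ℕ.* (k ℕ.* k) ℕ.* (d ℕ.* d ℕ.* (d ℕ.* d))
    cube-bound-ℕ zero        k d _  = ℕ.z≤n
    cube-bound-ℕ n@(suc n-1) k d le = #-cancel-≤ n _ (begin
      # n
        ≤⟨ ≤-by-difference (+-nonNeg (*-nonNeg (*-nonNeg (#-nonNeg n) (#-nonNeg n)) (x≤y⇒0≤y-x (1≤#suc n-1))) (*-nonNeg (#-nonNeg n) (x≤y⇒0≤y-x (1≤#suc n-1))))
             (solve 1 (λ n → n :* (n :* n) :- n := n :* n :* (n :- :# 1) :+ n :* (n :- :# 1)) refl (# n)) ⟩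
      # n * (# n * # n)
        ≤⟨ le ⟩
      # k * (# k * # k) * (# d * # d * (# d * # d))
        ≈⟨ *-cong (trans (×1-homo-* k (k ℕ.* k)) (*-congˡ (×1-homo-* k k)))
             (trans (×1-homo-* (d ℕ.* d) (d ℕ.* d)) (*-cong (×1-homo-* d d) (×1-homo-* d d))) ⟨
      # (k ℕ.* (k ℕ.* k)) * # (d ℕ.* d ℕ.* (d ℕ.* d))
        ≈⟨ ×1-homo-* (k ℕ.* (k ℕ.* k)) (d ℕ.* d ℕ.* (d ℕ.* d)) ⟨
      # (k ℕ.* (k ℕ.* k) ℕ.* (d ℕ.* d ℕ.* (d ℕ.* d))) ∎)
      where open ≤-Reasoning

  four-thirds-bound : ∀ n k {d r} → 0# ≤ r → r * (r * r) ≈ d * (d * (d * d)) →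
    # n * (# n * # n) ≤ # k * (# k * # k) * (d * d * (d * d)) → # n ≤ # k * r
  four-thirds-bound zero        k 0≤r _ _ = *-nonNeg (#-nonNeg k) 0≤r
  four-thirds-bound n@(suc n-1) k {d} {r} 0≤r r³≈d⁴ le = cube-cancel-≤ (1≤#suc n-1) (*-nonNeg (#-nonNeg k) 0≤r) (begin
    # n * (# n * # n)                         ≤⟨ le ⟩
    # k * (# k * # k) * (d * d * (d * d))     ≈⟨ *-congˡ (*-assoc d d (d * d)) ⟩
    # k * (# k * # k) * (d * (d * (d * d)))   ≈⟨ *-congˡ r³≈d⁴ ⟨
    # k * (# k * # k) * (r * (r * r))         ≈⟨ solve 2 (λ k r → k :* (k :* k) :* (r :* (r :* r)) := k :* r :* (k :* r :* (k :* r))) refl (# k) r ⟩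
    # k * r * (# k * r * (# k * r))           ∎)
    where open ≤-Reasoning

open import Defs hiding (_-_)
open ≡ using (refl; cong; subst; subst₂)

-- Absolute values and differences of rationals.

module Rationals where

  open +-*-Solver

  <-by-difference : ∀ {p q r} → 0ℚ ℚ.< r → q ℚ.- p ≡ r → p ℚ.< q
  <-by-difference {p} {q} {r} 0<r q-p≡r = subst₂ ℚ._<_ (ℚ.+-identityʳ p)
    (≡.trans (cong (p ℚ.+_) (≡.sym q-p≡r)) (solve 2 (λ p q → p :+ (q :- p) := q) refl p q))
    (ℚ.+-monoʳ-< p 0<r)

  p<q⇒0<q-p : ∀ {p q} → p ℚ.< q → 0ℚ ℚ.< q ℚ.- p
  p<q⇒0<q-p {p} {q} p<q = subst (ℚ._< q ℚ.- p) (ℚ.+-inverseʳ p) (ℚ.+-monoˡ-< (ℚ.- p) p<q)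

  p≤q⇒0≤q-p : ∀ {p q} → p ℚ.≤ q → 0ℚ ℚ.≤ q ℚ.- p
  p≤q⇒0≤q-p {p} {q} p≤q = subst (ℚ._≤ q ℚ.- p) (ℚ.+-inverseʳ p) (ℚ.+-monoˡ-≤ (ℚ.- p) p≤q)

  p≤∣p∣ : ∀ p → p ℚ.≤ ∣ p ∣
  p≤∣p∣ p with ℚ.∣p∣≡p∨∣p∣≡-p p
  ... | inj₁ ∣p∣≡p  = ℚ.≤-reflexive (≡.sym ∣p∣≡p)
  ... | inj₂ ∣p∣≡-p with ℚ.≤-total p 0ℚ
  ...   | inj₁ p≤0 = ℚ.≤-trans p≤0 (ℚ.0≤∣p∣ p)
  ...   | inj₂ 0≤p = ℚ.≤-reflexive (≡.sym (ℚ.0≤p⇒∣p∣≡p 0≤p))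

  ½ε>0 : ∀ {ε} → 0ℚ ℚ.< ε → 0ℚ ℚ.< ½ ℚ.* ε
  ½ε>0 {ε} ε>0 = subst (ℚ._< ½ ℚ.* ε) (ℚ.*-zeroʳ ½) (ℚ.*-monoʳ-<-pos ½ ε>0)

  ∣p-q∣<ε⇒p<q+ε : ∀ p q {ε} → ∣ p ℚ.- q ∣ ℚ.< ε → p ℚ.< q ℚ.+ ε
  ∣p-q∣<ε⇒p<q+ε p q {ε} h = <-by-difference (p<q⇒0<q-p (ℚ.≤-<-trans (p≤∣p∣ (p ℚ.- q)) h))
    (solve 3 (λ p q ε → q :+ ε :- p := ε :- (p :- q)) refl p q ε)

  ∣p-q∣<ε⇒q<p+ε : ∀ p q {ε} → ∣ p ℚ.- q ∣ ℚ.< ε → q ℚ.< p ℚ.+ ε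
  ∣p-q∣<ε⇒q<p+ε p q {ε} h = ∣p-q∣<ε⇒p<q+ε q p (subst (ℚ._< ε)
    (≡.trans (≡.sym (ℚ.∣-p∣≡∣p∣ (p ℚ.- q))) (cong ∣_∣ (solve 2 (λ p q → :- (p :- q) := q :- p) refl p q))) h)

  ∣p-q∣<ε : ∀ p q {ε} → p ℚ.< q ℚ.+ ε → q ℚ.< p ℚ.+ ε → ∣ p ℚ.- q ∣ ℚ.< ε
  ∣p-q∣<ε p q {ε} p<q+ε q<p+ε with ℚ.∣p∣≡p∨∣p∣≡-p (p ℚ.- q)
  ... | inj₁ eq = subst (ℚ._< ε) (≡.sym eq) (<-by-difference (p<q⇒0<q-p p<q+ε)
    (solve 3 (λ p q ε → ε :- (p :- q) := q :+ ε :- p) refl p q ε))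
  ... | inj₂ eq = subst (ℚ._< ε) (≡.sym eq) (<-by-difference (p<q⇒0<q-p q<p+ε)
    (solve 3 (λ p q ε → ε :- (:- (p :- q)) := p :+ ε :- q) refl p q ε))

  quotient : ∀ {D ε} → 0ℚ ℚ.< D → 0ℚ ℚ.< ε → ∃[ δ ] 0ℚ ℚ.< δ × D ℚ.* δ ≡ ε
  quotient {D} {ε} D>0 ε>0 = r ℚ.* ε , rε>0 ,
    ≡.trans (≡.sym (ℚ.*-assoc D r ε)) (≡.trans (cong (ℚ._* ε) (ℚ.*-inverseʳ D)) (ℚ.*-identityˡ ε))
    where
    instance
      D-positive : ℚ.Positive D
      D-positive = ℚ.positive D>0
      D-nonZero : ℚ.NonZero D
      D-nonZero = ℚ.pos⇒nonZero D
    r : ℚ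
    r = ℚ.1/ D
    rε>0 : 0ℚ ℚ.< r ℚ.* ε
    rε>0 = subst (ℚ._< r ℚ.* ε) (ℚ.*-zeroʳ r) (ℚ.*-monoʳ-<-pos r {{ℚ.1/pos⇒pos D}} ε>0)

-- The Cauchy reals as an ordered ring.

module RealRing where

  open Rationals

  ≈-pointwise : ∀ x y → (∀ n → seq x n ≡ seq y n) → x ≈ y
  ≈-pointwise x y p = mk≈ λ ε ε>0 → 0 , λ n _ →
    subst (λ t → ∣ t ∣ ℚ.< ε) (≡.sym (≡.trans (cong (ℚ._- seq y n) (p n)) (ℚ.+-inverseʳ (seq y n)))) ε>0

  +-cong : ∀ {x x′ y y′} → x ≈ x′ → y ≈ y′ → x + y ≈ x′ + y′
  +-cong {x} {x′} {y} {y′} (mk≈ p) (mk≈ q) = mk≈ λ ε ε>0 →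
    let M , h = p (½ ℚ.* ε) (½ε>0 ε>0)
        N , g = q (½ ℚ.* ε) (½ε>0 ε>0)
    in M ℕ.⊔ N , λ n le →
      let hₙ = h n (ℕ.m⊔n≤o⇒m≤o M N le)
          gₙ = g n (ℕ.m⊔n≤o⇒n≤o M N le)
      in ∣p-q∣<ε (seq x n ℚ.+ seq y n) (seq x′ n ℚ.+ seq y′ n)
        (subst (seq x n ℚ.+ seq y n ℚ.<_) (halves (seq x′ n) (seq y′ n) ε)
          (ℚ.+-mono-< (∣p-q∣<ε⇒p<q+ε (seq x n) (seq x′ n) hₙ) (∣p-q∣<ε⇒p<q+ε (seq y n) (seq y′ n) gₙ)))
        (subst (seq x′ n ℚ.+ seq y′ n ℚ.<_) (halves (seq x n) (seq y n) ε)
          (ℚ.+-mono-< (∣p-q∣<ε⇒q<p+ε (seq x n) (seq x′ n) hₙ) (∣p-q∣<ε⇒q<p+ε (seq y n) (seq y′ n) gₙ)))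
    where
    open +-*-Solver
    halves : ∀ p q ε → p ℚ.+ ½ ℚ.* ε ℚ.+ (q ℚ.+ ½ ℚ.* ε) ≡ p ℚ.+ q ℚ.+ ε
    halves = solve 3 (λ p q ε → p :+ con ½ :* ε :+ (q :+ con ½ :* ε) := p :+ q :+ ε) refl

  -‿cong : ∀ {x y} → x ≈ y → - x ≈ - y
  -‿cong {x} {y} (mk≈ p) = mk≈ λ ε ε>0 → let N , h = p ε ε>0 in N , λ n N≤n →
    subst (ℚ._< ε) (negate (seq x n) (seq y n)) (h n N≤n)
    where
    open +-*-Solver
    negate : ∀ p q → ∣ p ℚ.- q ∣ ≡ ∣ (ℚ.- p) ℚ.- (ℚ.- q) ∣
    negate p q = ≡.trans (≡.sym (ℚ.∣-p∣≡∣p∣ (p ℚ.- q)))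
      (cong ∣_∣ (solve 2 (λ p q → :- (p :- q) := (:- p) :- (:- q)) refl p q))

  eventually-bounded : ∀ y → ∃[ B ] 0ℚ ℚ.< B × ∃[ N ] (∀ n → N ℕ.≤ n → ∣ seq y n ∣ ℚ.≤ B)
  eventually-bounded y with cauchy y 1ℚ (ℚ.positive⁻¹ 1ℚ)
  ... | N , h = 1ℚ ℚ.+ ∣ seq y N ∣ , ℚ.+-mono-<-≤ (ℚ.positive⁻¹ 1ℚ) (ℚ.0≤∣p∣ (seq y N)) , N , λ n N≤n →
    ℚ.≤-trans (ℚ.≤-trans
      (ℚ.≤-reflexive (cong ∣_∣ (solve 2 (λ p q → p := p :- q :+ q) refl (seq y n) (seq y N))))
      (ℚ.∣p+q∣≤∣p∣+∣q∣ (seq y n ℚ.- seq y N) (seq y N)))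
      (ℚ.+-monoˡ-≤ ∣ seq y N ∣ (ℚ.<⇒≤ (h n N N≤n ℕ.≤-refl)))
    where open +-*-Solver

  *-congʳ : ∀ {x x′} y → x ≈ x′ → x * y ≈ x′ * y
  *-congʳ {x} {x′} y (mk≈ p) = mk≈ λ ε ε>0 →
    let B , B>0 , M , bounded = eventually-bounded y
        δ , δ>0 , Bδ≡ε = quotient B>0 ε>0
        N , h = p δ δ>0
    in M ℕ.⊔ N , λ n le → subst (∣ seq x n ℚ.* seq y n ℚ.- seq x′ n ℚ.* seq y n ∣ ℚ.<_) Bδ≡ε
      (scaled B>0 (seq x n) (seq x′ n) (seq y n) (bounded n (ℕ.m⊔n≤o⇒m≤o M N le)) (h n (ℕ.m⊔n≤o⇒n≤o M N le)))
    where
    open +-*-Solver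
    factor : ∀ p q r → ∣ r ∣ ℚ.* ∣ p ℚ.- q ∣ ≡ ∣ p ℚ.* r ℚ.- q ℚ.* r ∣
    factor p q r = ≡.trans (≡.sym (ℚ.∣p*q∣≡∣p∣*∣q∣ r (p ℚ.- q)))
      (cong ∣_∣ (solve 3 (λ p q r → r :* (p :- q) := p :* r :- q :* r) refl p q r))
    scaled : ∀ {B δ} → 0ℚ ℚ.< B → ∀ p q r → ∣ r ∣ ℚ.≤ B → ∣ p ℚ.- q ∣ ℚ.< δ →
             ∣ p ℚ.* r ℚ.- q ℚ.* r ∣ ℚ.< B ℚ.* δ
    scaled {B} {δ} B>0 p q r r≤B d<δ = subst (ℚ._< B ℚ.* δ) (factor p q r)
      (ℚ.≤-<-trans (ℚ.*-monoʳ-≤-nonNeg ∣ p ℚ.- q ∣ {{ℚ.nonNegative (ℚ.0≤∣p∣ (p ℚ.- q))}} r≤B)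
        (ℚ.*-monoʳ-<-pos B {{ℚ.positive B>0}} d<δ))

  *-comm : ∀ x y → x * y ≈ y * x
  *-comm x y = ≈-pointwise (x * y) (y * x) λ n → ℚ.*-comm (seq x n) (seq y n)

  *-cong : ∀ {x x′ y y′} → x ≈ x′ → y ≈ y′ → x * y ≈ x′ * y′
  *-cong {x} {x′} {y} {y′} x≈x′ y≈y′ =
    ≈-trans {x * y} {x′ * y} {x′ * y′} (*-congʳ {x} {x′} y x≈x′)
      (≈-trans {x′ * y} {y * x′} {x′ * y′} (*-comm x′ y)
        (≈-trans {y * x′} {y′ * x′} {x′ * y′} (*-congʳ {y} {y′} x′ y≈y′) (*-comm y′ x′)))

  infixl 6 _⊕_
  infixl 7 _⊗_
  infix  8 ⊖_

  -- Opaque, so that conversion checking never compares the Cauchy proofs.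
  opaque

    _⊕_ _⊗_ : ℝ → ℝ → ℝ
    _⊕_ = _+_
    _⊗_ = _*_

    ⊖_ : ℝ → ℝ
    ⊖_ = -_

    0ʳ 1ʳ : ℝ
    0ʳ = 0ℝ
    1ʳ = 1ℝ

  opaque
    unfolding _⊕_

    ⊕-cong : ∀ {x x′ y y′} → x ≈ x′ → y ≈ y′ → x ⊕ y ≈ x′ ⊕ y′
    ⊕-cong {x} {x′} {y} {y′} = +-cong {x} {x′} {y} {y′}

    ⊗-cong : ∀ {x x′ y y′} → x ≈ x′ → y ≈ y′ → x ⊗ y ≈ x′ ⊗ y′
    ⊗-cong {x} {x′} {y} {y′} = *-cong {x} {x′} {y} {y′}

    ⊖-cong : ∀ {x y} → x ≈ y → ⊖ x ≈ ⊖ y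
    ⊖-cong {x} {y} = -‿cong {x} {y}

    seq-⊕ : ∀ x y n → seq (x ⊕ y) n ≡ seq x n ℚ.+ seq y n
    seq-⊕ x y n = refl

    seq-⊗ : ∀ x y n → seq (x ⊗ y) n ≡ seq x n ℚ.* seq y n
    seq-⊗ x y n = refl

    seq-⊖ : ∀ x n → seq (⊖ x) n ≡ ℚ.- seq x n
    seq-⊖ x n = refl

    seq-0ʳ : ∀ n → seq 0ʳ n ≡ 0ℚ
    seq-0ʳ n = refl

    seq-1ʳ : ∀ n → seq 1ʳ n ≡ 1ℚ
    seq-1ʳ n = refl

  ⊕-assoc : ∀ x y z → x ⊕ y ⊕ z ≈ x ⊕ (y ⊕ z)
  ⊕-assoc x y z = ≈-pointwise _ _ pointwise
    where
    pointwise : ∀ n → seq (x ⊕ y ⊕ z) n ≡ seq (x ⊕ (y ⊕ z)) n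
    pointwise n rewrite seq-⊕ (x ⊕ y) z n | seq-⊕ x (y ⊕ z) n | seq-⊕ x y n | seq-⊕ y z n = ℚ.+-assoc (seq x n) (seq y n) (seq z n)

  ⊕-comm : ∀ x y → x ⊕ y ≈ y ⊕ x
  ⊕-comm x y = ≈-pointwise _ _ pointwise
    where
    pointwise : ∀ n → seq (x ⊕ y) n ≡ seq (y ⊕ x) n
    pointwise n rewrite seq-⊕ x y n | seq-⊕ y x n = ℚ.+-comm (seq x n) (seq y n)

  ⊕-identityˡ : ∀ x → 0ʳ ⊕ x ≈ x
  ⊕-identityˡ x = ≈-pointwise _ _ pointwise
    where
    pointwise : ∀ n → seq (0ʳ ⊕ x) n ≡ seq (x) n
    pointwise n rewrite seq-⊕ 0ʳ x n | seq-0ʳ n = ℚ.+-identityˡ (seq x n)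

  ⊕-inverseˡ : ∀ x → ⊖ x ⊕ x ≈ 0ʳ
  ⊕-inverseˡ x = ≈-pointwise _ _ pointwise
    where
    pointwise : ∀ n → seq (⊖ x ⊕ x) n ≡ seq (0ʳ) n
    pointwise n rewrite seq-⊕ (⊖ x) x n | seq-⊖ x n | seq-0ʳ n = ℚ.+-inverseˡ (seq x n)

  ⊗-assoc : ∀ x y z → x ⊗ y ⊗ z ≈ x ⊗ (y ⊗ z)
  ⊗-assoc x y z = ≈-pointwise _ _ pointwise
    where
    pointwise : ∀ n → seq (x ⊗ y ⊗ z) n ≡ seq (x ⊗ (y ⊗ z)) n
    pointwise n rewrite seq-⊗ (x ⊗ y) z n | seq-⊗ x (y ⊗ z) n | seq-⊗ x y n | seq-⊗ y z n = ℚ.*-assoc (seq x n) (seq y n) (seq z n)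

  ⊗-comm : ∀ x y → x ⊗ y ≈ y ⊗ x
  ⊗-comm x y = ≈-pointwise _ _ pointwise
    where
    pointwise : ∀ n → seq (x ⊗ y) n ≡ seq (y ⊗ x) n
    pointwise n rewrite seq-⊗ x y n | seq-⊗ y x n = ℚ.*-comm (seq x n) (seq y n)

  ⊗-identityˡ : ∀ x → 1ʳ ⊗ x ≈ x
  ⊗-identityˡ x = ≈-pointwise _ _ pointwise
    where
    pointwise : ∀ n → seq (1ʳ ⊗ x) n ≡ seq (x) n
    pointwise n rewrite seq-⊗ 1ʳ x n | seq-1ʳ n = ℚ.*-identityˡ (seq x n)

  ⊗-distribˡ-⊕ : ∀ x y z → x ⊗ (y ⊕ z) ≈ x ⊗ y ⊕ x ⊗ z
  ⊗-distribˡ-⊕ x y z = ≈-pointwise _ _ pointwise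
    where
    pointwise : ∀ n → seq (x ⊗ (y ⊕ z)) n ≡ seq (x ⊗ y ⊕ x ⊗ z) n
    pointwise n rewrite seq-⊗ x (y ⊕ z) n | seq-⊕ y z n | seq-⊕ (x ⊗ y) (x ⊗ z) n | seq-⊗ x y n | seq-⊗ x z n = ℚ.*-distribˡ-+ (seq x n) (seq y n) (seq z n)

  open Algebra.Consequences.Setoid ℝ-setoid using (comm∧idˡ⇒id; comm∧invˡ⇒inv; comm∧distrˡ⇒distr)

  ℝ-commutativeRing : CommutativeRing 0ℓ 0ℓ
  ℝ-commutativeRing = record
    { Carrier = ℝ ; _≈_ = _≈_ ; _+_ = _⊕_ ; _*_ = _⊗_ ; -_ = ⊖_ ; 0# = 0ʳ ; 1# = 1ʳ
    ; isCommutativeRing = record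
      { isRing = record
        { +-isAbelianGroup = record
          { isGroup = record
            { isMonoid = record
              { isSemigroup = record
                { isMagma = record
                  { isEquivalence = Setoid.isEquivalence ℝ-setoid
                  ; ∙-cong = ⊕-cong }
                ; assoc = ⊕-assoc }
              ; identity = comm∧idˡ⇒id ⊕-comm ⊕-identityˡ }
            ; inverse = comm∧invˡ⇒inv ⊕-comm ⊕-inverseˡ
            ; ⁻¹-cong = ⊖-cong }
          ; comm = ⊕-comm }
        ; *-cong = ⊗-cong
        ; *-assoc = ⊗-assoc
        ; *-identity = comm∧idˡ⇒id ⊗-comm ⊗-identityˡ
        ; distrib = comm∧distrˡ⇒distr ⊕-cong ⊗-comm ⊗-distribˡ-⊕ }
      ; *-comm = ⊗-comm } }

  ≤-reflexive : ∀ {x y} → x ≈ y → x ≤ y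
  ≤-reflexive {x} {y} (mk≈ p) = mk≤ λ ε ε>0 → let N , h = p ε ε>0 in N , λ n N≤n →
    ∣p-q∣<ε⇒p<q+ε (seq x n) (seq y n) (h n N≤n)

  ≤-trans : ∀ {x y z} → x ≤ y → y ≤ z → x ≤ z
  ≤-trans {x} {y} {z} (mk≤ p) (mk≤ q) = mk≤ λ ε ε>0 →
    let M , h = p (½ ℚ.* ε) (½ε>0 ε>0)
        N , g = q (½ ℚ.* ε) (½ε>0 ε>0)
    in M ℕ.⊔ N , λ n le → ℚ.<-trans (h n (ℕ.m⊔n≤o⇒m≤o M N le))
      (subst (seq y n ℚ.+ ½ ℚ.* ε ℚ.<_)
        (solve 2 (λ z ε → z :+ con ½ :* ε :+ con ½ :* ε := z :+ ε) refl (seq z n) ε)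
        (ℚ.+-monoˡ-< (½ ℚ.* ε) (g n (ℕ.m⊔n≤o⇒n≤o M N le))))
    where open +-*-Solver

  ≤-antisym : ∀ {x y} → x ≤ y → y ≤ x → x ≈ y
  ≤-antisym {x} {y} (mk≤ p) (mk≤ q) = mk≈ λ ε ε>0 →
    let M , h = p ε ε>0
        N , g = q ε ε>0
    in M ℕ.⊔ N , λ n le → ∣p-q∣<ε (seq x n) (seq y n) (h n (ℕ.m⊔n≤o⇒m≤o M N le)) (g n (ℕ.m⊔n≤o⇒n≤o M N le))

  ≤-eventually : ∀ {x y} N → (∀ n → N ℕ.≤ n → seq x n ℚ.≤ seq y n) → x ≤ y
  ≤-eventually {x} {y} N p = mk≤ λ ε ε>0 → N , λ n N≤n → ℚ.≤-<-trans (p n N≤n)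
    (subst (ℚ._< seq y n ℚ.+ ε) (ℚ.+-identityʳ (seq y n)) (ℚ.+-monoʳ-< (seq y n) ε>0))

  <⇒≤ : ∀ {x y} → x < y → x ≤ y
  <⇒≤ {x} {y} (mk< g g>0 (N , p)) = ≤-eventually N λ n N≤n → ℚ.≤-trans
    (subst (ℚ._≤ seq x n ℚ.+ g) (ℚ.+-identityʳ (seq x n)) (ℚ.+-monoʳ-≤ (seq x n) (ℚ.<⇒≤ g>0)))
    (p n N≤n)

  -- Past both Cauchy thresholds for ε/4, a single index with yₙ ≥ xₙ + ε forces a gap of ε/2 ever
  -- after, that is x < y. Comparing rationals at each index thus decides.
  ≮⇒≥ : ∀ {x y} → ¬ x < y → y ≤ x
  ≮⇒≥ {x} {y} x≮y = mk≤ λ ε ε>0 →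
    let ε/4>0 = ½ε>0 (½ε>0 ε>0)
        M , h = cauchy x _ ε/4>0
        N , g = cauchy y _ ε/4>0
    in M ℕ.⊔ N , λ n le → decide ε ε>0 n
         (λ m le′ → h m n (ℕ.m⊔n≤o⇒m≤o M N (ℕ.≤-trans le le′)) (ℕ.m⊔n≤o⇒m≤o M N le))
         (λ m le′ → g m n (ℕ.m⊔n≤o⇒n≤o M N (ℕ.≤-trans le le′)) (ℕ.m⊔n≤o⇒n≤o M N le))
    where
    open +-*-Solver
    decide : ∀ ε → 0ℚ ℚ.< ε → ∀ n →
      (∀ m → n ℕ.≤ m → ∣ seq x m ℚ.- seq x n ∣ ℚ.< ½ ℚ.* (½ ℚ.* ε)) →
      (∀ m → n ℕ.≤ m → ∣ seq y m ℚ.- seq y n ∣ ℚ.< ½ ℚ.* (½ ℚ.* ε)) →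
      seq y n ℚ.< seq x n ℚ.+ ε
    decide ε ε>0 n h g with seq y n ℚ.<? seq x n ℚ.+ ε
    ... | yes y<x+ε = y<x+ε
    ... | no  y≮x+ε = contradiction (mk< (½ ℚ.* ε) (½ε>0 ε>0) (n , λ m n≤m → ℚ.<⇒≤ (far m n≤m))) x≮y
      where
      far : ∀ m → n ℕ.≤ m → seq x m ℚ.+ ½ ℚ.* ε ℚ.< seq y m
      far m n≤m = <-by-difference
        (ℚ.+-mono-<-≤ (ℚ.+-mono-< (p<q⇒0<q-p (∣p-q∣<ε⇒p<q+ε (seq x m) (seq x n) (h m n≤m))) (p<q⇒0<q-p (∣p-q∣<ε⇒q<p+ε (seq y m) (seq y n) (g m n≤m))))
          (p≤q⇒0≤q-p (ℚ.≮⇒≥ y≮x+ε)))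
        (solve 5 (λ a b c d ε → d :- (b :+ con ½ :* ε) :=
          (a :+ con ½ :* (con ½ :* ε) :- b) :+ (d :+ con ½ :* (con ½ :* ε) :- c) :+ (c :- (a :+ ε)))
          refl (seq x n) (seq x m) (seq y n) (seq y m) ε)

  ⊕-monoʳ-≤ : ∀ x {y z} → y ≤ z → x ⊕ y ≤ x ⊕ z
  ⊕-monoʳ-≤ x {y} {z} (mk≤ p) = mk≤ λ ε ε>0 → let N , h = p ε ε>0 in N , λ n N≤n →
    shift ε n (h n N≤n)
    where
    shift : ∀ ε n → seq y n ℚ.< seq z n ℚ.+ ε → seq (x ⊕ y) n ℚ.< seq (x ⊕ z) n ℚ.+ ε
    shift ε n h rewrite seq-⊕ x y n | seq-⊕ x z n =
      subst (seq x n ℚ.+ seq y n ℚ.<_) (≡.sym (ℚ.+-assoc (seq x n) (seq z n) ε)) (ℚ.+-monoʳ-< (seq x n) h)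

  ⊗-pos : ∀ {x y} → 0ʳ < x → 0ʳ < y → 0ʳ ≤ x ⊗ y
  ⊗-pos {x} {y} (mk< g g>0 (M , p)) (mk< h h>0 (N , q)) = ≤-eventually (M ℕ.⊔ N) λ n le →
    product n (nonNeg x n g>0 (p n (ℕ.m⊔n≤o⇒m≤o M N le))) (nonNeg y n h>0 (q n (ℕ.m⊔n≤o⇒n≤o M N le)))
    where
    nonNeg : ∀ x n {g} → 0ℚ ℚ.< g → seq 0ʳ n ℚ.+ g ℚ.≤ seq x n → 0ℚ ℚ.≤ seq x n
    nonNeg x n {g} g>0 le rewrite seq-0ʳ n =
      ℚ.≤-trans (ℚ.<⇒≤ g>0) (ℚ.≤-trans (ℚ.≤-reflexive (≡.sym (ℚ.+-identityˡ g))) le)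
    product : ∀ n → 0ℚ ℚ.≤ seq x n → 0ℚ ℚ.≤ seq y n → seq 0ʳ n ℚ.≤ seq (x ⊗ y) n
    product n 0≤x 0≤y rewrite seq-0ʳ n | seq-⊗ x y n = subst (ℚ._≤ seq x n ℚ.* seq y n) (ℚ.*-zeroʳ (seq x n))
      (ℚ.*-monoˡ-≤-nonNeg (seq x n) {{ℚ.nonNegative 0≤x}} 0≤y)

  module _ (em : ExcludedMiddle 0ℓ) where

    -- A sequence representing a nonnegative real may have negative terms. Excluded middle makes
    -- each factor either positive, hence with terms eventually positive, or equal to 0.
    ⊗-nonNeg : ∀ {x y} → 0ʳ ≤ x → 0ʳ ≤ y → 0ʳ ≤ x ⊗ y
    ⊗-nonNeg {x} {y} 0≤x 0≤y with em {P = 0ʳ < x} | em {P = 0ʳ < y}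
    ... | yes 0<x | yes 0<y = ⊗-pos 0<x 0<y
    ... | no 0≮x  | _       = ≤-reflexive (≈-sym (≈-trans
      (⊗-cong (≤-antisym (≮⇒≥ 0≮x) 0≤x) (≈-refl {y})) (CommutativeRing.zeroˡ ℝ-commutativeRing y)))
    ... | yes _   | no 0≮y  = ≤-reflexive (≈-sym (≈-trans
      (⊗-cong (≈-refl {x}) (≤-antisym (≮⇒≥ 0≮y) 0≤y)) (CommutativeRing.zeroʳ ℝ-commutativeRing x)))

    ≤-total : ∀ x y → x ≤ y ⊎ y ≤ x
    ≤-total x y with em {P = x < y}
    ... | yes x<y = inj₁ (<⇒≤ x<y)
    ... | no  x≮y = inj₂ (≮⇒≥ x≮y)

    ℝ-orderedRing : OrderedRing
    ℝ-orderedRing = record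
      { commutativeRing = ℝ-commutativeRing
      ; _≤_ = _≤_
      ; isTotalOrder = record
        { isPartialOrder = record
          { isPreorder = record
            { isEquivalence = Setoid.isEquivalence ℝ-setoid
            ; reflexive = ≤-reflexive
            ; trans = ≤-trans }
          ; antisym = ≤-antisym }
        ; total = ≤-total }
      ; +-monoʳ-≤ = ⊕-monoʳ-≤
      ; *-nonNeg = ⊗-nonNeg
      ; _≈?_ = λ x y → em }

-- Rational numerals and the Archimedean property.

module RationalOrder where

  open import Data.Integer.Base using (+_; -[1+_])
  open Rationals

  ℚ-orderedRing : OrderedRing
  ℚ-orderedRing = record
    { commutativeRing = ℚ.+-*-commutativeRing
    ; _≤_ = ℚ._≤_
    ; isTotalOrder = ℚ.≤-isTotalOrder
    ; +-monoʳ-≤ = ℚ.+-monoʳ-≤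
    ; *-nonNeg = λ {p} {q} 0≤p 0≤q → subst (ℚ._≤ p ℚ.* q) (ℚ.*-zeroʳ p)
        (ℚ.*-monoˡ-≤-nonNeg p {{ℚ.nonNegative 0≤p}} 0≤q)
    ; _≈?_ = ℚ._≟_ }

  module Q = OrderedRingProperties ℚ-orderedRing

  -- The fraction is normalised by a gcd that is stuck on a variable, so the equation is checked on
  -- unnormalised representatives.
  suc/1 : ∀ n → + suc n ℚ./ 1 ≡ 1ℚ ℚ.+ + n ℚ./ 1
  suc/1 n = ℚ.toℚᵘ-injective (begin
    ℚ.toℚᵘ (ℚ.fromℚᵘ (ℚᵘ.mkℚᵘ (+ suc n) 0))               ≈⟨ ℚ.toℚᵘ-fromℚᵘ (ℚᵘ.mkℚᵘ (+ suc n) 0) ⟩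
    ℚᵘ.mkℚᵘ (+ suc n) 0                                   ≈⟨ ℚᵘ.*≡* (cong (λ k → (+ 1 ℤ.+ k) ℤ.* + 1) (≡.sym (ℤ.*-identityʳ (+ n)))) ⟩
    ℚᵘ.1ℚᵘ ℚᵘ.+ ℚᵘ.mkℚᵘ (+ n) 0                           ≈⟨ ℚᵘ.+-congʳ ℚᵘ.1ℚᵘ (ℚ.toℚᵘ-fromℚᵘ (ℚᵘ.mkℚᵘ (+ n) 0)) ⟨
    ℚᵘ.1ℚᵘ ℚᵘ.+ ℚ.toℚᵘ (ℚ.fromℚᵘ (ℚᵘ.mkℚᵘ (+ n) 0))       ≈⟨ ℚ.toℚᵘ-homo-+ 1ℚ (ℚ.fromℚᵘ (ℚᵘ.mkℚᵘ (+ n) 0)) ⟨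
    ℚ.toℚᵘ (1ℚ ℚ.+ ℚ.fromℚᵘ (ℚᵘ.mkℚᵘ (+ n) 0))            ∎)
    where open ℚᵘ.≃-Reasoning

  n/1≡#n : ∀ n → + n ℚ./ 1 ≡ Q.# n
  n/1≡#n zero    = refl
  n/1≡#n (suc n) = ≡.trans (suc/1 n) (≡.trans (cong (1ℚ ℚ.+_) (n/1≡#n n)) (≡.sym (Q.1+× n 1ℚ)))

  archimedean : ∀ p → ∃[ n ] p ℚ.≤ Q.# n
  archimedean p@(ℚ.mkℚ (-[1+ k ]) _ _) = 0 , ℚ.<⇒≤ (ℚ.negative⁻¹ p)
  archimedean p@(ℚ.mkℚ (+ n) d-1 _) = n , subst (p ℚ.≤_) (n/1≡#n n) (ℚ.toℚᵘ-cancel-≤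
    (ℚᵘ.≤-respʳ-≃ (ℚᵘ.≃-sym (ℚ.toℚᵘ-fromℚᵘ (ℚᵘ.mkℚᵘ (+ n) 0)))
      (ℚᵘ.*≤* (ℤ.*-monoˡ-≤-nonNeg (+ n) (ℤ.+≤+ (ℕ.s≤s (ℕ.z≤n {d-1})))))))

-- Cube roots by bisection.

module CubeRoot {a : ℚ} (0≤a : 0ℚ ℚ.≤ a) where

  open Rationals
  open RationalOrder

  cube : ℚ → ℚ
  cube p = p ℚ.* (p ℚ.* p)

  -- Bisection: the cube root of a stays between x m and x m + h m.
  h x : ℕ → ℚ
  h zero    = 1ℚ ℚ.+ a
  h (suc m) = ½ ℚ.* h m
  x zero    = 0ℚ
  x (suc m) with cube (x m ℚ.+ h (suc m)) ℚ.≤? a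
  ... | yes _ = x m ℚ.+ h (suc m)
  ... | no _  = x m

  h>0 : ∀ m → 0ℚ ℚ.< h m
  h>0 zero    = ℚ.+-mono-<-≤ (ℚ.positive⁻¹ 1ℚ) 0≤a
  h>0 (suc m) = ½ε>0 (h>0 m)

  h≥0 : ∀ m → 0ℚ ℚ.≤ h m
  h≥0 m = ℚ.<⇒≤ (h>0 m)

  step : ∀ m →
    (x (suc m) ≡ x m ℚ.+ h (suc m) × cube (x m ℚ.+ h (suc m)) ℚ.≤ a) ⊎
    (x (suc m) ≡ x m × a ℚ.≤ cube (x m ℚ.+ h (suc m)))
  step m with cube (x m ℚ.+ h (suc m)) ℚ.≤? a
  ... | yes le = inj₁ (refl , le)
  ... | no ≰   = inj₂ (refl , ℚ.<⇒≤ (ℚ.≰⇒> ≰))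

  double : ∀ m → x m ℚ.+ h (suc m) ℚ.+ h (suc m) ≡ x m ℚ.+ h m
  double m = solve 2 (λ x h → x :+ con ½ :* h :+ con ½ :* h := x :+ h) refl (x m) (h m)
    where open +-*-Solver

  lower : ∀ m → cube (x m) ℚ.≤ a
  lower zero = 0≤a
  lower (suc m) with x (suc m) | step m
  ... | _ | inj₁ (refl , le) = le
  ... | _ | inj₂ (refl , _)  = lower m

  upper : ∀ m → a ℚ.≤ cube (x m ℚ.+ h m)
  -- The initial bracket is [0, 1 + a], as a ≤ (1 + a)³.
  upper zero = Q.≤-by-difference
    (Q.+-nonNeg (Q.+-nonNeg (Q.+-nonNeg (Q.#-nonNeg 1) (Q.*-nonNeg (Q.#-nonNeg 2) 0≤a)) (Q.*-nonNeg (Q.#-nonNeg 3) (Q.sq-nonNeg a)))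
      (Q.*-nonNeg 0≤a (Q.sq-nonNeg a)))
    (solve 1 (λ a → (con 0ℚ :+ (con 1ℚ :+ a)) :* ((con 0ℚ :+ (con 1ℚ :+ a)) :* (con 0ℚ :+ (con 1ℚ :+ a))) :- a :=
      con (Q.# 1) :+ con (Q.# 2) :* a :+ con (Q.# 3) :* (a :* a) :+ a :* (a :* a)) refl a)
    where open +-*-Solver
  upper (suc m) with x (suc m) | step m
  ... | _ | inj₁ (refl , _)  = subst (λ t → a ℚ.≤ cube t) (≡.sym (double m)) (upper m)
  ... | _ | inj₂ (refl , le) = le

  x-step : ∀ m → x m ℚ.≤ x (suc m)
  x-step m with x (suc m) | step m
  ... | _ | inj₁ (refl , _) = Q.≤-by-difference (h≥0 (suc m))
    (solve 2 (λ x h → x :+ h :- x := h) refl (x m) (h (suc m)))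
    where open +-*-Solver
  ... | _ | inj₂ (refl , _) = ℚ.≤-refl

  x+h-step : ∀ m → x (suc m) ℚ.+ h (suc m) ℚ.≤ x m ℚ.+ h m
  x+h-step m with x (suc m) | step m
  ... | _ | inj₁ (refl , _) = ℚ.≤-reflexive (double m)
  ... | _ | inj₂ (refl , _) = Q.≤-by-difference (h≥0 (suc m))
    (solve 2 (λ x h → x :+ h :- (x :+ con ½ :* h) := con ½ :* h) refl (x m) (h m))
    where open +-*-Solver

  x-mono : ∀ {m n} → m ℕ.≤′ n → x m ℚ.≤ x n
  x-mono ℕ.≤′-refl       = ℚ.≤-refl
  x-mono (ℕ.≤′-step {n} m≤n) = ℚ.≤-trans (x-mono m≤n) (x-step n)

  x+h-antitone : ∀ {m n} → m ℕ.≤′ n → x n ℚ.+ h n ℚ.≤ x m ℚ.+ h m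
  x+h-antitone ℕ.≤′-refl       = ℚ.≤-refl
  x+h-antitone (ℕ.≤′-step {n} m≤n) = ℚ.≤-trans (x+h-step n) (x+h-antitone m≤n)

  h-antitone : ∀ {m n} → m ℕ.≤′ n → h n ℚ.≤ h m
  h-antitone ℕ.≤′-refl             = ℚ.≤-refl
  h-antitone (ℕ.≤′-step {n} m≤n)   = ℚ.≤-trans
    (Q.≤-by-difference (h≥0 (suc n)) (solve 1 (λ h → h :- con ½ :* h := con ½ :* h) refl (h n)))
    (h-antitone m≤n)
    where open +-*-Solver

  -- A Bernoulli-type estimate for halving, in the form that the Archimedean property can use; each
  -- step needs only (m + 2)/2 ≤ m + 1.
  h-harmonic : ∀ m → (1ℚ ℚ.+ Q.# m) ℚ.* h m ℚ.≤ h 0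
  h-harmonic zero    = ℚ.≤-reflexive (ℚ.*-identityˡ (h 0))
  h-harmonic (suc m) = ℚ.≤-trans (Q.≤-by-difference
    (Q.*-nonNeg (Q.*-nonNeg (ℚ.<⇒≤ (ℚ.positive⁻¹ ½)) (Q.#-nonNeg m)) (h≥0 m))
    (≡.trans (cong (λ t → (1ℚ ℚ.+ Q.# m) ℚ.* h m ℚ.- (1ℚ ℚ.+ t) ℚ.* (½ ℚ.* h m)) (Q.1+× m 1ℚ))
      (solve 2 (λ k h → (con 1ℚ :+ k) :* h :- (con 1ℚ :+ (con 1ℚ :+ k)) :* (con ½ :* h) := con ½ :* k :* h) refl (Q.# m) (h m))))
    (h-harmonic m)
    where open +-*-Solver

  h-null : ∀ ε → 0ℚ ℚ.< ε → ∃[ M ] (∀ m → M ℕ.≤ m → h m ℚ.< ε)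
  h-null ε ε>0 with quotient ε>0 (h>0 0)
  ... | q , _ , εq≡h₀ with archimedean q
  ...   | M , q≤M = M , λ m M≤m → ℚ.≤-<-trans (h-antitone (ℕ.≤⇒≤′ M≤m)) (ℚ.≰⇒> small)
    where
    open +-*-Solver
    -- Otherwise (1 + M) ε ≤ (1 + M) h M ≤ h 0 = ε q ≤ ε M, so ε ≤ 0.
    small : ¬ ε ℚ.≤ h M
    small ε≤h = ℚ.<-irrefl refl (ℚ.<-≤-trans ε>0 (Q.≤-by-difference
      (Q.+-nonNeg (Q.+-nonNeg (p≤q⇒0≤q-p (h-harmonic M))
        (Q.*-nonNeg (Q.+-nonNeg (Q.#-nonNeg 1) (Q.#-nonNeg M)) (p≤q⇒0≤q-p ε≤h)))
        (Q.*-nonNeg (ℚ.<⇒≤ ε>0) (p≤q⇒0≤q-p q≤M)))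
      (≡.trans (solve 4 (λ ε q M h → con 0ℚ :- ε := ((ε :* q) :- (con 1ℚ :+ M) :* h) :+ (con 1ℚ :+ M) :* (h :- ε) :+ ε :* (M :- q)) refl ε q (Q.# M) (h M))
        (cong (λ t → (t ℚ.- (1ℚ ℚ.+ Q.# M) ℚ.* h M) ℚ.+ (1ℚ ℚ.+ Q.# M) ℚ.* (h M ℚ.- ε) ℚ.+ ε ℚ.* (Q.# M ℚ.- q)) εq≡h₀))))

  p≤p+h : ∀ p m → p ℚ.≤ p ℚ.+ h m
  p≤p+h p m = Q.≤-by-difference {p} {p ℚ.+ h m} (h≥0 m) (solve 2 (λ p h → p :+ h :- p := h) refl p (h m))
    where open +-*-Solver

  x-cauchy : IsCauchy x
  x-cauchy ε ε>0 = let M , h<ε = h-null ε ε>0 in M , λ m n M≤m M≤n →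
    ∣p-q∣<ε (x m) (x n) (close M (h<ε M ℕ.≤-refl) m n (ℕ.≤⇒≤′ M≤m) (ℕ.≤⇒≤′ M≤n))
      (close M (h<ε M ℕ.≤-refl) n m (ℕ.≤⇒≤′ M≤n) (ℕ.≤⇒≤′ M≤m))
    where
    close : ∀ M → h M ℚ.< ε → ∀ m n → M ℕ.≤′ m → M ℕ.≤′ n → x m ℚ.< x n ℚ.+ ε
    close M h<ε m n M≤m M≤n = begin-strict
      x m           ≤⟨ p≤p+h (x m) m ⟩
      x m ℚ.+ h m   ≤⟨ x+h-antitone M≤m ⟩
      x M ℚ.+ h M   ≤⟨ ℚ.+-monoˡ-≤ (h M) {x M} {x n} (x-mono M≤n) ⟩
      x n ℚ.+ h M   <⟨ ℚ.+-monoʳ-< (x n) {h M} {ε} h<ε ⟩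
      x n ℚ.+ ε     ∎
      where open ℚ.≤-Reasoning

  h-cauchy : IsCauchy h
  h-cauchy ε ε>0 = let M , h<ε = h-null ε ε>0 in M , λ m n M≤m M≤n →
    ∣p-q∣<ε (h m) (h n) (close m n (h<ε m M≤m)) (close n m (h<ε n M≤n))
    where
    close : ∀ m n → h m ℚ.< ε → h m ℚ.< h n ℚ.+ ε
    close m n h<ε = begin-strict
      h m         <⟨ h<ε ⟩
      ε           ≤⟨ p≤p+h ε n ⟩
      ε ℚ.+ h n   ≡⟨ ℚ.+-comm ε (h n) ⟩
      h n ℚ.+ ε   ∎
      where open ℚ.≤-Reasoning

  open RealRing

  root step-size : ℝ
  root      = mkℝ x x-cauchy
  step-size = mkℝ h h-cauchy

  root-nonNeg : 0ℝ ≤ root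
  root-nonNeg = ≤-eventually 0 λ n _ → x-mono (ℕ.≤⇒≤′ (ℕ.z≤n {n}))

  step-size≈0 : step-size ≈ 0ʳ
  step-size≈0 = mk≈ λ ε ε>0 → let M , h<ε = h-null ε ε>0 in M , λ n M≤n → close ε n (h<ε n M≤n)
    where
    open +-*-Solver
    close : ∀ ε n → h n ℚ.< ε → ∣ h n ℚ.- seq 0ʳ n ∣ ℚ.< ε
    close ε n h<ε = subst (ℚ._< ε)
      (≡.trans (≡.sym (ℚ.0≤p⇒∣p∣≡p (h≥0 n))) (cong ∣_∣ (≡.trans (solve 1 (λ h → h := h :- con 0ℚ) refl (h n)) (cong (λ t → h n ℚ.- t) (≡.sym (seq-0ʳ n))))))
      h<ε

  -- The lower ends of the brackets give one inequality. The upper ends represent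
  -- `root ⊕ step-size`, which is the same real because the widths tend to 0, and give the other.
  root³ : root ⊗ (root ⊗ root) ≈ fromℚ a
  root³ = ≤-antisym below (≤-trans above (≤-reflexive (⊗-cong shift (⊗-cong shift shift))))
    where
    open CommutativeRing ℝ-commutativeRing using (+-identityʳ)
    s : ℝ
    s = root ⊕ step-size
    shift : s ≈ root
    shift = ≈-trans (⊕-cong (≈-refl {root}) step-size≈0) (+-identityʳ root)
    seq-cube : ∀ r n → seq (r ⊗ (r ⊗ r)) n ≡ cube (seq r n)
    seq-cube r n = ≡.trans (seq-⊗ r (r ⊗ r) n) (cong (seq r n ℚ.*_) (seq-⊗ r r n))
    below : root ⊗ (root ⊗ root) ≤ fromℚ a
    below = ≤-eventually {root ⊗ (root ⊗ root)} {fromℚ a} 0 λ n _ → subst (ℚ._≤ a) (≡.sym (seq-cube root n)) (lower n)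
    above : fromℚ a ≤ s ⊗ (s ⊗ s)
    above = ≤-eventually {fromℚ a} {s ⊗ (s ⊗ s)} 0 λ n _ → subst (a ℚ.≤_)
      (≡.sym (≡.trans (seq-cube s n) (cong cube (seq-⊕ root step-size n)))) (upper n)

-- Transfer between the opaque operations and the operations of the statement.

module RealOperations where

  open import Data.Integer.Base using (+_)
  open RealRing
  open RationalOrder

  ⊗-^ : ∀ x y n → y ≈ x ^ n → x ⊗ y ≈ x ^ suc n
  ⊗-^ x y n y≈x^n = ≈-trans (⊗-cong (≈-refl {x}) y≈x^n) (≈-pointwise (x ⊗ x ^ n) (x ^ suc n) λ m → seq-⊗ x (x ^ n) m)

  1ʳ≈^0 : ∀ x → 1ʳ ≈ x ^ 0
  1ʳ≈^0 x = ≈-pointwise 1ʳ (x ^ 0) seq-1ʳ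

  ^1 : ∀ x → x ≈ x ^ 1
  ^1 x = ≈-trans (≈-sym (CommutativeRing.*-identityʳ ℝ-commutativeRing x)) (⊗-^ x 1ʳ 0 (1ʳ≈^0 x))

  ^2 : ∀ x → x ⊗ x ≈ x ^ 2
  ^2 x = ⊗-^ x x 1 (^1 x)

  ^3 : ∀ x → x ⊗ (x ⊗ x) ≈ x ^ 3
  ^3 x = ⊗-^ x (x ⊗ x) 2 (^2 x)

  ^4 : ∀ x → x ⊗ (x ⊗ (x ⊗ x)) ≈ x ^ 4
  ^4 x = ⊗-^ x (x ⊗ (x ⊗ x)) 3 (^3 x)

  seq-difference : ∀ x y n → seq (x ⊕ ⊖ y) n ≡ seq x n ℚ.- seq y n
  seq-difference x y n = ≡.trans (seq-⊕ x (⊖ y) n) (cong (seq x n ℚ.+_) (seq-⊖ y n))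

  fromℕ-suc : ∀ n → fromℕ (suc n) ≈ 1ʳ ⊕ fromℕ n
  fromℕ-suc n = ≈-pointwise _ _ λ m → ≡.trans (suc/1 n)
    (≡.sym (≡.trans (seq-⊕ 1ʳ (fromℕ n) m) (cong (λ t → t ℚ.+ (+ n ℚ./ 1)) (seq-1ʳ m))))

  fromℚ-* : ∀ p q → fromℚ (p ℚ.* q) ≈ fromℚ p ⊗ fromℚ q
  fromℚ-* p q = ≈-pointwise _ _ λ m → ≡.sym (seq-⊗ (fromℚ p) (fromℚ q) m)

  1≰0 : ¬ 1ʳ ≤ 0ʳ
  1≰0 (mk≤ p) = let N , h = p 1ℚ (ℚ.positive⁻¹ 1ℚ) in ℚ.<-irrefl refl
    (subst₂ ℚ._<_ (seq-1ʳ N) (≡.trans (cong (ℚ._+ 1ℚ) (seq-0ʳ N)) (ℚ.+-identityˡ 1ℚ)) (h N ℕ.≤-refl))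

  d⁴ : ℕ → ℚ
  d⁴ d = q ℚ.* (q ℚ.* (q ℚ.* q))
    where
    q : ℚ
    q = + d ℚ./ 1

  fromℚ-d⁴ : ∀ d → fromℚ (d⁴ d) ≈ fromℕ d ⊗ (fromℕ d ⊗ (fromℕ d ⊗ fromℕ d))
  fromℚ-d⁴ d = ≈-trans (fromℚ-* q (q ℚ.* (q ℚ.* q))) (⊗-cong (≈-refl {fromℚ q})
    (≈-trans (fromℚ-* q (q ℚ.* q)) (⊗-cong (≈-refl {fromℚ q}) (fromℚ-* q q))))
    where
    q : ℚ
    q = + d ℚ./ 1

  d⁴-nonNeg : ∀ d → 0ℚ ℚ.≤ d⁴ d
  d⁴-nonNeg d = Q.*-nonNeg 0≤q (Q.*-nonNeg 0≤q (Q.sq-nonNeg q))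
    where
    q : ℚ
    q = + d ℚ./ 1
    0≤q : 0ℚ ℚ.≤ q
    0≤q = subst (0ℚ ℚ.≤_) (≡.sym (n/1≡#n d)) (Q.#-nonNeg d)

  -- The bisection is run on the rational number d⁴.
  four-thirds-power : ∀ d → ∃[ r ] r IsFourThirdsPowerOf d
  four-thirds-power d = root , root-nonNeg ,
    ≈-trans {root ^ 3} {root ⊗ (root ⊗ root)} {fromℕ d ^ 4} (≈-sym (^3 root))
      (≈-trans root³ (≈-trans (fromℚ-d⁴ d) (^4 (fromℕ d))))
    where open CubeRoot (d⁴-nonNeg d)

-- Cardinality from a maximal family of distinct points.

module Maximal (em : ExcludedMiddle 0ℓ) where

  -- The search climbs from 0 until a successor fails; the invariant M ≤ fuel + n makes exhausted
  -- fuel contradict the bound.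
  maximum : (P : ℕ → Set) → P 0 → ∀ M → (∀ n → P n → n ℕ.≤ M) → ∃[ n ] P n × ¬ P (suc n)
  maximum P P0 M bound = search M 0 P0 (ℕ.≤-reflexive (≡.sym (ℕ.+-identityʳ M)))
    where
    search : ∀ fuel n → P n → M ℕ.≤ fuel ℕ.+ n → ∃[ n ] P n × ¬ P (suc n)
    search fuel n Pn M≤ with em {P = P (suc n)}
    search fuel       n Pn M≤ | no ¬Psn = n , Pn , ¬Psn
    search zero       n Pn M≤ | yes Psn = contradiction (ℕ.≤-trans (bound (suc n) Psn) M≤) (ℕ.n≮n n)
    search (suc fuel) n Pn M≤ | yes Psn =
      search fuel (suc n) Psn (ℕ.≤-trans M≤ (ℕ.≤-reflexive (≡.sym (ℕ.+-suc fuel n))))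

  module _ {d : ℕ} (V : Subset d) where

    private module V = Setoid (Subset.setoid V)

    DistinctFamily : ℕ → Set
    DistinctFamily n = ∃ λ (f : Fin n → V.Carrier) → ∀ i j → f i V.≈ f j → i ≡ j

    -- A point missed by the family could be adjoined to it, so maximality gives surjectivity.
    maximal⇒cardinality : ∀ {n} → DistinctFamily n → ¬ DistinctFamily (suc n) → HasCardinality V n
    maximal⇒cardinality {n} (f , f-injective) maximal = record
      { to = f
      ; cong = λ { {i} refl → V.refl {f i} }
      ; bijective = (λ {i} {j} → f-injective i j) , surjective }
      where
      surjective : ∀ v → ∃[ i ] (∀ {j} → j ≡ i → f j V.≈ v)
      surjective v with em {P = ∃[ i ] f i V.≈ v}
      ... | yes (i , fi≈v) = i , λ { refl → fi≈v }
      ... | no missed      = contradiction (g , g-injective) maximal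
        where
        g : Fin (suc n) → V.Carrier
        g zero    = v
        g (suc i) = f i
        g-injective : ∀ i j → g i V.≈ g j → i ≡ j
        g-injective zero    zero    _ = refl
        g-injective zero    (suc j) e = contradiction (j , V.sym {v} {f j} e) missed
        g-injective (suc i) zero    e = contradiction (i , e) missed
        g-injective (suc i) (suc j) e = cong suc (f-injective i j e)


-- Almost-equidistant sets in Euclidean space.

module RealBound (em : ExcludedMiddle 0ℓ) where

  open RealRing
  open RealOperations
  open Maximal em

  private
    module O = OrderedRingProperties (ℝ-orderedRing em)

  #≈fromℕ : ∀ n → O.# n ≈ fromℕ n
  #≈fromℕ zero    = ≈-pointwise 0ʳ (fromℕ 0) seq-0ʳ
  #≈fromℕ (suc n) = ≈-trans (O.1+× n 1ʳ) (≈-trans (⊕-cong (≈-refl {1ʳ}) (#≈fromℕ n)) (≈-sym (fromℕ-suc n)))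

  ∑≈sum : ∀ {d} (f g : Fin d → ℝ) → (∀ c → f c ≈ g c) → O.∑ f ≈ sum g
  ∑≈sum {zero}  f g f≈g = ≈-pointwise 0ʳ (sum g) seq-0ʳ
  ∑≈sum {suc d} f g f≈g = ≈-trans
    (⊕-cong (f≈g zero) (∑≈sum (λ c → f (suc c)) (λ c → g (suc c)) (λ c → f≈g (suc c))))
    (≈-pointwise (g zero ⊕ sum (λ c → g (suc c))) (sum g) (seq-⊕ (g zero) (sum (λ c → g (suc c)))))

  unit-distance⇒0 : ∀ {d} (x y : Point d) → UnitDistance x y →
    1ʳ ⊕ ⊖ O.∑ (λ c → (x c ⊕ ⊖ y c) ⊗ (x c ⊕ ⊖ y c)) ≈ 0ʳ
  unit-distance⇒0 {d} x y (_ , unit) = ≈-trans (⊕-cong 1≈∑ ≈-refl) (O.-‿inverseʳ S)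
    where
    S : ℝ
    S = O.∑ (λ c → (x c ⊕ ⊖ y c) ⊗ (x c ⊕ ⊖ y c))
    squares : Point d
    squares = map (_^ 2) (zipWith Defs._-_ x y)
    squared : ∀ c → (x c ⊕ ⊖ y c) ⊗ (x c ⊕ ⊖ y c) ≈ squares c
    squared c = ≈-pointwise (u c ⊗ u c) (squares c) λ m →
      ≡.trans (seq-⊗ (u c) (u c) m) (pointwise (seq-difference (x c) (y c) m))
      where
      u : Fin d → ℝ
      u c = x c ⊕ ⊖ y c
      pointwise : ∀ {p q} → p ≡ q → p ℚ.* p ≡ q ℚ.* (q ℚ.* 1ℚ)
      pointwise {p} refl = cong (p ℚ.*_) (≡.sym (ℚ.*-identityʳ p))
    S≈sum : S ≈ sum squares
    S≈sum = ∑≈sum _ squares squared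
    1≈∑ : 1ʳ ≈ S
    1≈∑ = ≈-trans (≈-pointwise 1ʳ (1ℝ ^ 2) seq-1ʳ) (≈-trans {1ℝ ^ 2} {sum squares} {S} unit (≈-sym S≈sum))

  module _ {d : ℕ} (1≤d : 1 ℕ.≤ d) (V : Subset d) (almostEquidistant : AlmostEquidistant V) where

    family-bound : ∀ n → DistinctFamily V n →
      O.# n ⊗ (O.# n ⊗ O.# n) ≤ O.# 728 ⊗ (O.# 728 ⊗ O.# 728) ⊗ (O.# d ⊗ O.# d ⊗ (O.# d ⊗ O.# d))
    family-bound n (f , f-injective) =
      AlmostEquidistantBound.almost-equidistant-bound (ℝ-orderedRing em) n (1≤#d 1≤d) p sparse
      where
      1≤#d : ∀ {d} → 1 ℕ.≤ d → 1ʳ ≤ O.# d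
      1≤#d {suc d-1} _ = NaturalBounds.1≤#suc (ℝ-orderedRing em) d-1
      p : Fin n → Fin d → ℝ
      p i = proj₁ (f i)
      a : Fin n → Fin n → ℝ
      a = UnitDistanceForm.a (ℝ-orderedRing em) p
      distinct : ∀ {i j} → ¬ i ≡ j → p i ≋̸ p j
      distinct {i} {j} i≢j e = i≢j (f-injective i j e)
      sparse : ∀ i j l → ¬ i ≡ j → ¬ j ≡ l → ¬ i ≡ l → a i j ≈ 0ʳ ⊎ a j l ≈ 0ʳ ⊎ a i l ≈ 0ʳ
      sparse i j l i≢j j≢l i≢l = Sum.map (unit-distance⇒0 (p i) (p j))
        (Sum.map (unit-distance⇒0 (p j) (p l)) (unit-distance⇒0 (p i) (p l)))
        (almostEquidistant (p i) (p j) (p l) (proj₂ (f i)) (proj₂ (f j)) (proj₂ (f l))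
          (distinct i≢j) (distinct j≢l) (distinct i≢l))

    maximal-family : ∃[ n ] DistinctFamily V n × ¬ DistinctFamily V (suc n)
    -- Finiteness of V is obtained here: the search starts at the empty family and is stopped by the
    -- crude bound 728³ d⁴.
    maximal-family = maximum (DistinctFamily V) ((λ ()) , λ ()) (728 ℕ.* (728 ℕ.* 728) ℕ.* (d ℕ.* d ℕ.* (d ℕ.* d)))
      λ n family → NaturalBounds.cube-bound-ℕ (ℝ-orderedRing em) 1≰0 n 728 d (family-bound n family)

    family-bound-4/3 : ∀ n → DistinctFamily V n → ∀ r → r IsFourThirdsPowerOf d → fromℕ n ≤ fromℕ 728 * r
    family-bound-4/3 n family r (0≤r , r³≈d⁴) = ≤-trans (≤-reflexive (≈-sym (#≈fromℕ n))) (≤-trans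
      (NaturalBounds.four-thirds-bound (ℝ-orderedRing em) n 728 {O.# d} {r} 0ʳ≤r r³≈#d⁴ (family-bound n family))
      (≤-reflexive (≈-trans (⊗-cong (#≈fromℕ 728) (≈-refl {r}))
        (≈-pointwise (fromℕ 728 ⊗ r) (fromℕ 728 * r) (seq-⊗ (fromℕ 728) r)))))
      where
      0ʳ≤r : 0ʳ ≤ r
      0ʳ≤r = ≤-trans (≤-reflexive (≈-pointwise 0ʳ 0ℝ seq-0ʳ)) 0≤r
      #d≈ : O.# d ≈ fromℕ d
      #d≈ = #≈fromℕ d
      r³≈#d⁴ : r ⊗ (r ⊗ r) ≈ O.# d ⊗ (O.# d ⊗ (O.# d ⊗ O.# d))
      r³≈#d⁴ = ≈-trans (^3 r) (≈-trans r³≈d⁴ (≈-trans (≈-sym (^4 (fromℕ d)))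
        (≈-sym (⊗-cong #d≈ (⊗-cong #d≈ (⊗-cong #d≈ #d≈))))))

    cardinality-bound : ∃[ n ] HasCardinality V n ×
      ∃[ r ] (r IsFourThirdsPowerOf d) × (fromℕ n ≤ fromℕ 728 * r)
    cardinality-bound =
      let n , family , no-larger = maximal-family
          r , r-spec = four-thirds-power d
      in n , maximal⇒cardinality V family no-larger , r , r-spec , family-bound-4/3 n family r r-spec

theorem1 : ExcludedMiddle 0ℓ →
    ∃[ K ] (0ℝ < K) ×
    (∀ (d : ℕ) → 1 ℕ.≤ d → (V : Subset d) → AlmostEquidistant V →
    ∃[ n ] HasCardinality V n ×
    ∃[ r ] (r IsFourThirdsPowerOf d) × (fromℕ n ≤ K * r))
-- The cubic bound reads n³ ≤ 728³ d⁴, so its cube root carries the same constant.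
theorem1 em = fromℕ 728 , 0<728 , λ d 1≤d V → RealBound.cardinality-bound em 1≤d V
  where
  open import Data.Integer.Base using (+_)
  0<728 : 0ℝ < fromℕ 728
  0<728 = mk< (+ 728 ℚ./ 1) (ℚ.positive⁻¹ (+ 728 ℚ./ 1)) (0 , λ _ _ → ℚ.≤-reflexive (ℚ.+-identityˡ (+ 728 ℚ./ 1)))
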